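{- For any prime $p\equiv 1\pmod 4$, $$\left(\frac{\sqrt{S_{3+\frac{p-1}{2},2}(-1,p)}}{p}\right)=(-1)^{\left|\left\{0<r<\frac{p}{4}\,:\,\left(\frac{r}{p}\right)=-1\right\}\right|}\left(\frac{p}{4+(-1)^{\frac{p-1}{4}}}\right),$$ where $r$ ranges over integers.
   Context: For an odd prime $p$, let $\alpha_1,\ldots,\alpha_{(p-1)/2}$ be integers representing the distinct (nonzero) quadratic residues modulo $p$, and for $n\in\mathbb{N}$, $d\in\mathbb{Z}$ put $$S_{n,2}(d,p)=\det\left[(\alpha_i+d\,\alpha_j)^n\right]_{1\le i,j\le \frac{p-1}{2}}.$$ When $p\equiv 1\pmod 4$ and $n$ is odd, $S_{n,2}(-1,p)$ is the determinant of a skew-symmetric integer matrix of even order, hence the square of an integer, and $\sqrt{S_{n,2}(-1,p)}$ denotes its integer square root (the sign is immaterial inside the Legendre symbol since $p\equiv 1\pmod 4$). $\left(\frac{\cdot}{p}\right)$ is the Legendre symbol, and $\left(\frac{p}{4+(-1)^{(p-1)/4}}\right)$ is the Legendre symbol modulo the prime $5$ or $3$. -}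

module Defs where

open import Data.Bool.Base using (if_then_else_)
open import Data.Fin.Base using (Fin; zero; suc; toℕ; fromℕ<; punchIn)
open import Data.Fin.Properties using (any?; toℕ-fromℕ<)
open import Data.Integer.Base using (ℤ; +_; _+_; _-_; _*_; _^_; 0ℤ; 1ℤ; -1ℤ; _%ℕ_; _/ℕ_)
open import Data.Integer.Divisibility.Signed using (_∣_; _∣?_; divides; ∣m⇒∣m*n; ∣m∣n⇒∣m-n)
open import Data.Integer.DivMod using (n%ℕd<d; a≡a%ℕn+[a/ℕn]*n)
import Data.Integer.Properties as ℤ
open import Data.Integer.Tactic.RingSolver using (solve-∀)
open import Data.List.Base using (length; filter; upTo)
open import Data.Nat.Base as ℕ using (ℕ; zero; suc; NonZero)
open import Data.Nat.Properties using (_<?_)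
open import Data.Product.Base using (_×_; _,_; ∃; ∃-syntax)
open import Relation.Binary.PropositionalEquality
  using (_≡_; refl; sym; trans; cong; subst)
open import Relation.Nullary.Decidable using (Dec; does; map′; ¬?; _×-dec_)
open import Relation.Nullary.Negation using (¬_)

open import Algebra.Properties.CommutativeMonoid.Sum ℤ.+-0-commutativeMonoid using (sum)

infix 4 _≡_[mod_]

_≡_[mod_] : ℤ → ℤ → ℕ → Set
a ≡ b [mod n ] = + n ∣ (a - b)

-- Residues are nonzero by convention.
QuadraticResidue : ℕ → ℤ → Set
QuadraticResidue n a = ¬ (+ n ∣ a) × ∃[ x ] (x * x ≡ a [mod n ])

square-mod? : ∀ n .{{_ : NonZero n}} a → Dec (∃[ x ] (x * x ≡ a [mod n ]))
square-mod? n a = map′ from to (any? λ i → + n ∣? (+ toℕ i * + toℕ i - a))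
  where
  from : (∃ λ (i : Fin n) → + toℕ i * + toℕ i ≡ a [mod n ]) →
         ∃[ x ] (x * x ≡ a [mod n ])
  from (i , i²≡a) = + toℕ i , i²≡a

  to : ∃[ x ] (x * x ≡ a [mod n ]) →
       ∃ λ (i : Fin n) → + toℕ i * + toℕ i ≡ a [mod n ]
  to (x , x²≡a) = fromℕ< (n%ℕd<d x n) ,
    subst (λ k → + k * + k ≡ a [mod n ]) (sym (toℕ-fromℕ< (n%ℕd<d x n))) r²≡a
    where
    r = + (x %ℕ n)

    cancel : ∀ r q → (r + q) - r ≡ q
    cancel = solve-∀

    factor : ∀ x r a → (x * x - a) - (x - r) * (x + r) ≡ r * r - a
    factor = solve-∀

    x≡r : x ≡ r [mod n ]
    x≡r = divides (x /ℕ n)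
      (trans (cong (_- r) (a≡a%ℕn+[a/ℕn]*n x n)) (cancel r (x /ℕ n * + n)))

    r²≡a : r * r ≡ a [mod n ]
    r²≡a = subst (+ n ∣_) (factor x r a) (∣m∣n⇒∣m-n x²≡a (∣m⇒∣m*n (x + r) x≡r))

quadraticResidue? : ∀ n .{{_ : NonZero n}} a → Dec (QuadraticResidue n a)
quadraticResidue? n a = ¬? (+ n ∣? a) ×-dec square-mod? n a

-- The value at modulus 0 is junk; only odd prime moduli are meaningful.
legendre : ℤ → ℕ → ℤ
legendre a zero = 0ℤ
legendre a p@(suc _) =
  if does (+ p ∣? a) then 0ℤ else
  if does (quadraticResidue? p a) then 1ℤ else -1ℤ

record RepresentsQuadraticResidues (p : ℕ) {m : ℕ} (α : Fin m → ℤ) : Set where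
  field
    residue  : ∀ i → QuadraticResidue p (α i)
    distinct : ∀ i j → α i ≡ α j [mod p ] → i ≡ j
    complete : ∀ a → QuadraticResidue p a → ∃[ i ] (α i ≡ a [mod p ])

-- Laplace expansion along the first row.
det : ∀ {m} → (Fin m → Fin m → ℤ) → ℤ
det {zero}  A = 1ℤ
det {suc m} A =
  sum λ j → -1ℤ ^ toℕ j * A zero j * det (λ i k → A (suc i) (punchIn j k))

-- S_{n,2}(d,p), with α the chosen representatives of the residues modulo p.
S₂ : ∀ {m} → ℕ → ℤ → (Fin m → ℤ) → ℤ
S₂ n d α = det λ i j → (α i + d * α j) ^ n

-- The number of 0 < r < p/4 with (r/p) = -1.
nonresiduesBelowQuarter : ℕ → ℕ
nonresiduesBelowQuarter p = length (filter
  (λ r → 0 <? r ×-dec 4 ℕ.* r <? p ×-dec legendre (+ r) p ℤ.≟ -1ℤ) (upTo p))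

{-# OPTIONS --safe #-}

-- Write p = 2m + 1 = 4h + 1. The square root exists because the determinant of a skew-symmetric
-- integer matrix of even size is a square: a symplectic elimination step with pivot a trades the
-- matrix for a smaller skew-symmetric one, up to even powers of a.
--
-- Modulo p the Legendre symbol of a root s of S is s^m = S^h, so only S itself matters. The αᵢ are
-- the m-th roots of unity, hence expanding (αᵢ - αⱼ)^(m+3) and folding exponents modulo m factors
-- the matrix as (αᵢ^k) · diag(cₖ) · (αⱼ^(m-k)) · diag(αⱼ³). The two Vandermonde-like factors multiply
-- to m times the identity, and ∏ αᵢ = -1. The cₖ are, up to sign, binomial coefficients C(m+3, k)
-- (with a correction for k < 4), so S^h becomes a product of quadratic characters of factorials,
-- which collapses to χ(3) χ(h!) for odd h and to χ(2) χ(5) χ(h!) for even h. Finally χ(h!) counts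
-- the nonresidues below p/4, and χ(2), χ(3), χ(5) come from Gauss sums in ring extensions of ℤ/p
-- by roots of unity of order 4, 3 and 5.
module Submission where

open import Defs
  using (_≡_[mod_]; QuadraticResidue; quadraticResidue?; legendre; RepresentsQuadraticResidues;
         S₂; nonresiduesBelowQuarter)
import Defs
open import Algebra.Bundles using (CommutativeMonoid; CommutativeRing)
import Algebra.Properties.AbelianGroup as AbelianGroupProperties
import Algebra.Properties.CommutativeMonoid.Sum as CommutativeMonoidSum
import Algebra.Properties.CommutativeSemiring.Binomial as Binomial
import Algebra.Properties.CommutativeSemiring.Exp as CommutativeSemiringExp
import Algebra.Properties.Ring as RingProperties
import Algebra.Properties.Semiring.Mult as SemiringMult
import Algebra.Properties.Semiring.Mult.TCOptimised as TCMult
import Algebra.Properties.Semiring.Sum as SemiringSum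
import Algebra.Solver.Ring
open import Algebra.Solver.Ring.AlmostCommutativeRing
  using (_-Raw-AlmostCommutative⟶_; fromCommutativeRing)
open import Data.Bool.Base using (if_then_else_)
open import Data.Fin.Base as Fin using (Fin; zero; suc; toℕ; punchIn; punchOut)
import Data.Fin.Properties as Fin
open import Data.Integer.Base as ℤ
  using (ℤ; +_; -[1+_]; _⊖_; _◃_; ∣_∣; 0ℤ; 1ℤ; -1ℤ)
import Data.Integer.DivMod as ℤ
import Data.Integer.Divisibility.Signed as ℤ
import Data.Integer.Properties as ℤ
import Data.Integer.Tactic.RingSolver as ℤ
open import Data.List.Base using ([]; length; filter; upTo; [_])
import Data.List.Properties as List
open import Data.Maybe.Base using (Maybe; just; nothing)
open import Data.Nat.Base as ℕ using (ℕ; zero; suc; _!; _∸_)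
open import Data.Nat.Combinatorics
  using (_C_; nCk≡n!/k![n-k]!; k![n∸k]!∣n!; nCn≡1; k>n⇒nCk≡0; nCk≡nC[n∸k]; nC1≡n)
import Data.Nat.Coprimality as Coprimality
open import Data.Nat.DivMod as ℕ using (_/_; _%_)
import Data.Nat.Divisibility as ℕ
import Data.Nat.GCD as ℕ
open import Data.Nat.Primality
  using (Prime; prime⇒irreducible; prime⇒nonTrivial; euclidsLemma; ¬prime[1])
import Data.Nat.Properties as ℕ
import Data.Nat.Tactic.RingSolver as ℕ
open import Data.Product.Base using (_×_; _,_; ∃-syntax; proj₁; proj₂)
import Data.Sign.Base as Sign
open import Data.Sum.Base as Sum using (_⊎_; inj₁; inj₂)
open import Data.Vec.Functional using (_∷_; init; last)
open import Function.Base using (_∘_)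
open import Level using (0ℓ; _⊔_)
open import Relation.Binary.PropositionalEquality as ≡ using (_≡_; _≢_)
import Relation.Binary.Reasoning.Setoid as SetoidReasoning
open import Relation.Nullary.Decidable using (Dec; does; yes; no; ¬?; decidable-stable; _×-dec_)
open import Relation.Nullary.Negation using (¬_; contradiction)

-- The lemmas are stated over an arbitrary commutative ring because three kinds of ring use them: ℤ
-- for the square root, ℤ/p, and the extensions carrying the Gauss sums. ℤ/p is ℤ with congruence as
-- setoid equality, so an integer determinant is read modulo p without a reduction map. The
-- extensions are never shown to be domains: only Frobenius and a comparison of coordinates take
-- place there.
--
-- The obstacle is that `S^h` with `h = (p-1)/4` is a quartic symbol of `S`. It becomes quadratic
-- because, apart from signs, the factors of `S` pair up. The symmetry `k ↔ 3 - k` makes the first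
-- four folded coefficients come in equal pairs. The symmetry `k ↔ m + 3 - k` makes the product of
-- the other binomial coefficients an even power of `(m+3)!` divided by a square.
--
-- The prime 5 is treated apart: there `m = 2`, and exponents up to `m + 3` wrap around modulo `m`
-- more than once, whereas for `m ≥ 4` they do so at most once.

-- The standard library's solver for an abstract commutative ring, with integer coefficients
-- so that additive inverses cancel.
module IntegerCoefficients {c ℓ} (R : CommutativeRing c ℓ) where
  open CommutativeRing R
  open RingProperties ring using (-‿distribˡ-*; -‿distribʳ-*)
  open AbelianGroupProperties +-abelianGroup
    using () renaming (ε⁻¹≈ε to -0≈0; ⁻¹-involutive to -‿involutive; ⁻¹-∙-comm to -‿+-comm)
  -- This variant of the multiple has `1 · 1# = 1#` by computation, so the solver's literal `con 1ℤ`
  -- denotes `1#` itself.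
  open TCMult semiring using (×-homo-+; ×1-homo-*; 1+×) renaming (_×_ to _·_)
  open SetoidReasoning setoid

  fromℤ : ℤ → Carrier
  fromℤ (+ n)     = n · 1#
  fromℤ -[1+ n ]  = - (suc n · 1#)

  fromℤ-neg : ∀ i → fromℤ (ℤ.- i) ≈ - fromℤ i
  fromℤ-neg (+ zero)   = sym -0≈0
  fromℤ-neg (+ suc n)  = refl
  fromℤ-neg -[1+ n ]   = sym (-‿involutive _)

  cancel-1 : ∀ x y → (1# + x) - (1# + y) ≈ x - y
  cancel-1 x y = begin
    (1# + x) - (1# + y)      ≈⟨ +-congˡ (-‿+-comm 1# y) ⟨
    (1# + x) + (- 1# - y)    ≈⟨ +-congʳ (+-comm 1# x) ⟩
    (x + 1#) + (- 1# - y)    ≈⟨ +-assoc x 1# _ ⟩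
    x + (1# + (- 1# - y))    ≈⟨ +-congˡ (+-assoc 1# (- 1#) _) ⟨
    x + ((1# - 1#) - y)      ≈⟨ +-congˡ (+-congʳ (-‿inverseʳ 1#)) ⟩
    x + (0# - y)             ≈⟨ +-congˡ (+-identityˡ _) ⟩
    x - y                    ∎

  fromℤ-⊖ : ∀ m n → fromℤ (m ⊖ n) ≈ m · 1# - n · 1#
  fromℤ-⊖ m       zero    = sym (trans (+-congˡ -0≈0) (+-identityʳ _))
  fromℤ-⊖ zero    (suc n) = sym (+-identityˡ _)
  fromℤ-⊖ (suc m) (suc n) = begin
    fromℤ (suc m ⊖ suc n)              ≡⟨ ≡.cong fromℤ (ℤ.[1+m]⊖[1+n]≡m⊖n m n) ⟩
    fromℤ (m ⊖ n)                      ≈⟨ fromℤ-⊖ m n ⟩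
    m · 1# - n · 1#                    ≈⟨ cancel-1 _ _ ⟨
    (1# + m · 1#) - (1# + n · 1#)      ≈⟨ +-cong (1+× m 1#) (-‿cong (1+× n 1#)) ⟨
    suc m · 1# - suc n · 1#            ∎

  fromℤ-+ : ∀ i j → fromℤ (i ℤ.+ j) ≈ fromℤ i + fromℤ j
  fromℤ-+ (+ m)    (+ n)    = ×-homo-+ 1# m n
  fromℤ-+ (+ m)    -[1+ n ] = fromℤ-⊖ m (suc n)
  fromℤ-+ -[1+ m ] (+ n)    = trans (fromℤ-⊖ n (suc m)) (+-comm _ _)
  fromℤ-+ -[1+ m ] -[1+ n ] = begin
    - (suc (suc (m ℕ.+ n)) · 1#)       ≡⟨ ≡.cong (λ k → - (k · 1#)) (ℕ.+-suc (suc m) n) ⟨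
    - ((suc m ℕ.+ suc n) · 1#)         ≈⟨ -‿cong (×-homo-+ 1# (suc m) (suc n)) ⟩
    - (suc m · 1# + suc n · 1#)        ≈⟨ -‿+-comm _ _ ⟨
    - (suc m · 1#) - suc n · 1#        ∎

  fromℤ-+◃ : ∀ n → fromℤ (Sign.+ ◃ n) ≈ n · 1#
  fromℤ-+◃ n = reflexive (≡.cong fromℤ (ℤ.+◃n≡+n n))

  fromℤ--◃ : ∀ n → fromℤ (Sign.- ◃ n) ≈ - (n · 1#)
  fromℤ--◃ n = trans (reflexive (≡.cong fromℤ (ℤ.-◃n≡-n n))) (fromℤ-neg (+ n))

  fromℤ-* : ∀ i j → fromℤ (i ℤ.* j) ≈ fromℤ i * fromℤ j
  fromℤ-* (+ m)    (+ n)    = trans (fromℤ-+◃ (m ℕ.* n)) (×1-homo-* m n)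
  fromℤ-* (+ m)    -[1+ n ] = trans (fromℤ--◃ (m ℕ.* suc n))
    (trans (-‿cong (×1-homo-* m (suc n))) (-‿distribʳ-* _ _))
  fromℤ-* -[1+ m ] (+ n)    = trans (fromℤ--◃ (suc m ℕ.* n))
    (trans (-‿cong (×1-homo-* (suc m) n)) (-‿distribˡ-* _ _))
  fromℤ-* -[1+ m ] -[1+ n ] = begin
    fromℤ (Sign.+ ◃ suc m ℕ.* suc n)         ≈⟨ fromℤ-+◃ (suc m ℕ.* suc n) ⟩
    (suc m ℕ.* suc n) · 1#                   ≈⟨ ×1-homo-* (suc m) (suc n) ⟩
    suc m · 1# * suc n · 1#                  ≈⟨ -‿involutive _ ⟨
    - - (suc m · 1# * suc n · 1#)            ≈⟨ -‿cong (-‿distribˡ-* _ _) ⟩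
    - (- (suc m · 1#) * suc n · 1#)          ≈⟨ -‿distribʳ-* _ _ ⟩
    - (suc m · 1#) * - (suc n · 1#)          ∎

  coefficients : ℤ.+-*-rawRing -Raw-AlmostCommutative⟶ fromCommutativeRing R
  coefficients = record
    { ⟦_⟧    = fromℤ
    ; +-homo = fromℤ-+
    ; *-homo = fromℤ-*
    ; -‿homo = fromℤ-neg
    ; 0-homo = refl
    ; 1-homo = refl
    }

  coefficient≟ : ∀ i j → Maybe (fromℤ i ≈ fromℤ j)
  coefficient≟ i j with i ℤ.≟ j
  ... | yes i≡j = just (reflexive (≡.cong fromℤ i≡j))
  ... | no  _   = nothing

  open Algebra.Solver.Ring ℤ.+-*-rawRing (fromCommutativeRing R) coefficients coefficient≟ public
    using (solve; _:=_; _:+_; _:*_; _:-_; :-_; con; _:^_)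

-- Determinants, by uniqueness of alternating multilinear functions

data Adjacent : ∀ {n} → Fin n → Fin n → Set where
  here  : ∀ {n} → Adjacent {suc (suc n)} zero (suc zero)
  there : ∀ {n} {i j : Fin n} → Adjacent i j → Adjacent (suc i) (suc j)

adjacent-punchOut : ∀ {n} {i j r : Fin (suc n)} → Adjacent i j → r ≢ i → r ≢ j →
  ∃[ i′ ] ∃[ j′ ] (Adjacent i′ j′ × punchIn r i′ ≡ i × punchIn r j′ ≡ j)
adjacent-punchOut {r = zero}        here      r≢i r≢j = contradiction ≡.refl r≢i
adjacent-punchOut {r = zero}        (there a) r≢i r≢j = _ , _ , a , ≡.refl , ≡.refl
adjacent-punchOut {r = suc zero}    here      r≢i r≢j = contradiction ≡.refl r≢j
adjacent-punchOut {n = suc (suc n)} {r = suc (suc r)} here      r≢i r≢j = _ , _ , here , ≡.refl , ≡.refl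
adjacent-punchOut {n = suc n} {r = suc r} (there a) r≢i r≢j
  with i′ , j′ , a′ , i≡ , j≡ ← adjacent-punchOut a (r≢i ∘ ≡.cong suc) (r≢j ∘ ≡.cong suc)
  = suc i′ , suc j′ , there a′ , ≡.cong suc i≡ , ≡.cong suc j≡

-- Deleting row `i` or its neighbour `j` leaves lists that differ in one place, where one keeps `j`
-- and the other `i`. If the two rows are equal, the two minors coincide.
punchIn-adjacent : ∀ {n} {i j : Fin (suc n)} → Adjacent i j → ∀ k →
  punchIn i k ≡ punchIn j k ⊎ (punchIn i k ≡ j × punchIn j k ≡ i)
punchIn-adjacent here      zero    = inj₂ (≡.refl , ≡.refl)
punchIn-adjacent here      (suc k) = inj₁ ≡.refl
punchIn-adjacent (there a) zero    = inj₁ ≡.refl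
punchIn-adjacent (there a) (suc k) with punchIn-adjacent a k
... | inj₁ eq        = inj₁ (≡.cong suc eq)
... | inj₂ (eq , qe) = inj₂ (≡.cong suc eq , ≡.cong suc qe)

module Determinant {c ℓ} (R : CommutativeRing c ℓ) where
  open CommutativeRing R hiding (zero)
  open RingProperties ring using (x+x≈x⇒x≈0; -1*x≈-x)
  open AbelianGroupProperties +-abelianGroup
    using () renaming (inverseˡ-unique to +-inverseˡ-unique)
  open SemiringSum semiring
  open CommutativeSemiringExp commutativeSemiring using (_^_)
  open CommutativeMonoidSum *-commutativeMonoid
    using () renaming (sum to product)
  open IntegerCoefficients R using (solve; _:=_; _:+_; _:*_; :-_; con)
  open SetoidReasoning setoid

  Matrix : ℕ → ℕ → Set c
  Matrix m n = Fin m → Fin n → Carrier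

  infix 4 _≋_
  _≋_ : ∀ {m n} → Matrix m n → Matrix m n → Set ℓ
  A ≋ B = ∀ i k → A i k ≈ B i k

  infix 25 _ᵀ
  _ᵀ : ∀ {m n} → Matrix m n → Matrix n m
  (A ᵀ) i k = A k i

  infixl 7 _⊡_
  _⊡_ : ∀ {l m n} → Matrix l m → Matrix m n → Matrix l n
  (A ⊡ B) i k = sum λ j → A i j * B j k

  δ : ∀ {n} → Matrix n n
  δ zero    zero    = 1#
  δ zero    (suc k) = 0#
  δ (suc i) zero    = 0#
  δ (suc i) (suc k) = δ i k

  det : ∀ {n} → Matrix n n → Carrier
  det {zero}  A = 1#
  det {suc n} A = sum λ j → (- 1#) ^ toℕ j * A zero j * det (λ i k → A (suc i) (punchIn j k))

  laplaceTerm : ∀ {n} → Matrix (suc n) (suc n) → Fin (suc n) → Carrier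
  laplaceTerm A j = (- 1#) ^ toℕ j * A zero j * det (λ i k → A (suc i) (punchIn j k))

  det-cong : ∀ {n} {A B : Matrix n n} → A ≋ B → det A ≈ det B
  det-cong {zero}  A≋B = refl
  det-cong {suc n} {A} {B} A≋B = sum-cong-≋ {x = laplaceTerm A} {laplaceTerm B} λ j →
    *-cong (*-congˡ (A≋B zero j)) (det-cong λ i k → A≋B (suc i) (punchIn j k))

  sum-zero : ∀ {n} {f : Fin n → Carrier} → (∀ i → f i ≈ 0#) → sum f ≈ 0#
  sum-zero {n} f≈0 = trans (sum-cong-≋ f≈0) (sum-replicate-zero n)

  sum-head : ∀ {n} (f : Fin (suc n) → Carrier) → (∀ i → f (suc i) ≈ 0#) → sum f ≈ f zero
  sum-head f f≈0 = trans (+-congˡ (sum-zero f≈0)) (+-identityʳ _)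

  laplaceTerm-zero : ∀ {n} (A : Matrix (suc n) (suc n)) j → A zero j ≈ 0# → laplaceTerm A j ≈ 0#
  laplaceTerm-zero A j A₀ⱼ≈0 = trans (*-congʳ (trans (*-congˡ A₀ⱼ≈0) (zeroʳ _))) (zeroˡ _)

  sum-adjacent-cancel : ∀ {n} {f : Fin n → Carrier} {i j} → Adjacent i j → f i + f j ≈ 0# →
    (∀ r → r ≢ i → r ≢ j → f r ≈ 0#) → sum f ≈ 0#
  sum-adjacent-cancel {f = f} here fi+fj≈0 rest = begin
    sum f                              ≈⟨ +-congˡ (sum-head (f ∘ suc) λ r → rest (suc (suc r)) (λ ()) (λ ())) ⟩
    f zero + f (suc zero)              ≈⟨ fi+fj≈0 ⟩
    0#                                 ∎
  sum-adjacent-cancel (there a) fi+fj≈0 rest =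
    trans (+-cong (rest zero (λ ()) (λ ()))
             (sum-adjacent-cancel a fi+fj≈0 λ r r≢i r≢j →
               rest (suc r) (r≢i ∘ Fin.suc-injective) (r≢j ∘ Fin.suc-injective)))
          (+-identityˡ 0#)

  -- Linearity relates three matrices that agree off row `i`, which avoids an operation overwriting
  -- a row. Vanishing is asked for adjacent equal rows only, since adjacency is inherited by minors.
  -- Allowing `m ≠ n` makes the notion stable under fixing the first row.
  record Alternating {m n} (F : Matrix m n → Carrier) : Set (c ⊔ ℓ) where
    field
      cong       : ∀ {A B} → A ≋ B → F A ≈ F B
      linear     : ∀ i a {A B Z} → (∀ k → A i k ≈ B i k + a * Z i k) →
                   (∀ r → r ≢ i → ∀ k → A r k ≈ B r k) →
                   (∀ r → r ≢ i → ∀ k → A r k ≈ Z r k) →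
                   F A ≈ F B + a * F Z
      alternates : ∀ {i j A} → Adjacent i j → (∀ k → A i k ≈ A j k) → F A ≈ 0#

  -- The transpose turns the expansion into one along the first column of `A`. There row `i` enters
  -- every term once: as the coefficient of its own term, and inside the minor of each other term.
  det∘ᵀ-linear : ∀ {n} i a {A B Z : Matrix n n} → (∀ k → A i k ≈ B i k + a * Z i k) →
    (∀ r → r ≢ i → ∀ k → A r k ≈ B r k) → (∀ r → r ≢ i → ∀ k → A r k ≈ Z r k) →
    det (A ᵀ) ≈ det (B ᵀ) + a * det (Z ᵀ)
  det∘ᵀ-linear {suc n} i a {A} {B} {Z} Aᵢ A≈B A≈Z = begin
    sum (term A)                         ≈⟨ sum-cong-≋ term-linear ⟩
    sum (λ r → term B r + a * term Z r)  ≈⟨ ∑-distrib-+ (term B) (λ r → a * term Z r) ⟩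
    sum (term B) + sum (λ r → a * term Z r)  ≈⟨ +-congˡ (*-distribˡ-sum a (term Z)) ⟨
    sum (term B) + a * sum (term Z)      ∎
    where
    minor : Matrix (suc n) (suc n) → Fin (suc n) → Matrix n n
    minor A r i k = A (punchIn r i) (suc k)

    term : Matrix (suc n) (suc n) → Fin (suc n) → Carrier
    term A r = (- 1#) ^ toℕ r * A r zero * det (minor A r ᵀ)

    term-linear : ∀ r → term A r ≈ term B r + a * term Z r
    term-linear r with r Fin.≟ i
    ... | yes ≡.refl = begin
      ε * A r zero * D A
        ≈⟨ *-congʳ (*-congˡ (Aᵢ zero)) ⟩
      ε * (B r zero + a * Z r zero) * D A
        ≈⟨ solve 5 (λ e b a c d → e :* (b :+ a :* c) :* d := e :* b :* d :+ a :* (e :* c :* d))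
             refl ε (B r zero) a (Z r zero) (D A) ⟩
      ε * B r zero * D A + a * (ε * Z r zero * D A)
        ≈⟨ +-cong (*-congˡ (D-cong A≈B)) (*-congˡ (*-congˡ (D-cong A≈Z))) ⟩
      ε * B r zero * D B + a * (ε * Z r zero * D Z) ∎
      where
      ε = (- 1#) ^ toℕ r
      D = λ A → det (minor A r ᵀ)
      D-cong : ∀ {X} → (∀ s → s ≢ r → ∀ k → A s k ≈ X s k) → D A ≈ D X
      D-cong A≈X = det-cong λ k s → A≈X (punchIn r s) (Fin.punchInᵢ≢i r s) (suc k)
    ... | no r≢i = begin
      ε * A r zero * D A
        ≈⟨ *-congˡ (det∘ᵀ-linear i′ a (λ k → Aᵢ′ (suc k))
             (λ s s≢ k → A≈B _ (avoid s s≢) (suc k)) (λ s s≢ k → A≈Z _ (avoid s s≢) (suc k))) ⟩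
      ε * A r zero * (D B + a * D Z)
        ≈⟨ solve 5 (λ e x b a c → e :* x :* (b :+ a :* c) := e :* x :* b :+ a :* (e :* x :* c))
             refl ε (A r zero) (D B) a (D Z) ⟩
      ε * A r zero * D B + a * (ε * A r zero * D Z)
        ≈⟨ +-cong (*-congʳ (*-congˡ (A≈B r r≢i zero)))
                  (*-congˡ (*-congʳ (*-congˡ (A≈Z r r≢i zero)))) ⟩
      ε * B r zero * D B + a * (ε * Z r zero * D Z) ∎
      where
      ε = (- 1#) ^ toℕ r
      D = λ A → det (minor A r ᵀ)
      i′ = punchOut r≢i
      Aᵢ′ : ∀ k → A (punchIn r i′) k ≈ B (punchIn r i′) k + a * Z (punchIn r i′) k
      Aᵢ′ k = ≡.subst (λ i → A i k ≈ B i k + a * Z i k) (≡.sym (Fin.punchIn-punchOut r≢i)) (Aᵢ k)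
      avoid : ∀ s → s ≢ i′ → punchIn r s ≢ i
      avoid s s≢i′ eq = s≢i′
        (Fin.punchIn-injective r s i′ (≡.trans eq (≡.sym (Fin.punchIn-punchOut r≢i))))

  sign-adjacent : ∀ {n} {i j : Fin n} → Adjacent i j → (- 1#) ^ toℕ j ≈ - ((- 1#) ^ toℕ i)
  sign-adjacent here      = *-identityʳ _
  sign-adjacent (there {i = i} {j} a) = begin
    - 1# * (- 1#) ^ toℕ j         ≈⟨ *-congˡ (sign-adjacent a) ⟩
    - 1# * - ((- 1#) ^ toℕ i)     ≈⟨ -1*x≈-x _ ⟩
    - - ((- 1#) ^ toℕ i)          ≈⟨ -‿cong (-1*x≈-x _) ⟨
    - (- 1# * (- 1#) ^ toℕ i)     ∎

  -- In the column expansion every term vanishes by induction except those of rows `i` and `j`,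
  -- which have equal entries, equal minors and opposite signs.
  det∘ᵀ-alternates : ∀ {n} {A : Matrix n n} {i j} → Adjacent i j → (∀ k → A i k ≈ A j k) →
    det (A ᵀ) ≈ 0#
  det∘ᵀ-alternates {suc n} {A} {i} {j} a Aᵢ≈Aⱼ = sum-adjacent-cancel a cancel vanish
    where
    minor : Fin (suc n) → Matrix n n
    minor r i k = A (punchIn r i) (suc k)

    vanish : ∀ r → r ≢ i → r ≢ j → (- 1#) ^ toℕ r * A r zero * det (minor r ᵀ) ≈ 0#
    vanish r r≢i r≢j with i′ , j′ , a′ , ≡.refl , ≡.refl ← adjacent-punchOut a r≢i r≢j =
      trans (*-congˡ (det∘ᵀ-alternates {A = minor r} a′ (λ k → Aᵢ≈Aⱼ (suc k)))) (zeroʳ _)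

    minors : ∀ s k → minor i s k ≈ minor j s k
    minors s k with punchIn-adjacent a s
    ... | inj₁ eq        = reflexive (≡.cong (λ r → A r (suc k)) eq)
    ... | inj₂ (eq , qe) = begin
      A (punchIn i s) (suc k)  ≡⟨ ≡.cong (λ r → A r (suc k)) eq ⟩
      A j (suc k)              ≈⟨ Aᵢ≈Aⱼ (suc k) ⟨
      A i (suc k)              ≡⟨ ≡.cong (λ r → A r (suc k)) qe ⟨
      A (punchIn j s) (suc k)  ∎

    cancel : (- 1#) ^ toℕ i * A i zero * det (minor i ᵀ) +
             (- 1#) ^ toℕ j * A j zero * det (minor j ᵀ) ≈ 0#
    cancel = begin
      ε * A i zero * det (minor i ᵀ) + (- 1#) ^ toℕ j * A j zero * det (minor j ᵀ)
        ≈⟨ +-congˡ (*-cong (*-cong (sign-adjacent a) (sym (Aᵢ≈Aⱼ zero)))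
                          (det-cong λ k s → sym (minors s k))) ⟩
      ε * A i zero * det (minor i ᵀ) + (- ε) * A i zero * det (minor i ᵀ)
        ≈⟨ solve 3 (λ e x d → e :* x :* d :+ (:- e) :* x :* d := con 0ℤ) refl
             ε (A i zero) (det (minor i ᵀ)) ⟩
      0# ∎
      where ε = (- 1#) ^ toℕ i

  det∘ᵀ-alternating : ∀ {n} → Alternating {n} (λ A → det (A ᵀ))
  det∘ᵀ-alternating = record
    { cong       = λ A≋B → det-cong λ i k → A≋B k i
    ; linear     = det∘ᵀ-linear
    ; alternates = det∘ᵀ-alternates
    }

  ∷-cong : ∀ {m n} {u v : Fin n → Carrier} {A B : Matrix m n} →
    (∀ k → u k ≈ v k) → A ≋ B → (u ∷ A) ≋ (v ∷ B)
  ∷-cong u≈v A≋B zero    = u≈v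
  ∷-cong u≈v A≋B (suc i) = A≋B i

  ∷-alternating : ∀ {m n} {F : Matrix (suc m) n → Carrier} (u : Fin n → Carrier) →
    Alternating F → Alternating (λ A → F (u ∷ A))
  ∷-alternating {m} {n} {F} u alt = record
    { cong       = λ A≋B → F.cong (∷-cong (λ k → refl) A≋B)
    ; linear     = λ i a A≈ A≈B A≈Z → F.linear (suc i) a A≈ (off A≈B) (off A≈Z)
    ; alternates = λ a → F.alternates (there a)
    }
    where
    module F = Alternating alt
    off : ∀ {i} {A B : Matrix m n} → (∀ r → r ≢ i → ∀ k → A r k ≈ B r k) →
      ∀ r → r ≢ suc i → ∀ k → (u ∷ A) r k ≈ (u ∷ B) r k
    off A≈B zero    _    k = refl
    off A≈B (suc r) r≢si k = A≈B r (r≢si ∘ ≡.cong suc) k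

  module _ {m n} {F : Matrix (suc m) n → Carrier} (alt : Alternating F) where
    open Alternating alt

    linear-head : ∀ a {u v w} {A} → (∀ k → u k ≈ v k + a * w k) →
      F (u ∷ A) ≈ F (v ∷ A) + a * F (w ∷ A)
    linear-head a u≈ = linear zero a u≈ off off
      where
      off : ∀ {u v : Fin n → Carrier} {A : Matrix m n} r → r ≢ zero → ∀ k → (u ∷ A) r k ≈ (v ∷ A) r k
      off zero    r≢0 = contradiction ≡.refl r≢0
      off (suc r) _ k = refl

    zero-head : ∀ {A} → F ((λ _ → 0#) ∷ A) ≈ 0#
    zero-head = x+x≈x⇒x≈0 _ (sym (trans
      (linear-head 1# (λ k → sym (trans (+-congˡ (*-identityˡ _)) (+-identityˡ _))))
      (+-congˡ (*-identityˡ _))))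

    sum-head-linear : ∀ {l} (a : Fin l → Carrier) (W : Matrix l n) {A} →
      F ((λ k → sum λ j → a j * W j k) ∷ A) ≈ sum λ j → a j * F (W j ∷ A)
    sum-head-linear {zero}  a W = zero-head
    sum-head-linear {suc l} a W {A} = begin
      F ((λ k → sum λ j → a j * W j k) ∷ A)
        ≈⟨ linear-head (a zero) (λ k → +-comm _ _) ⟩
      F ((λ k → sum λ j → a (suc j) * W (suc j) k) ∷ A) + a zero * F (W zero ∷ A)
        ≈⟨ +-comm _ _ ⟩
      a zero * F (W zero ∷ A) + F ((λ k → sum λ j → a (suc j) * W (suc j) k) ∷ A)
        ≈⟨ +-congˡ (sum-head-linear (a ∘ suc) (W ∘ suc)) ⟩
      (sum λ j → a j * F (W j ∷ A)) ∎

  module _ {m n} {F : Matrix (suc (suc m)) n → Carrier} (alt : Alternating F) where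
    open Alternating alt

    -- Polarisation: `F` vanishes on the repeated row `u + v`, hence so does its expansion into four
    -- terms.
    swap : ∀ u v A → F (u ∷ v ∷ A) ≈ - F (v ∷ u ∷ A)
    swap u v A = +-inverseˡ-unique _ _ (begin
      F (u ∷ v ∷ A) + F (v ∷ u ∷ A)
        ≈⟨ +-cong (trans (+-congʳ (same u)) (+-identityˡ _)) (trans (+-congˡ (same v)) (+-identityʳ _)) ⟨
      (F (u ∷ u ∷ A) + F (u ∷ v ∷ A)) + (F (v ∷ u ∷ A) + F (v ∷ v ∷ A))
        ≈⟨ +-cong (second u) (second v) ⟨
      F (u ∷ u+v ∷ A) + F (v ∷ u+v ∷ A)
        ≈⟨ +-congˡ (*-identityˡ _) ⟨
      F (u ∷ u+v ∷ A) + 1# * F (v ∷ u+v ∷ A)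
        ≈⟨ linear-head alt 1# (λ k → +-congˡ (sym (*-identityˡ _))) ⟨
      F (u+v ∷ u+v ∷ A)
        ≈⟨ same u+v ⟩
      0# ∎)
      where
      u+v : Fin n → Carrier
      u+v k = u k + v k
      same : ∀ w → F (w ∷ w ∷ A) ≈ 0#
      same w = alternates here (λ k → refl)
      second : ∀ w → F (w ∷ u+v ∷ A) ≈ F (w ∷ u ∷ A) + F (w ∷ v ∷ A)
      second w = trans (linear-head (∷-alternating w alt) 1# (λ k → +-congˡ (sym (*-identityˡ _))))
        (+-congˡ (*-identityˡ _))

  ∷-η : ∀ {m n} (A : Matrix (suc m) n) → A ≋ (A zero ∷ A ∘ suc)
  ∷-η A zero    k = refl
  ∷-η A (suc i) k = refl

  repeated-head : ∀ {m n} {F : Matrix (suc m) n → Carrier} → Alternating F →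
    ∀ i {u A} → (∀ k → u k ≈ A i k) → F (u ∷ A) ≈ 0#
  repeated-head {suc m} alt zero    u≈ = Alternating.alternates alt here u≈
  repeated-head {suc m} {F = F} alt (suc i) {u} {A} u≈ = begin
    F (u ∷ A)                    ≈⟨ Alternating.cong alt (∷-cong (λ k → refl) (∷-η A)) ⟩
    F (u ∷ A zero ∷ A ∘ suc)     ≈⟨ swap alt u (A zero) (A ∘ suc) ⟩
    - F (A zero ∷ u ∷ A ∘ suc)   ≈⟨ -‿cong (repeated-head (∷-alternating (A zero) alt) i u≈) ⟩
    - 0#                         ≈⟨ solve 0 (:- con 0ℤ := con 0ℤ) refl ⟩
    0#                           ∎

  -- A multiple of `w` in another row contributes a matrix in which `w` is repeated. The treated row
  -- is swapped to the front so that the induction can run with it fixed.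
  eliminate : ∀ {m n} {F : Matrix (suc m) n → Carrier} → Alternating F → ∀ w (c : Fin m → Carrier) {A B} →
    (∀ i k → A i k ≈ B i k + c i * w k) → F (w ∷ A) ≈ F (w ∷ B)
  eliminate {zero} alt w c A≈ = Alternating.cong alt (∷-cong (λ k → refl) λ ())
  eliminate {suc m} {F = F} alt w c {A} {B} A≈ = begin
    F (w ∷ A)
      ≈⟨ F.cong (∷-cong (λ k → refl) (∷-η A)) ⟩
    F (w ∷ A zero ∷ A ∘ suc)
      ≈⟨ linear-head (∷-alternating w alt) (c zero) (A≈ zero) ⟩
    F (w ∷ B zero ∷ A ∘ suc) + c zero * F (w ∷ w ∷ A ∘ suc)
      ≈⟨ +-congˡ (*-congˡ (F.alternates here (λ k → refl))) ⟩
    F (w ∷ B zero ∷ A ∘ suc) + c zero * 0#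
      ≈⟨ trans (+-congˡ (zeroʳ _)) (+-identityʳ _) ⟩
    F (w ∷ B zero ∷ A ∘ suc)
      ≈⟨ swap alt w (B zero) (A ∘ suc) ⟩
    - F (B zero ∷ w ∷ A ∘ suc)
      ≈⟨ -‿cong (eliminate (∷-alternating (B zero) alt) w (c ∘ suc) (A≈ ∘ suc)) ⟩
    - F (B zero ∷ w ∷ B ∘ suc)
      ≈⟨ swap alt w (B zero) (B ∘ suc) ⟨
    F (w ∷ B zero ∷ B ∘ suc)
      ≈⟨ F.cong (∷-cong (λ k → refl) (∷-η B)) ⟨
    F (w ∷ B) ∎
    where module F = Alternating alt

  move-to-front : ∀ {m n} {F : Matrix (suc m) n → Carrier} → Alternating F → ∀ j W →
    F (W j ∷ W ∘ punchIn j) ≈ (- 1#) ^ toℕ j * F W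
  move-to-front alt zero W =
    trans (Alternating.cong alt (λ i k → sym (∷-η W i k))) (sym (*-identityˡ _))
  move-to-front {suc m} {F = F} alt (suc j) W = begin
    F (W (suc j) ∷ W ∘ punchIn (suc j))
      ≈⟨ F.cong (∷-cong (λ k → refl) (∷-η _)) ⟩
    F (W (suc j) ∷ W zero ∷ W ∘ suc ∘ punchIn j)
      ≈⟨ swap alt _ _ _ ⟩
    - F (W zero ∷ W (suc j) ∷ W ∘ suc ∘ punchIn j)
      ≈⟨ -‿cong (move-to-front (∷-alternating (W zero) alt) j (W ∘ suc)) ⟩
    - ((- 1#) ^ toℕ j * F (W zero ∷ W ∘ suc))
      ≈⟨ -‿cong (*-congˡ (F.cong (∷-η W))) ⟨
    - ((- 1#) ^ toℕ j * F W)
      ≈⟨ solve 2 (λ e x → :- (e :* x) := (:- con 1ℤ) :* e :* x) refl _ _ ⟩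
    (- 1#) ^ toℕ (suc j) * F W ∎
    where module F = Alternating alt

  -- Puts a zero at column `j`; this turns a function of matrices with `n + 1` columns into one of
  -- the minor without column `j`.
  insert0 : ∀ {n} → Fin (suc n) → (Fin n → Carrier) → Fin (suc n) → Carrier
  insert0         zero    v zero    = 0#
  insert0         zero    v (suc k) = v k
  insert0 {suc n} (suc j) v zero    = v zero
  insert0 {suc n} (suc j) v (suc k) = insert0 j (v ∘ suc) k

  insert0-cong : ∀ {n} (j : Fin (suc n)) {u v : Fin n → Carrier} →
    (∀ k → u k ≈ v k) → ∀ k → insert0 j u k ≈ insert0 j v k
  insert0-cong         zero    u≈v zero    = refl
  insert0-cong         zero    u≈v (suc k) = u≈v k
  insert0-cong {suc n} (suc j) u≈v zero    = u≈v zero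
  insert0-cong {suc n} (suc j) u≈v (suc k) = insert0-cong j (u≈v ∘ suc) k

  insert0-linear : ∀ {n} (j : Fin (suc n)) a {u v w : Fin n → Carrier} →
    (∀ k → u k ≈ v k + a * w k) → ∀ k → insert0 j u k ≈ insert0 j v k + a * insert0 j w k
  insert0-linear         zero    a u≈ zero    = sym (trans (+-identityˡ _) (zeroʳ a))
  insert0-linear         zero    a u≈ (suc k) = u≈ k
  insert0-linear {suc n} (suc j) a u≈ zero    = u≈ zero
  insert0-linear {suc n} (suc j) a u≈ (suc k) = insert0-linear j a (u≈ ∘ suc) k

  insert0-δ : ∀ {n} (j : Fin (suc n)) i k → insert0 j (δ i) k ≈ δ (punchIn j i) k
  insert0-δ         zero    i       zero    = refl
  insert0-δ         zero    i       (suc k) = refl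
  insert0-δ {suc n} (suc j) zero    zero    = refl
  insert0-δ {suc n} (suc j) (suc i) zero    = refl
  insert0-δ {suc n} (suc j) (suc i) (suc k) = insert0-δ j i k
  insert0-δ {suc n} (suc j) zero    (suc k) = insert0-zero j k
    where
    insert0-zero : ∀ {n} (j : Fin (suc n)) k → insert0 j (λ _ → 0#) k ≈ 0#
    insert0-zero         zero    zero    = refl
    insert0-zero         zero    (suc k) = refl
    insert0-zero {suc n} (suc j) zero    = refl
    insert0-zero {suc n} (suc j) (suc k) = insert0-zero j k

  insert0-punchIn : ∀ {n} (j : Fin (suc n)) v k →
    v k ≈ insert0 j (v ∘ punchIn j) k + v j * δ j k
  insert0-punchIn         zero    v zero    = sym (trans (+-identityˡ _) (*-identityʳ _))
  insert0-punchIn         zero    v (suc k) = sym (trans (+-congˡ (zeroʳ _)) (+-identityʳ _))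
  insert0-punchIn {suc n} (suc j) v zero    = sym (trans (+-congˡ (zeroʳ _)) (+-identityʳ _))
  insert0-punchIn {suc n} (suc j) v (suc k) = insert0-punchIn j (v ∘ suc) k

  δ-expansion : ∀ {n} (v : Fin n → Carrier) k → v k ≈ sum λ j → v j * δ j k
  δ-expansion v zero    = sym (trans (sum-head (λ j → v j * δ j zero) λ j → zeroʳ _) (*-identityʳ _))
  δ-expansion v (suc k) =
    trans (δ-expansion (v ∘ suc) k) (sym (trans (+-congʳ (zeroʳ _)) (+-identityˡ _)))

  -- The first row is expanded in the basis `δ j`. With `δ j` on top, column `j` can be cleared
  -- below, so `F` becomes an alternating function of the minor and induction applies; moving `δ j`
  -- into its place produces the Laplace sign. Transposition and multiplicativity of `det` are both
  -- read off from this.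
  alternating-unique : ∀ {n} {F : Matrix n n → Carrier} → Alternating F → ∀ A → F A ≈ det A * F δ
  alternating-unique {zero}  alt A = trans (Alternating.cong alt λ ()) (sym (*-identityˡ _))
  alternating-unique {suc n} {F} alt A = begin
    F A
      ≈⟨ F.cong (λ i k → trans (∷-η A i k) (∷-cong (δ-expansion (A zero)) (λ i k → refl) i k)) ⟩
    F ((λ k → sum λ j → A zero j * δ j k) ∷ A ∘ suc)
      ≈⟨ sum-head-linear alt (A zero) δ ⟩
    (sum λ j → A zero j * F (δ j ∷ A ∘ suc))
      ≈⟨ sum-cong-≋ (λ j → trans (*-congˡ (expand j)) (regroup j)) ⟩
    (sum λ j → (- 1#) ^ toℕ j * A zero j * det (minor j) * F δ)
      ≈⟨ *-distribʳ-sum (F δ) (λ j → (- 1#) ^ toℕ j * A zero j * det (minor j)) ⟨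
    det A * F δ ∎
    where
    module F = Alternating alt

    minor : Fin (suc n) → Matrix n n
    minor j i k = A (suc i) (punchIn j k)

    G : Fin (suc n) → Matrix n n → Carrier
    G j B = F (δ j ∷ λ i → insert0 j (B i))

    G-alternating : ∀ j → Alternating (G j)
    G-alternating j = record
      { cong       = λ A≋B → G′.cong λ i → insert0-cong j (A≋B i)
      ; linear     = λ i a A≈ A≈B A≈Z → G′.linear i a (insert0-linear j a A≈)
                       (λ r r≢i → insert0-cong j (A≈B r r≢i)) (λ r r≢i → insert0-cong j (A≈Z r r≢i))
      ; alternates = λ a Aᵢ≈Aⱼ → G′.alternates a (insert0-cong j Aᵢ≈Aⱼ)
      }
      where module G′ = Alternating (∷-alternating (δ j) alt)

    expand : ∀ j → F (δ j ∷ A ∘ suc) ≈ det (minor j) * ((- 1#) ^ toℕ j * F δ)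
    expand j = begin
      F (δ j ∷ A ∘ suc)
        ≈⟨ eliminate alt (δ j) (λ i → A (suc i) j) (λ i → insert0-punchIn j (A (suc i))) ⟩
      G j (minor j)
        ≈⟨ alternating-unique (G-alternating j) (minor j) ⟩
      det (minor j) * G j δ
        ≈⟨ *-congˡ (F.cong (∷-cong (λ k → refl) (insert0-δ j))) ⟩
      det (minor j) * F (δ j ∷ δ ∘ punchIn j)
        ≈⟨ *-congˡ (move-to-front alt j δ) ⟩
      det (minor j) * ((- 1#) ^ toℕ j * F δ) ∎

    regroup : ∀ j → A zero j * (det (minor j) * ((- 1#) ^ toℕ j * F δ)) ≈
                    (- 1#) ^ toℕ j * A zero j * det (minor j) * F δ
    regroup j = solve 4 (λ a d e f → a :* (d :* (e :* f)) := e :* a :* d :* f) refl _ _ _ _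

  det-lower : ∀ {n} {A : Matrix n n} → (∀ {i k} → i Fin.< k → A i k ≈ 0#) →
    det A ≈ product (λ i → A i i)
  det-lower {zero}      A≈0 = refl
  det-lower {suc n} {A} A≈0 = begin
    det A
      ≈⟨ sum-head (laplaceTerm A) (λ j → laplaceTerm-zero A (suc j) (A≈0 (ℕ.s≤s ℕ.z≤n))) ⟩
    1# * A zero zero * det (λ i k → A (suc i) (suc k))
      ≈⟨ *-cong (*-identityˡ _) (det-lower λ i<k → A≈0 (ℕ.s≤s i<k)) ⟩
    product (λ i → A i i) ∎

  δ-diagonal : ∀ {n} (i : Fin n) → δ i i ≡ 1#
  δ-diagonal zero    = ≡.refl
  δ-diagonal (suc i) = δ-diagonal i

  δ-off-diagonal : ∀ {n} {i k : Fin n} → i ≢ k → δ i k ≡ 0#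
  δ-off-diagonal {i = zero}  {zero}  i≢k = contradiction ≡.refl i≢k
  δ-off-diagonal {i = zero}  {suc k} i≢k = ≡.refl
  δ-off-diagonal {i = suc i} {zero}  i≢k = ≡.refl
  δ-off-diagonal {i = suc i} {suc k} i≢k = δ-off-diagonal (i≢k ∘ ≡.cong suc)

  product-one : ∀ {n} {f : Fin n → Carrier} → (∀ i → f i ≈ 1#) → product f ≈ 1#
  product-one {zero}  f≈1 = refl
  product-one {suc n} f≈1 = trans (*-cong (f≈1 zero) (product-one (f≈1 ∘ suc))) (*-identityˡ 1#)

  det-δ : ∀ {n} → det (δ {n}) ≈ 1#
  det-δ {n} = trans (det-lower {A = δ {n}} λ i<k → reflexive (δ-off-diagonal (Fin.<⇒≢ i<k)))
    (product-one {n} λ i → reflexive (δ-diagonal i))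

  δ-sym : ∀ {n} (i k : Fin n) → δ i k ≡ δ k i
  δ-sym zero    zero    = ≡.refl
  δ-sym zero    (suc k) = ≡.refl
  δ-sym (suc i) zero    = ≡.refl
  δ-sym (suc i) (suc k) = δ-sym i k

  det-ᵀ : ∀ {n} (A : Matrix n n) → det (A ᵀ) ≈ det A
  det-ᵀ {n} A = begin
    det (A ᵀ)           ≈⟨ alternating-unique det∘ᵀ-alternating A ⟩
    det A * det {n} (δ ᵀ)   ≈⟨ *-congˡ (trans (det-cong {n} λ i k → reflexive (δ-sym k i)) (det-δ {n})) ⟩
    det A * 1#          ≈⟨ *-identityʳ _ ⟩
    det A               ∎

  -- For fixed `B` the determinant of `A ⊡ B` is alternating in `A`, because row `i` of the product
  -- depends linearly on row `i` of `A` and on no other row.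
  det-* : ∀ {n} (A B : Matrix n n) → det (A ⊡ B) ≈ det A * det B
  det-* {n} A B = begin
    det (A ⊡ B)           ≈⟨ alternating-unique alternating A ⟩
    det A * det (δ ⊡ B)   ≈⟨ *-congˡ (det-cong δ⊡B) ⟩
    det A * det B         ∎
    where
    module D = Alternating (det∘ᵀ-alternating {n})

    δ⊡B : δ ⊡ B ≋ B
    δ⊡B i k = begin
      (sum λ j → δ i j * B j k)  ≈⟨ sum-cong-≋ (λ j → trans (*-comm _ _) (*-congˡ (reflexive (δ-sym i j)))) ⟩
      (sum λ j → B j k * δ j i)  ≈⟨ δ-expansion (λ j → B j k) i ⟨
      B i k                      ∎

    row-linear : ∀ a {u v w : Fin n → Carrier} → (∀ k → u k ≈ v k + a * w k) → ∀ k →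
      (sum λ j → u j * B j k) ≈ (sum λ j → v j * B j k) + a * (sum λ j → w j * B j k)
    row-linear a {u} {v} {w} u≈ k = begin
      (sum λ j → u j * B j k)
        ≈⟨ sum-cong-≋ (λ j → trans (*-congʳ (u≈ j))
             (solve 4 (λ v a w b → (v :+ a :* w) :* b := v :* b :+ a :* (w :* b)) refl _ _ _ _)) ⟩
      (sum λ j → v j * B j k + a * (w j * B j k))
        ≈⟨ ∑-distrib-+ (λ j → v j * B j k) (λ j → a * (w j * B j k)) ⟩
      (sum λ j → v j * B j k) + (sum λ j → a * (w j * B j k))
        ≈⟨ +-congˡ (*-distribˡ-sum a (λ j → w j * B j k)) ⟨
      (sum λ j → v j * B j k) + a * (sum λ j → w j * B j k) ∎

    row-cong : ∀ {u v : Fin n → Carrier} → (∀ k → u k ≈ v k) → ∀ k →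
      (sum λ j → u j * B j k) ≈ (sum λ j → v j * B j k)
    row-cong u≈v k = sum-cong-≋ λ j → *-congʳ (u≈v j)

    alternating : Alternating (λ A → det (A ⊡ B))
    alternating = record
      { cong       = λ A≋B → det-cong λ i → row-cong (A≋B i)
      ; linear     = λ i a {X} {Y} {Z} X≈ X≈Y X≈Z → begin
          det (X ⊡ B)
            ≈⟨ det-ᵀ (X ⊡ B) ⟨
          det ((X ⊡ B) ᵀ)
            ≈⟨ D.linear i a {X ⊡ B} {Y ⊡ B} {Z ⊡ B} (row-linear a X≈)
                 (λ r r≢i → row-cong (X≈Y r r≢i)) (λ r r≢i → row-cong (X≈Z r r≢i)) ⟩
          det ((Y ⊡ B) ᵀ) + a * det ((Z ⊡ B) ᵀ)
            ≈⟨ +-cong (det-ᵀ (Y ⊡ B)) (*-congˡ (det-ᵀ (Z ⊡ B))) ⟩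
          det (Y ⊡ B) + a * det (Z ⊡ B) ∎
      ; alternates = λ {_} {_} {X} a Xᵢ≈Xⱼ →
          trans (sym (det-ᵀ (X ⊡ B))) (D.alternates {A = X ⊡ B} a (row-cong Xᵢ≈Xⱼ))
      }

-- Skew-symmetric integer determinants are squares

-- After division by the gcd, `n / g` is coprime to `m / g` and divides its square, hence divides
-- `m / g`.
n*n∣m*m⇒n∣m : ∀ n m .{{_ : ℕ.NonZero n}} → n ℕ.* n ℕ.∣ m ℕ.* m → n ℕ.∣ m
n*n∣m*m⇒n∣m n m n²∣m² = ≡.subst₂ ℕ._∣_ n≡ m≡ (ℕ.*-monoˡ-∣ g n/g∣m/g)
  where
  g = ℕ.gcd n m
  instance
    g≢0 : ℕ.NonZero g
    g≢0 = ℕ.≢-nonZero (ℕ.gcd[m,n]≢0 n m (inj₁ (ℕ.≢-nonZero⁻¹ n)))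
    g²≢0 : ℕ.NonZero (g ℕ.* g)
    g²≢0 = ℕ.m*n≢0 g g
  n≡ : n ℕ./ g ℕ.* g ≡ n
  n≡ = ℕ.m/n*n≡m (ℕ.gcd[m,n]∣m n m)
  m≡ : m ℕ./ g ℕ.* g ≡ m
  m≡ = ℕ.m/n*n≡m (ℕ.gcd[m,n]∣n n m)
  square : ∀ k l → l ℕ.* g ≡ k → k ℕ.* k ≡ l ℕ.* l ℕ.* (g ℕ.* g)
  square _ l ≡.refl = ℕ.[m*n]*[o*p]≡[m*o]*[n*p] l g l g
  n/g∣m/g : n ℕ./ g ℕ.∣ m ℕ./ g
  n/g∣m/g = Coprimality.coprime-divisor (Coprimality.coprime-/gcd n m)
    (ℕ.∣-trans (ℕ.m∣m*n (n ℕ./ g))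
      (ℕ.*-cancelʳ-∣ (g ℕ.* g) (≡.subst₂ ℕ._∣_ (square n (n ℕ./ g) n≡) (square m (m ℕ./ g) m≡) n²∣m²)))

-- Elimination only shows that `u² d` is a square. That `d` itself is the square of an integer rests
-- on `u² ∣ v²` forcing `u ∣ v`.
square-quotient : ∀ u v d → u ≢ 0ℤ → u ℤ.* u ℤ.* d ≡ v ℤ.* v → ∃[ w ] (w ℤ.* w ≡ d)
square-quotient u v d u≢0 u²d≡v² = w , ℤ.*-cancelˡ-≡ (u ℤ.* u) (w ℤ.* w) d (begin
  u ℤ.* u ℤ.* (w ℤ.* w)   ≡⟨ rearrange u w ⟩
  (w ℤ.* u) ℤ.* (w ℤ.* u) ≡⟨ ≡.cong (λ z → z ℤ.* z) v≡wu ⟨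
  v ℤ.* v                 ≡⟨ u²d≡v² ⟨
  u ℤ.* u ℤ.* d           ∎)
  where
  open ≡.≡-Reasoning
  instance
    ∣u∣≢0 : ℕ.NonZero ∣ u ∣
    ∣u∣≢0 = ℕ.≢-nonZero (u≢0 ∘ ℤ.∣i∣≡0⇒i≡0)
    u²≢0 : ℤ.NonZero (u ℤ.* u)
    u²≢0 = ℤ.i*j≢0 u u
  rearrange : ∀ u w → u ℤ.* u ℤ.* (w ℤ.* w) ≡ (w ℤ.* u) ℤ.* (w ℤ.* u)
  rearrange = ℤ.solve-∀
  u∣v : u ℤ.∣ v
  u∣v = ℤ.∣ᵤ⇒∣ (n*n∣m*m⇒n∣m ∣ u ∣ ∣ v ∣
    (≡.subst₂ ℕ._∣_ (ℤ.abs-* u u) (ℤ.abs-* v v)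
      (ℤ.∣⇒∣ᵤ (ℤ.divides d (≡.trans (≡.sym u²d≡v²) (ℤ.*-comm (u ℤ.* u) d))))))
  open ℤ._∣_ u∣v renaming (quotient to w; equality to v≡wu)

i≡-i⇒i≡0 : ∀ i → i ≡ ℤ.- i → i ≡ 0ℤ
i≡-i⇒i≡0 (+ zero)  _  = ≡.refl
i≡-i⇒i≡0 (+ suc n) ()
i≡-i⇒i≡0 -[1+ n ]  ()

module SkewSymmetric where
  open Determinant ℤ.+-*-commutativeRing
  open SemiringSum ℤ.+-*-semiring using (sum; sum-cong-≋; ∑-comm; ∑-distrib-+; *-distribˡ-sum; *-distribʳ-sum)
  open CommutativeMonoidSum ℤ.*-1-commutativeMonoid using () renaming (sum to product)
  open CommutativeSemiringExp ℤ.+-*-commutativeSemiring using (_^_; ^-homo-*)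
  open ≡.≡-Reasoning

  Skew : ∀ {n} → Matrix n n → Set
  Skew A = ∀ i k → A i k ≡ ℤ.- A k i

  skew-diagonal : ∀ {n} {A : Matrix n n} → Skew A → ∀ i → A i i ≡ 0ℤ
  skew-diagonal skew i = i≡-i⇒i≡0 _ (skew i i)

  skew-congruence : ∀ {n} (E : Matrix n n) {A} → Skew A → Skew (E ⊡ A ⊡ E ᵀ)
  skew-congruence {n} E {A} skew i k = begin
    (E ⊡ A ⊡ E ᵀ) i k
      ≡⟨ sum-cong-≋ {n} (λ b → *-distribʳ-sum (E k b) (λ a → E i a ℤ.* A a b)) ⟩
    (sum λ b → sum λ a → E i a ℤ.* A a b ℤ.* E k b)
      ≡⟨ ∑-comm {n} {n} (λ b a → E i a ℤ.* A a b ℤ.* E k b) ⟩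
    (sum λ a → sum λ b → E i a ℤ.* A a b ℤ.* E k b)
      ≡⟨ sum-cong-≋ {n} (λ a → sum-cong-≋ {n} λ b →
           ≡.trans (≡.cong (λ z → E i a ℤ.* z ℤ.* E k b) (skew a b)) (flip (E i a) (A b a) (E k b))) ⟩
    (sum λ a → sum λ b → -1ℤ ℤ.* (E k b ℤ.* A b a ℤ.* E i a))
      ≡⟨ sum-cong-≋ {n} (λ a → *-distribˡ-sum -1ℤ (λ b → E k b ℤ.* A b a ℤ.* E i a)) ⟨
    (sum λ a → -1ℤ ℤ.* (sum λ b → E k b ℤ.* A b a ℤ.* E i a))
      ≡⟨ *-distribˡ-sum -1ℤ (λ a → sum λ b → E k b ℤ.* A b a ℤ.* E i a) ⟨
    -1ℤ ℤ.* (sum λ a → sum λ b → E k b ℤ.* A b a ℤ.* E i a)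
      ≡⟨ ≡.cong (-1ℤ ℤ.*_) (sum-cong-≋ {n} λ a → *-distribʳ-sum (E i a) (λ b → E k b ℤ.* A b a)) ⟨
    -1ℤ ℤ.* (E ⊡ A ⊡ E ᵀ) k i
      ≡⟨ ℤ.-1*i≡-i _ ⟩
    ℤ.- (E ⊡ A ⊡ E ᵀ) k i ∎
    where
    flip : ∀ x y z → x ℤ.* (ℤ.- y) ℤ.* z ≡ -1ℤ ℤ.* (z ℤ.* y ℤ.* x)
    flip = ℤ.solve-∀

  -- Congruence by the unipotent 1 + e₁ eⱼᵀ moves a nonzero entry (0, j) to position (0, 1).
  module MovePivot {n} (A : Matrix (suc (suc n)) (suc (suc n))) (j : Fin n) where

    E : Matrix (suc (suc n)) (suc (suc n))
    E zero          = δ zero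
    E (suc zero)    = λ k → δ (suc zero) k ℤ.+ δ (suc (suc j)) k
    E (suc (suc i)) = δ (suc (suc i))

    E-upper : ∀ {i k} → i Fin.< k → E k i ≡ 0ℤ
    E-upper {zero}  {suc zero}    _ = ≡.refl
    E-upper {suc i} {suc zero}    (ℕ.s≤s ())
    E-upper {i}     {suc (suc k)} i<k = δ-off-diagonal (Fin.<⇒≢ i<k ∘ ≡.sym)

    det-E : det E ≡ 1ℤ
    det-E = begin
      det E                    ≡⟨ det-ᵀ E ⟨
      det (E ᵀ)                ≡⟨ det-lower E-upper ⟩
      product (λ i → E i i)    ≡⟨ product-one E-diagonal ⟩
      1ℤ                       ∎
      where
      E-diagonal : ∀ i → E i i ≡ 1ℤ
      E-diagonal zero          = ≡.refl
      E-diagonal (suc zero)    = ≡.refl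
      E-diagonal (suc (suc i)) = δ-diagonal i

    moved : Matrix (suc (suc n)) (suc (suc n))
    moved = E ⊡ A ⊡ E ᵀ

    det-moved : det moved ≡ det A
    det-moved = begin
      det (E ⊡ A ⊡ E ᵀ)            ≡⟨ det-* (E ⊡ A) (E ᵀ) ⟩
      det (E ⊡ A) ℤ.* det (E ᵀ)    ≡⟨ ≡.cong₂ ℤ._*_ (det-* E A) (≡.trans (det-ᵀ E) det-E) ⟩
      det E ℤ.* det A ℤ.* 1ℤ       ≡⟨ ≡.cong (λ z → z ℤ.* det A ℤ.* 1ℤ) det-E ⟩
      1ℤ ℤ.* det A ℤ.* 1ℤ          ≡⟨ ≡.trans (ℤ.*-identityʳ _) (ℤ.*-identityˡ _) ⟩
      det A                        ∎

    -- When `A₀₁ = 0` the right side is the nonzero entry found further along the row, so the moved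
    -- matrix has a usable pivot.
    moved-pivot : moved zero (suc zero) ≡ A zero (suc zero) ℤ.+ A zero (suc (suc j))
    moved-pivot = begin
      moved zero (suc zero)
        ≡⟨ sum-cong-≋ {suc (suc n)} (λ b → ≡.trans (≡.cong (ℤ._* E (suc zero) b) (row0 b))
               (ℤ.*-distribˡ-+ (A zero b) (δ (suc zero) b) (δ (suc (suc j)) b))) ⟩
      (sum λ b → A zero b ℤ.* δ (suc zero) b ℤ.+ A zero b ℤ.* δ (suc (suc j)) b)
        ≡⟨ ∑-distrib-+ (λ b → A zero b ℤ.* δ (suc zero) b) (λ b → A zero b ℤ.* δ (suc (suc j)) b) ⟩
      (sum λ b → A zero b ℤ.* δ (suc zero) b) ℤ.+ (sum λ b → A zero b ℤ.* δ (suc (suc j)) b)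
        ≡⟨ ≡.cong₂ ℤ._+_ (pick (suc zero)) (pick (suc (suc j))) ⟩
      A zero (suc zero) ℤ.+ A zero (suc (suc j)) ∎
      where
      pick : ∀ k → (sum λ b → A zero b ℤ.* δ k b) ≡ A zero k
      pick k = ≡.trans (sum-cong-≋ {suc (suc n)} λ b → ≡.cong (A zero b ℤ.*_) (δ-sym k b))
        (≡.sym (δ-expansion (A zero) k))
      row0 : ∀ b → (sum λ a → δ zero a ℤ.* A a b) ≡ A zero b
      row0 b = ≡.trans (sum-cong-≋ {suc (suc n)} λ a →
          ≡.trans (ℤ.*-comm (δ zero a) (A a b)) (≡.cong (A a b ℤ.*_) (δ-sym zero a)))
        (≡.sym (δ-expansion (λ a → A a b) zero))

  -- Clearing the first two columns with the pivot a = A₀₁, after scaling the other rows by a.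
  module Condense {n} (A : Matrix (suc (suc n)) (suc (suc n))) (skew : Skew A) where

    a = A zero (suc zero)

    -- The entry is the Pfaffian of `A` restricted to the indices `0`, `1`, `i + 2`, `k + 2`.
    condensed : Matrix n n
    condensed i k = A (suc zero) (suc (suc i)) ℤ.* A zero (suc (suc k))
      ℤ.+ ℤ.- A zero (suc (suc i)) ℤ.* A (suc zero) (suc (suc k))
      ℤ.+ a ℤ.* A (suc (suc i)) (suc (suc k))

    condensed-skew : Skew condensed
    condensed-skew i k = begin
      condensed i k
        ≡⟨ ≡.cong (λ z → u i ℤ.* v k ℤ.+ ℤ.- v i ℤ.* u k ℤ.+ a ℤ.* z) (skew _ _) ⟩
      u i ℤ.* v k ℤ.+ ℤ.- v i ℤ.* u k ℤ.+ a ℤ.* ℤ.- A (suc (suc k)) (suc (suc i))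
        ≡⟨ antisym (u i) (v k) (v i) (u k) a _ ⟩
      ℤ.- condensed k i ∎
      where
      u v : Fin n → ℤ
      u i = A (suc zero) (suc (suc i))
      v i = A zero (suc (suc i))
      antisym : ∀ uᵢ vₖ vᵢ uₖ a b →
        uᵢ ℤ.* vₖ ℤ.+ ℤ.- vᵢ ℤ.* uₖ ℤ.+ a ℤ.* ℤ.- b ≡
        ℤ.- (uₖ ℤ.* vᵢ ℤ.+ ℤ.- vₖ ℤ.* uᵢ ℤ.+ a ℤ.* b)
      antisym = ℤ.solve-∀

    -- Row operations alone suffice: skew symmetry of `A` makes the first two columns of `P ⊡ A`
    -- vanish below the second row, which leaves `condensed` as the lower right block.
    P : Matrix (suc (suc n)) (suc (suc n))
    P zero          = δ zero
    P (suc zero)    = δ (suc zero)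
    P (suc (suc i)) zero          = A (suc zero) (suc (suc i))
    P (suc (suc i)) (suc zero)    = ℤ.- A zero (suc (suc i))
    P (suc (suc i)) (suc (suc k)) = a ℤ.* δ i k

    P-lower : ∀ {i k} → i Fin.< k → P i k ≡ 0ℤ
    P-lower {zero}        i<k = δ-off-diagonal (Fin.<⇒≢ i<k)
    P-lower {suc zero}    i<k = δ-off-diagonal (Fin.<⇒≢ i<k)
    P-lower {suc (suc i)} {suc zero}    (ℕ.s≤s ())
    P-lower {suc (suc i)} {suc (suc k)} (ℕ.s≤s (ℕ.s≤s i<k)) =
      ≡.trans (≡.cong (a ℤ.*_) (δ-off-diagonal (Fin.<⇒≢ i<k))) (ℤ.*-zeroʳ a)

    product-const : ∀ m → product {m} (λ _ → a) ≡ a ^ m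
    product-const zero    = ≡.refl
    product-const (suc m) = ≡.cong (a ℤ.*_) (product-const m)

    det-P : det P ≡ a ^ n
    det-P = begin
      det P                            ≡⟨ det-lower P-lower ⟩
      1ℤ ℤ.* (1ℤ ℤ.* tail)             ≡⟨ ≡.trans (ℤ.*-identityˡ (1ℤ ℤ.* tail)) (ℤ.*-identityˡ tail) ⟩
      tail                             ≡⟨ product-cong-δ n ⟩
      product {n} (λ _ → a)            ≡⟨ product-const n ⟩
      a ^ n                            ∎
      where
      tail = product {n} (λ i → a ℤ.* δ i i)
      product-cong-δ : ∀ m → product {m} (λ i → a ℤ.* δ i i) ≡ product {m} (λ _ → a)
      product-cong-δ zero    = ≡.refl
      product-cong-δ (suc m) = ≡.cong₂ ℤ._*_ (ℤ.*-identityʳ a) (product-cong-δ m)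

    cleared : Matrix (suc (suc n)) (suc (suc n))
    cleared = P ⊡ A

    cleared-0 : ∀ k → cleared zero k ≡ A zero k
    cleared-0 k = begin
      cleared zero k          ≡⟨ sum-head (λ j → δ zero j ℤ.* A j k) (λ j → ℤ.*-zeroˡ (A (suc j) k)) ⟩
      1ℤ ℤ.* A zero k         ≡⟨ ℤ.*-identityˡ _ ⟩
      A zero k                ∎

    cleared-1 : ∀ k → cleared (suc zero) k ≡ A (suc zero) k
    cleared-1 k = begin
      cleared (suc zero) k    ≡⟨ ≡.trans (≡.cong (ℤ._+ rest) (ℤ.*-zeroˡ (A zero k))) (ℤ.+-identityˡ rest) ⟩
      rest                    ≡⟨ sum-head (λ j → δ zero j ℤ.* A (suc j) k) (λ j → ℤ.*-zeroˡ (A (suc (suc j)) k)) ⟩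
      1ℤ ℤ.* A (suc zero) k   ≡⟨ ℤ.*-identityˡ _ ⟩
      A (suc zero) k          ∎
      where rest = sum λ j → δ zero j ℤ.* A (suc j) k

    cleared-2+ : ∀ i k → cleared (suc (suc i)) k ≡
      A (suc zero) (suc (suc i)) ℤ.* A zero k
      ℤ.+ ℤ.- A zero (suc (suc i)) ℤ.* A (suc zero) k
      ℤ.+ a ℤ.* A (suc (suc i)) k
    cleared-2+ i k = begin
      x ℤ.+ (y ℤ.+ (sum λ j → a ℤ.* δ i j ℤ.* A (suc (suc j)) k))
        ≡⟨ ≡.cong (λ z → x ℤ.+ (y ℤ.+ z)) tail ⟩
      x ℤ.+ (y ℤ.+ a ℤ.* A (suc (suc i)) k)
        ≡⟨ ℤ.+-assoc x y _ ⟨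
      x ℤ.+ y ℤ.+ a ℤ.* A (suc (suc i)) k ∎
      where
      x = A (suc zero) (suc (suc i)) ℤ.* A zero k
      y = ℤ.- A zero (suc (suc i)) ℤ.* A (suc zero) k
      regroup : ∀ a d b → a ℤ.* d ℤ.* b ≡ a ℤ.* (b ℤ.* d)
      regroup = ℤ.solve-∀
      tail : (sum λ j → a ℤ.* δ i j ℤ.* A (suc (suc j)) k) ≡ a ℤ.* A (suc (suc i)) k
      tail = begin
        (sum λ j → a ℤ.* δ i j ℤ.* A (suc (suc j)) k)
          ≡⟨ sum-cong-≋ {n} (λ j → ≡.trans (regroup a (δ i j) (A (suc (suc j)) k))
               (≡.cong (λ d → a ℤ.* (A (suc (suc j)) k ℤ.* d)) (δ-sym i j))) ⟩
        (sum λ j → a ℤ.* (A (suc (suc j)) k ℤ.* δ j i))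
          ≡⟨ *-distribˡ-sum a (λ j → A (suc (suc j)) k ℤ.* δ j i) ⟨
        a ℤ.* (sum λ j → A (suc (suc j)) k ℤ.* δ j i)
          ≡⟨ ≡.cong (a ℤ.*_) (δ-expansion (λ j → A (suc (suc j)) k) i) ⟨
        a ℤ.* A (suc (suc i)) k ∎

    column-0 : ∀ i → cleared (suc (suc i)) zero ≡ 0ℤ
    column-0 i = begin
      cleared (suc (suc i)) zero
        ≡⟨ cleared-2+ i zero ⟩
      u ℤ.* A zero zero ℤ.+ ℤ.- v ℤ.* A (suc zero) zero ℤ.+ a ℤ.* A (suc (suc i)) zero
        ≡⟨ ≡.cong₂ (λ x y → u ℤ.* x ℤ.+ ℤ.- v ℤ.* A (suc zero) zero ℤ.+ a ℤ.* y)
             (skew-diagonal skew zero) (skew _ _) ⟩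
      u ℤ.* 0ℤ ℤ.+ ℤ.- v ℤ.* A (suc zero) zero ℤ.+ a ℤ.* ℤ.- v
        ≡⟨ ≡.cong (λ x → u ℤ.* 0ℤ ℤ.+ ℤ.- v ℤ.* x ℤ.+ a ℤ.* ℤ.- v) (skew _ _) ⟩
      u ℤ.* 0ℤ ℤ.+ ℤ.- v ℤ.* ℤ.- a ℤ.+ a ℤ.* ℤ.- v
        ≡⟨ vanish u v a ⟩
      0ℤ ∎
      where
      u = A (suc zero) (suc (suc i))
      v = A zero (suc (suc i))
      vanish : ∀ u v a → u ℤ.* 0ℤ ℤ.+ ℤ.- v ℤ.* ℤ.- a ℤ.+ a ℤ.* ℤ.- v ≡ 0ℤ
      vanish = ℤ.solve-∀

    column-1 : ∀ i → cleared (suc (suc i)) (suc zero) ≡ 0ℤ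
    column-1 i = begin
      cleared (suc (suc i)) (suc zero)
        ≡⟨ cleared-2+ i (suc zero) ⟩
      u ℤ.* a ℤ.+ ℤ.- v ℤ.* A (suc zero) (suc zero) ℤ.+ a ℤ.* A (suc (suc i)) (suc zero)
        ≡⟨ ≡.cong₂ (λ x y → u ℤ.* a ℤ.+ ℤ.- v ℤ.* x ℤ.+ a ℤ.* y)
             (skew-diagonal skew (suc zero)) (skew _ _) ⟩
      u ℤ.* a ℤ.+ ℤ.- v ℤ.* 0ℤ ℤ.+ a ℤ.* ℤ.- u
        ≡⟨ vanish u v a ⟩
      0ℤ ∎
      where
      u = A (suc zero) (suc (suc i))
      v = A zero (suc (suc i))
      vanish : ∀ u v a → u ℤ.* a ℤ.+ ℤ.- v ℤ.* 0ℤ ℤ.+ a ℤ.* ℤ.- u ≡ 0ℤ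
      vanish = ℤ.solve-∀

    minor : Matrix (suc n) (suc n)
    minor i k = cleared (punchIn (suc zero) k) (suc i)

    det-minor : det minor ≡ a ℤ.* det condensed
    det-minor = begin
      det minor
        ≡⟨ sum-head (laplaceTerm minor) (λ k → laplaceTerm-zero minor (suc k) (column-1 k)) ⟩
      1ℤ ℤ.* cleared zero (suc zero) ℤ.* det (λ i k → cleared (suc (suc k)) (suc (suc i)))
        ≡⟨ ≡.cong₂ ℤ._*_ (≡.trans (ℤ.*-identityˡ _) (cleared-0 (suc zero)))
             (≡.trans (det-ᵀ (λ i k → cleared (suc (suc i)) (suc (suc k))))
                      (det-cong {n} λ i k → cleared-2+ i (suc (suc k)))) ⟩
      a ℤ.* det condensed ∎

    det-cleared : det cleared ≡ a ℤ.* a ℤ.* det condensed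
    det-cleared = begin
      det cleared
        ≡⟨ det-ᵀ cleared ⟨
      det (cleared ᵀ)
        ≡⟨ ≡.cong₂ ℤ._+_ head tail ⟩
      0ℤ ℤ.+ -1ℤ ℤ.* ℤ.- a ℤ.* (a ℤ.* det condensed)
        ≡⟨ simplify a (det condensed) ⟩
      a ℤ.* a ℤ.* det condensed ∎
      where
      simplify : ∀ a d → 0ℤ ℤ.+ -1ℤ ℤ.* ℤ.- a ℤ.* (a ℤ.* d) ≡ a ℤ.* a ℤ.* d
      simplify = ℤ.solve-∀
      term = laplaceTerm (cleared ᵀ)
      head : term zero ≡ 0ℤ
      head = laplaceTerm-zero (cleared ᵀ) zero (≡.trans (cleared-0 zero) (skew-diagonal skew zero))
      tail : sum (term ∘ suc) ≡ -1ℤ ℤ.* ℤ.- a ℤ.* (a ℤ.* det condensed)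
      tail = begin
        sum (term ∘ suc)
          ≡⟨ sum-head (term ∘ suc) (λ k → laplaceTerm-zero (cleared ᵀ) (suc (suc k)) (column-0 k)) ⟩
        -1ℤ ℤ.* cleared (suc zero) zero ℤ.* det minor
          ≡⟨ ≡.cong₂ (λ x y → -1ℤ ℤ.* x ℤ.* y) (≡.trans (cleared-1 zero) (skew _ _)) det-minor ⟩
        -1ℤ ℤ.* ℤ.- a ℤ.* (a ℤ.* det condensed) ∎

    det-condensed : a ^ n ℤ.* det A ≡ a ℤ.* a ℤ.* det condensed
    det-condensed = ≡.trans (≡.trans (≡.cong (ℤ._* det A) (≡.sym det-P)) (≡.sym (det-* P A))) det-cleared

  ^-double : ∀ a k → a ^ (k ℕ.* 2) ≡ a ^ k ℤ.* a ^ k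
  ^-double a k = begin
    a ^ (k ℕ.* 2)      ≡⟨ ≡.cong (a ^_) (≡.trans (ℕ.*-comm k 2) (≡.cong (k ℕ.+_) (ℕ.+-identityʳ k))) ⟩
    a ^ (k ℕ.+ k)      ≡⟨ ^-homo-* a k k ⟩
    a ^ k ℤ.* a ^ k    ∎

  ^-≢0 : ∀ {a} k → a ≢ 0ℤ → a ^ k ≢ 0ℤ
  ^-≢0 {a} (suc k) a≢0 eq with ℤ.i*j≡0⇒i≡0∨j≡0 a eq
  ... | inj₁ a≡0  = a≢0 a≡0
  ... | inj₂ aᵏ≡0 = ^-≢0 k a≢0 aᵏ≡0

  det-skew-square : ∀ k (A : Matrix (k ℕ.* 2) (k ℕ.* 2)) → Skew A → ∃[ s ] (s ℤ.* s ≡ det A)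
  pivoted : ∀ k (A : Matrix (suc k ℕ.* 2) (suc k ℕ.* 2)) → Skew A → A zero (suc zero) ≢ 0ℤ →
    ∃[ s ] (s ℤ.* s ≡ det A)

  det-skew-square zero    A skew = 1ℤ , ≡.refl
  det-skew-square (suc k) A skew with Fin.any? (λ j → ¬? (A zero j ℤ.≟ 0ℤ))
  ... | no all-zero = 0ℤ , ≡.sym (sum-zero {f = laplaceTerm A} λ j →
    laplaceTerm-zero A j (decidable-stable (A zero j ℤ.≟ 0ℤ) (λ ≢0 → all-zero (j , ≢0))))
  ... | yes (zero , ≢0) = contradiction (skew-diagonal skew zero) ≢0
  ... | yes (suc zero , ≢0) = pivoted k A skew ≢0
  ... | yes (suc (suc j) , ≢0) with A zero (suc zero) ℤ.≟ 0ℤ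
  ...   | no  pivot≢0 = pivoted k A skew pivot≢0
  ...   | yes pivot≡0 = s , ≡.trans s²≡ M.det-moved
    where
    module M = MovePivot A j
    moved≢0 : M.moved zero (suc zero) ≢ 0ℤ
    moved≢0 eq = ≢0 (≡.trans (≡.sym (≡.trans M.moved-pivot
      (≡.trans (≡.cong (ℤ._+ A zero (suc (suc j))) pivot≡0) (ℤ.+-identityˡ _)))) eq)
    square = pivoted k M.moved (skew-congruence M.E skew) moved≢0
    s = proj₁ square
    s²≡ = proj₂ square

  pivoted k A skew a≢0 with t , t²≡ ← det-skew-square k (Condense.condensed A skew) (Condense.condensed-skew A skew) =
    -- The condensed matrix has order `2k`, so `a` occurs to an even power on the left, while the
    -- right side is the square of `a t`.
    square-quotient (a ^ k) (a ℤ.* t) (det A) (^-≢0 k a≢0) (begin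
      a ^ k ℤ.* a ^ k ℤ.* det A        ≡⟨ ≡.cong (ℤ._* det A) (^-double a k) ⟨
      a ^ (k ℕ.* 2) ℤ.* det A          ≡⟨ det-condensed ⟩
      a ℤ.* a ℤ.* det condensed        ≡⟨ ≡.cong (a ℤ.* a ℤ.*_) t²≡ ⟨
      a ℤ.* a ℤ.* (t ℤ.* t)            ≡⟨ ℤ-rearrange a t ⟩
      (a ℤ.* t) ℤ.* (a ℤ.* t)          ∎)
    where
    open Condense A skew
    ℤ-rearrange : ∀ a t → a ℤ.* a ℤ.* (t ℤ.* t) ≡ (a ℤ.* t) ℤ.* (a ℤ.* t)
    ℤ-rearrange = ℤ.solve-∀

  -- The two determinants differ only in the power function that forms the sign.
  det-Defs : ∀ {n} (A : Fin n → Fin n → ℤ) → Defs.det A ≡ det A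
  det-Defs {zero}  A = ≡.refl
  det-Defs {suc n} A = sum-cong-≋ {suc n}
    {λ j → -1ℤ ℤ.^ toℕ j ℤ.* A zero j ℤ.* Defs.det (λ i k → A (suc i) (punchIn j k))} {laplaceTerm A}
    λ j → ≡.cong₂ (λ ε d → ε ℤ.* A zero j ℤ.* d) (signs (toℕ j)) (det-Defs (λ i k → A (suc i) (punchIn j k)))
    where
    signs : ∀ k → -1ℤ ℤ.^ k ≡ (ℤ.- 1ℤ) ^ k
    signs zero    = ≡.refl
    signs (suc k) = ≡.cong (-1ℤ ℤ.*_) (signs k)

-- Binomial coefficients modulo a prime and the Frobenius map

prime∤! : ∀ {p k} → Prime p → k ℕ.< p → ¬ p ℕ.∣ k !
prime∤! {k = zero}  pr 0<p p∣1 = ℕ.nonTrivial⇒≢1 {{prime⇒nonTrivial pr}} (ℕ.∣1⇒≡1 p∣1)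
prime∤! {k = suc k} pr k<p p∣k! with euclidsLemma (suc k) (k !) pr p∣k!
... | inj₁ p∣1+k = ℕ.>⇒∤ k<p p∣1+k
... | inj₂ p∣k!′ = prime∤! pr (ℕ.<-trans ℕ.≤-refl k<p) p∣k!′

nCk*k!*[n∸k]! : ∀ {n k} → k ℕ.≤ n → (n C k) ℕ.* (k ! ℕ.* (n ℕ.∸ k) !) ≡ n !
nCk*k!*[n∸k]! {n} {k} k≤n = ≡.trans
  (≡.cong (ℕ._* d) {n C k} {n ! ℕ./ d} (nCk≡n!/k![n-k]! k≤n))
  (ℕ.m/n*n≡m {n !} {d} (k![n∸k]!∣n! k≤n))
  where
  d = k ! ℕ.* (n ℕ.∸ k) !
  instance
    d≢0 : ℕ.NonZero d
    d≢0 = k ℕ.!* (n ℕ.∸ k) !≢0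

prime∣nCk : ∀ {p k} → Prime p → 0 ℕ.< k → k ℕ.< p → p ℕ.∣ p C k
prime∣nCk {p@(suc q)} {k} pr 0<k k<p
  with euclidsLemma (p C k) (k ! ℕ.* (p ℕ.∸ k) !) pr
         (≡.subst (p ℕ.∣_) (≡.sym (nCk*k!*[n∸k]! (ℕ.<⇒≤ k<p))) (ℕ.m∣m*n (q !)))
... | inj₁ p∣pCk = p∣pCk
... | inj₂ p∣rest with euclidsLemma (k !) ((p ℕ.∸ k) !) pr p∣rest
...   | inj₁ p∣k!     = contradiction p∣k! (prime∤! pr k<p)
...   | inj₂ p∣[p∸k]! = contradiction p∣[p∸k]! (prime∤! pr (ℕ.∸-monoʳ-< 0<k (ℕ.<⇒≤ k<p)))

module Frobenius {c ℓ} (R : CommutativeRing c ℓ) where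
  open CommutativeRing R hiding (zero)
  open CommutativeSemiringExp commutativeSemiring using (_^_)
  open SemiringSum semiring using (sum; sum-init-last)
  open SemiringMult semiring
    using (×-assoc-*; ×-congʳ; ×-homo-1; ×-assocˡ) renaming (_×_ to _·_)
  open Determinant R using (sum-zero)
  open SetoidReasoning setoid

  module _ {q} (prime : Prime (suc q)) (p·1≈0 : suc q · 1# ≈ 0#) where
    private p = suc q

    p∣n⇒n·x≈0 : ∀ {n} → p ℕ.∣ n → ∀ x → n · x ≈ 0#
    p∣n⇒n·x≈0 (ℕ.divides q ≡.refl) x = begin
      (q ℕ.* p) · x         ≡⟨ ≡.cong (_· x) (ℕ.*-comm q p) ⟩
      (p ℕ.* q) · x         ≈⟨ ×-assocˡ x p q ⟨
      p · (q · x)           ≈⟨ ×-congʳ p (*-identityˡ _) ⟨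
      p · (1# * q · x)      ≈⟨ ×-assoc-* p 1# _ ⟨
      p · 1# * q · x        ≈⟨ *-congʳ p·1≈0 ⟩
      0# * q · x            ≈⟨ zeroˡ _ ⟩
      0#                    ∎

    frobenius-+ : ∀ x y → (x + y) ^ p ≈ x ^ p + y ^ p
    frobenius-+ x y = begin
      (x + y) ^ p                         ≈⟨ Binomial.theorem commutativeSemiring p x y ⟩
      term zero + sum (term ∘ suc)        ≈⟨ +-cong (trans (×-homo-1 _) (*-identityˡ _)) (sum-init-last (term ∘ suc)) ⟩
      y ^ p + (sum (init (term ∘ suc)) + last (term ∘ suc))
        ≈⟨ +-congˡ (+-cong (sum-zero middle) top) ⟩
      y ^ p + (0# + x ^ p)                ≈⟨ trans (+-congˡ (+-identityˡ _)) (+-comm _ _) ⟩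
      x ^ p + y ^ p                       ∎
      where
      term = Binomial.binomialTerm commutativeSemiring x y p
      middle : ∀ i → init (term ∘ suc) i ≈ 0#
      middle i = p∣n⇒n·x≈0 (prime∣nCk prime (ℕ.s≤s ℕ.z≤n) (ℕ.s≤s (≡.subst (ℕ._< q) (≡.sym (Fin.toℕ-inject₁ i)) (Fin.toℕ<n i))))
        (Binomial.binomial commutativeSemiring x y p (suc (Fin.inject₁ i)))
      top : last (term ∘ suc) ≈ x ^ p
      top rewrite Fin.toℕ-fromℕ q | nCn≡1 p | ℕ.n∸n≡0 q = trans (×-homo-1 _) (*-identityʳ _)

-- Monic polynomial functions and roots of unity

module RootsOfUnity {c ℓ} (R : CommutativeRing c ℓ) where
  open CommutativeRing R hiding (zero)
  open AbelianGroupProperties +-abelianGroup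
    using () renaming (x∙y⁻¹≈ε⇒x≈y to x-y≈0⇒x≈y; x≈y⇒x∙y⁻¹≈ε to x≈y⇒x-y≈0)
  open CommutativeSemiringExp commutativeSemiring
  open CommutativeMonoidSum *-commutativeMonoid using () renaming (sum to product)
  open IntegerCoefficients R using (solve; _:=_; _:+_; _:*_; _:-_; :-_; con)
  open SetoidReasoning setoid

  -- A polynomial is a function together with a Horner scheme that witnesses its degree and leading
  -- coefficient, so no polynomial ring has to be built.
  data Monic : ℕ → (Carrier → Carrier) → Set (c ⊔ ℓ) where
    one    : ∀ {f} → (∀ x → f x ≈ 1#) → Monic 0 f
    horner : ∀ {n f g} a → Monic n g → (∀ x → f x ≈ x * g x + a) → Monic (suc n) f

  ^-monic : ∀ n → Monic n (_^ n)
  ^-monic zero    = one λ x → refl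
  ^-monic (suc n) = horner 0# (^-monic n) λ x → sym (+-identityʳ _)

  ^-1-monic : ∀ n .{{_ : ℕ.NonZero n}} → Monic n (λ x → x ^ n - 1#)
  ^-1-monic (suc n) = horner (- 1#) (^-monic n) λ x → refl

  -- Synthetic division: the inner Horner factor `g` is divided first, and its value at `r` becomes
  -- the constant term of the new quotient.
  divide : ∀ {n f} → Monic (suc n) f → ∀ r →
    ∃[ g ] (Monic n g × (∀ x → f x ≈ (x - r) * g x + f r))
  divide {f = f} (horner {g = g} a (one g≈1) f≈) r = (λ _ → 1#) , one (λ x → refl) , λ x → begin
    f x                           ≈⟨ trans (f≈ x) (+-congʳ (*-congˡ (g≈1 x))) ⟩
    x * 1# + a                    ≈⟨ solve 3 (λ x r a → x :* con 1ℤ :+ a := (x :- r) :* con 1ℤ :+ (r :* con 1ℤ :+ a)) refl x r a ⟩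
    (x - r) * 1# + (r * 1# + a)   ≈⟨ +-congˡ (trans (f≈ r) (+-congʳ (*-congˡ (g≈1 r)))) ⟨
    (x - r) * 1# + f r            ∎
  divide {f = f} (horner {g = g} a g-monic@(horner _ _ _) f≈) r
    with h , h-monic , g≈ ← divide g-monic r =
    (λ x → x * h x + g r) , horner (g r) h-monic (λ x → refl) , λ x → begin
      f x                                         ≈⟨ trans (f≈ x) (+-congʳ (*-congˡ (g≈ x))) ⟩
      x * ((x - r) * h x + g r) + a
        ≈⟨ solve 5 (λ x r h b a → x :* ((x :- r) :* h :+ b) :+ a :=
             (x :- r) :* (x :* h :+ b) :+ (r :* b :+ a)) refl x r (h x) (g r) a ⟩
      (x - r) * (x * h x + g r) + (r * g r + a)   ≈⟨ +-congˡ (f≈ r) ⟨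
      (x - r) * (x * h x + g r) + f r             ∎

  Distinct : ∀ {n} → (Fin n → Carrier) → Set ℓ
  Distinct r = ∀ i j → r i ≈ r j → i ≡ j

  product-neg : ∀ {n} (r : Fin n → Carrier) → product (λ i → 0# - r i) ≈ (- 1#) ^ n * product r
  product-neg {zero}  r = sym (*-identityˡ _)
  product-neg {suc n} r = trans (*-congˡ (product-neg (r ∘ suc)))
    (solve 3 (λ r e p → (con 0ℤ :- r) :* (e :* p) := (:- con 1ℤ) :* e :* (r :* p)) refl
      (r zero) ((- 1#) ^ n) (product (r ∘ suc)))

  ^-double : ∀ x n → x ^ (n ℕ.* 2) ≈ x ^ n * x ^ n
  ^-double x zero    = sym (*-identityˡ _)
  ^-double x (suc n) = trans (*-congˡ (*-congˡ (^-double x n)))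
    (solve 2 (λ x y → x :* (x :* (y :* y)) := x :* y :* (x :* y)) refl x (x ^ n))

  1^n≈1 : ∀ n → 1# ^ n ≈ 1#
  1^n≈1 zero    = refl
  1^n≈1 (suc n) = trans (*-identityˡ _) (1^n≈1 n)

  -1^even : ∀ n → (- 1#) ^ (n ℕ.* 2) ≈ 1#
  -1^even zero    = refl
  -1^even (suc n) = trans (solve 1 (λ x → (:- con 1ℤ) :* ((:- con 1ℤ) :* x) := x) refl _) (-1^even n)

  module _ (integral : ∀ {x y} → x * y ≈ 0# → x ≈ 0# ⊎ y ≈ 0#) where

    factor : ∀ {n f} → Monic n f → (r : Fin n → Carrier) → Distinct r →
      (∀ i → f (r i) ≈ 0#) → ∀ x → f x ≈ product (λ i → x - r i)
    factor {zero}      (one f≈1) r distinct root x = f≈1 x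
    factor {suc n} {f} f-monic   r distinct root x
      with g , g-monic , f≈ ← divide f-monic (r zero) = begin
        f x                                   ≈⟨ f≈′ x ⟩
        (x - r zero) * g x                    ≈⟨ *-congˡ (factor g-monic (r ∘ suc)
                                                   (λ i j → Fin.suc-injective ∘ distinct (suc i) (suc j)) g-root x) ⟩
        (x - r zero) * product (λ i → x - r (suc i)) ∎
      where
      f≈′ : ∀ x → f x ≈ (x - r zero) * g x
      f≈′ x = trans (f≈ x) (trans (+-congˡ (root zero)) (+-identityʳ _))
      g-root : ∀ i → g (r (suc i)) ≈ 0#
      g-root i with integral (trans (sym (f≈′ (r (suc i)))) (root (suc i)))
      ... | inj₁ rᵢ-r₀≈0 = contradiction (distinct (suc i) zero (x-y≈0⇒x≈y _ _ rᵢ-r₀≈0)) λ ()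
      ... | inj₂ gᵢ≈0    = gᵢ≈0

    square-one : ∀ {x} → x * x ≈ 1# → x ≈ 1# ⊎ x ≈ - 1#
    square-one {x} x²≈1 = Sum.map (x-y≈0⇒x≈y x 1#)
      (λ x+1≈0 → x-y≈0⇒x≈y x (- 1#) (trans (solve 1 (λ x → x :- :- con 1ℤ := x :+ con 1ℤ) refl x) x+1≈0))
      (integral (trans (solve 1 (λ x → (x :- con 1ℤ) :* (x :+ con 1ℤ) := x :* x :- con 1ℤ) refl x)
        (x≈y⇒x-y≈0 x²≈1)))

    product≈0 : ∀ {n} (f : Fin n → Carrier) → ¬ 1# ≈ 0# → product f ≈ 0# → ∃[ i ] (f i ≈ 0#)
    product≈0 {zero}  f 1≉0 1≈0 = contradiction 1≈0 1≉0
    product≈0 {suc n} f 1≉0 f≈0 with integral f≈0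
    ... | inj₁ f₀≈0 = zero , f₀≈0
    ... | inj₂ rest with i , fᵢ≈0 ← product≈0 (f ∘ suc) 1≉0 rest = suc i , fᵢ≈0

    module _ {m} .{{_ : ℕ.NonZero m}} (r : Fin m → Carrier) (distinct : Distinct r)
      (unity : ∀ i → r i ^ m ≈ 1#) where

      unity-factor : ∀ x → x ^ m - 1# ≈ product (λ i → x - r i)
      unity-factor = factor (^-1-monic m) r distinct λ i → x≈y⇒x-y≈0 (unity i)

      -- At a root `b` the product of the `b - rᵢ` vanishes, hence one of its factors does. Applied
      -- to the `αᵢ`, this is the hard half of Euler's criterion.
      unity-complete : ¬ 1# ≈ 0# → ∀ b → b ^ m ≈ 1# → ∃[ i ] (r i ≈ b)
      unity-complete 1≉0 b bᵏ≈1
        with i , b-rᵢ≈0 ← product≈0 (λ i → b - r i) 1≉0 (trans (sym (unity-factor b)) (x≈y⇒x-y≈0 bᵏ≈1))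
        = i , sym (x-y≈0⇒x≈y _ _ b-rᵢ≈0)

    -- The factorisation of `x ^ m - 1` is evaluated at `x = 0`.
    unity-product : ∀ {m} .{{_ : ℕ.NonZero m}} → (- 1#) ^ m ≈ 1# →
      (r : Fin m → Carrier) → Distinct r → (∀ i → r i ^ m ≈ 1#) → product r ≈ - 1#
    unity-product {m@(suc k)} -1^m≈1 r distinct unity = begin
      product r                           ≈⟨ *-identityˡ _ ⟨
      1# * product r                      ≈⟨ *-congʳ -1^m≈1 ⟨
      (- 1#) ^ m * product r              ≈⟨ product-neg r ⟨
      product (λ i → 0# - r i)            ≈⟨ unity-factor r distinct unity 0# ⟨
      0# * 0# ^ k - 1#                    ≈⟨ solve 1 (λ x → con 0ℤ :* x :- con 1ℤ := :- con 1ℤ) refl _ ⟩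
      - 1#                                ∎

-- Range sums and the determinant of powers of differences

module RangeSum {c ℓ} (M : CommutativeMonoid c ℓ) where
  open CommutativeMonoid M
  open CommutativeMonoidSum M

  range : (n : ℕ) → (ℕ → Carrier) → Carrier
  range n f = sum {n} (f ∘ toℕ)

  range-cong : ∀ n {f g} → (∀ k → k ℕ.< n → f k ≈ g k) → range n f ≈ range n g
  range-cong n f≈g = sum-cong-≋ {n} λ i → f≈g (toℕ i) (Fin.toℕ<n i)

  range-+ : ∀ m n f → range (m ℕ.+ n) f ≈ range m f ∙ range n (f ∘ (m ℕ.+_))
  range-+ zero    n f = sym (identityˡ _)
  range-+ (suc m) n f = trans (∙-congˡ (range-+ m n (f ∘ suc))) (sym (assoc _ _ _))

  range-suc : ∀ n f → range (suc n) f ≈ range n f ∙ f n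
  range-suc zero    f = trans (identityʳ _) (sym (identityˡ _))
  range-suc (suc n) f = trans (∙-congˡ (range-suc n (f ∘ suc))) (sym (assoc _ _ _))

  range-ε : ∀ n {f} → (∀ k → k ℕ.< n → f k ≈ ε) → range n f ≈ ε
  range-ε n f≈ε = trans (range-cong n f≈ε) (sum-replicate-zero n)

  range-reverse : ∀ n f → range (suc n) (λ k → f (n ℕ.∸ k)) ≈ range (suc n) f
  range-reverse zero    f = refl
  range-reverse (suc n) f = begin
    f (suc n) ∙ range (suc n) (λ k → f (n ℕ.∸ k))   ≈⟨ ∙-congˡ (range-reverse n f) ⟩
    f (suc n) ∙ range (suc n) f                     ≈⟨ comm _ _ ⟩
    range (suc n) f ∙ f (suc n)                     ≈⟨ range-suc (suc n) f ⟨
    range (suc (suc n)) f                           ∎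
    where open SetoidReasoning setoid

  range-∙ : ∀ n f g → range n (λ k → f k ∙ g k) ≈ range n f ∙ range n g
  range-∙ n f g = ∑-distrib-+ {n} (f ∘ toℕ) (g ∘ toℕ)

module DifferencePowers {c ℓ} (R : CommutativeRing c ℓ) where
  open CommutativeRing R hiding (zero)
  open AbelianGroupProperties +-abelianGroup
    using () renaming (x∙y⁻¹≈ε⇒x≈y to x-y≈0⇒x≈y; x≈y⇒x∙y⁻¹≈ε to x≈y⇒x-y≈0)
  open CommutativeSemiringExp commutativeSemiring
  open CommutativeMonoidSum *-commutativeMonoid
    using () renaming (sum to product; sum-cong-≋ to product-cong)
  open SemiringSum semiring using (sum; sum-cong-≋; sum-replicate; *-distribˡ-sum; *-distribʳ-sum)
  open SemiringMult semiring
    using (×-assoc-*; ×-congʳ; ×-homo-+) renaming (_×_ to _·_)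
  open RangeSum +-commutativeMonoid
  open IntegerCoefficients R using (solve; _:=_; _:+_; _:*_; _:-_; :-_; con)
  open Determinant R
  open RootsOfUnity R using (-1^even; Distinct; ^-double)
  open SetoidReasoning setoid

  det-scale-columns : ∀ {n} (A : Matrix n n) (d : Fin n → Carrier) →
    det (λ i k → A i k * d k) ≈ det A * product d
  det-scale-columns {n} A d = begin
    det (λ i k → A i k * d k)   ≈⟨ det-cong {n} (λ i k → δ-expansion (λ j → A i j * d j) k) ⟩
    det (λ i k → sum λ j → A i j * d j * δ j k)
      ≈⟨ det-cong {n} (λ i k → sum-cong-≋ {n} λ j → *-assoc (A i j) (d j) (δ j k)) ⟩
    det (A ⊡ D)                 ≈⟨ det-* A D ⟩
    det A * det D               ≈⟨ *-congˡ det-D ⟩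
    det A * product d           ∎
    where
    D : Matrix n n
    D j k = d j * δ j k
    det-D : det D ≈ product d
    det-D = trans
      (det-lower {n} λ {i} i<k → trans (*-congˡ (reflexive (δ-off-diagonal (Fin.<⇒≢ i<k)))) (zeroʳ (d i)))
      (product-cong {n} λ i → trans (*-congˡ (reflexive (δ-diagonal i))) (*-identityʳ (d i)))

  product-const : ∀ n x → product {n} (λ _ → x) ≈ x ^ n
  product-const zero    x = refl
  product-const (suc n) x = *-congˡ (product-const n x)

  product-^ : ∀ {n} (f : Fin n → Carrier) e → product (λ i → f i ^ e) ≈ product f ^ e
  product-^ {zero}  f zero    = refl
  product-^ {zero}  f (suc e) = trans (product-^ f e) (sym (*-identityˡ _))
  product-^ {suc n} f e = trans (*-congˡ (product-^ (f ∘ suc) e)) (sym (^-distrib-* (f zero) (product (f ∘ suc)) e))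

  -- The exponent is `n ∸ k` and not `n ∸ 1 ∸ k`, whence the extra factor `y`. In this form the sum
  -- is an entry of `V ⊡ U`.
  geometric : ∀ n x y → (x - y) * range n (λ k → x ^ k * y ^ (n ℕ.∸ k)) ≈ y * (x ^ n - y ^ n)
  geometric zero    x y = solve 2 (λ x y → (x :- y) :* con 0ℤ := y :* (con 1ℤ :- con 1ℤ)) refl x y
  geometric (suc n) x y = begin
    (x - y) * (1# * y ^ suc n + range n (λ k → x * x ^ k * y ^ (n ℕ.∸ k)))
      ≈⟨ *-congˡ (+-congˡ (begin
           range n (λ k → x * x ^ k * y ^ (n ℕ.∸ k))
             ≈⟨ range-cong n (λ k _ → *-assoc x (x ^ k) (y ^ (n ℕ.∸ k))) ⟩
           range n (λ k → x * (x ^ k * y ^ (n ℕ.∸ k)))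
             ≈⟨ *-distribˡ-sum {n} x _ ⟨
           x * G ∎)) ⟩
    (x - y) * (1# * y ^ suc n + x * G)
      ≈⟨ solve 4 (λ x y g z → (x :- y) :* (con 1ℤ :* z :+ x :* g) :=
           (x :- y) :* z :+ x :* ((x :- y) :* g)) refl x y G (y ^ suc n) ⟩
    (x - y) * y ^ suc n + x * ((x - y) * G)
      ≈⟨ +-congˡ (*-congˡ (geometric n x y)) ⟩
    (x - y) * (y * y ^ n) + x * (y * (x ^ n - y ^ n))
      ≈⟨ solve 4 (λ x y a b → (x :- y) :* (y :* b) :+ x :* (y :* (a :- b)) :=
           y :* (x :* a :- y :* b)) refl x y (x ^ n) (y ^ n) ⟩
    y * (x ^ suc n - y ^ suc n) ∎
    where G = range n (λ k → x ^ k * y ^ (n ℕ.∸ k))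

  module Folding (integral : ∀ {x y} → x * y ≈ 0# → x ≈ 0# ⊎ y ≈ 0#) 
    (m r : ℕ) (m≡4+r : m ≡ 4 ℕ.+ r) (-1^m≈1 : (- 1#) ^ m ≈ 1#) where

    n : ℕ
    n = m ℕ.+ 3

    -- The sign `(-1) ^ (n ∸ k)` of the binomial expansion, simplified by `(-1) ^ m = 1`.
    ε : ℕ → Carrier
    ε k = - ((- 1#) ^ k)

    -- Collects the two exponents `k` and `m + k` that agree modulo `m`; the second coefficient is
    -- zero once `k > 3`.
    d : ℕ → ℕ
    d k = n C k ℕ.+ n C (m ℕ.+ k)

    coefficient : Fin m → Carrier
    coefficient k = ε (toℕ k) * d (toℕ k) · 1#

    ε-complement : ∀ {k} → k ℕ.≤ n → (- 1#) ^ (n ℕ.∸ k) ≈ ε k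
    ε-complement {k} k≤n = begin
      s ^ (n ℕ.∸ k)                        ≈⟨ *-identityʳ _ ⟨
      s ^ (n ℕ.∸ k) * 1#                   ≈⟨ *-congˡ (trans (sym (^-double s k)) (-1^even k)) ⟨
      s ^ (n ℕ.∸ k) * (s ^ k * s ^ k)      ≈⟨ *-assoc _ _ _ ⟨
      s ^ (n ℕ.∸ k) * s ^ k * s ^ k        ≈⟨ *-congʳ (^-homo-* s (n ℕ.∸ k) k) ⟨
      s ^ (n ℕ.∸ k ℕ.+ k) * s ^ k          ≡⟨ ≡.cong (λ e → s ^ e * s ^ k) (ℕ.m∸n+n≡m k≤n) ⟩
      s ^ (m ℕ.+ 3) * s ^ k                ≈⟨ *-congʳ (trans (^-homo-* s m 3) (*-congʳ -1^m≈1)) ⟩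
      1# * s ^ 3 * s ^ k
        ≈⟨ solve 1 (λ x → con 1ℤ :* (:- con 1ℤ :* (:- con 1ℤ :* (:- con 1ℤ :* con 1ℤ))) :* x := :- x) refl _ ⟩
      - (s ^ k)                            ∎
      where s = - 1#

    ε-periodic : ∀ k → ε (m ℕ.+ k) ≈ ε k
    ε-periodic k = -‿cong (trans (^-homo-* (- 1#) m k) (trans (*-congʳ -1^m≈1) (*-identityˡ _)))

    module _ {x y : Carrier} (xᵐ≈1 : x ^ m ≈ 1#) (yᵐ≈1 : y ^ m ≈ 1#) where

      term : ℕ → Carrier
      term k = (n C k) · (x ^ k * (- y) ^ (n ℕ.∸ k))

      reduced : ℕ → Carrier
      reduced k = x ^ k * (y ^ (m ℕ.∸ k) * y ^ 3)

      neg-^ : ∀ e → (- y) ^ e ≈ (- 1#) ^ e * y ^ e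
      neg-^ e = trans (^-congˡ e (solve 1 (λ y → :- y := :- con 1ℤ :* y) refl y)) (^-distrib-* (- 1#) y e)

      term-neg : ∀ {k} → k ℕ.≤ n → term k ≈ (n C k) · (ε k * (x ^ k * y ^ (n ℕ.∸ k)))
      term-neg {k} k≤n = ×-congʳ (n C k) (begin
        x ^ k * (- y) ^ (n ℕ.∸ k)                       ≈⟨ *-congˡ (neg-^ (n ℕ.∸ k)) ⟩
        x ^ k * ((- 1#) ^ (n ℕ.∸ k) * y ^ (n ℕ.∸ k))    ≈⟨ *-congˡ (*-congʳ (ε-complement k≤n)) ⟩
        x ^ k * (ε k * y ^ (n ℕ.∸ k))
          ≈⟨ solve 3 (λ x e y → x :* (e :* y) := e :* (x :* y)) refl _ _ _ ⟩
        ε k * (x ^ k * y ^ (n ℕ.∸ k))                   ∎)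

      term-low : ∀ {k} → k ℕ.< m → term k ≈ (n C k) · (ε k * reduced k)
      term-low {k} k<m = trans (term-neg k≤n) (×-congʳ (n C k) (*-congˡ (*-congˡ (begin
        y ^ (n ℕ.∸ k)              ≡⟨ ≡.cong (y ^_) n∸k ⟩
        y ^ (m ℕ.∸ k ℕ.+ 3)        ≈⟨ ^-homo-* y (m ℕ.∸ k) 3 ⟩
        y ^ (m ℕ.∸ k) * y ^ 3      ∎))))
        where
        k≤n : k ℕ.≤ n
        k≤n = ℕ.≤-trans (ℕ.<⇒≤ k<m) (ℕ.m≤m+n m 3)
        n∸k : n ℕ.∸ k ≡ m ℕ.∸ k ℕ.+ 3
        n∸k = ≡.trans (≡.cong (ℕ._∸ k) (ℕ.+-comm m 3))
          (≡.trans (ℕ.+-∸-assoc 3 (ℕ.<⇒≤ k<m)) (ℕ.+-comm 3 (m ℕ.∸ k)))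

      term-high : ∀ {k} → k ℕ.< m → term (m ℕ.+ k) ≈ (n C (m ℕ.+ k)) · (ε k * reduced k)
      term-high {k} k<m with k ℕ.≤? 3
      ... | no  k≰3 rewrite k>n⇒nCk≡0 (ℕ.+-monoʳ-< m (ℕ.≰⇒> k≰3)) = refl
      ... | yes k≤3 = trans (term-neg (ℕ.+-monoʳ-≤ m k≤3)) (×-congʳ (n C (m ℕ.+ k))
        (*-cong (ε-periodic k) (*-cong
          (trans (^-homo-* x m k) (trans (*-congʳ xᵐ≈1) (*-identityˡ _)))
          (begin
            y ^ (n ℕ.∸ (m ℕ.+ k))       ≡⟨ ≡.cong (y ^_) (ℕ.[m+n]∸[m+o]≡n∸o m 3 k) ⟩
            y ^ (3 ℕ.∸ k)               ≈⟨ trans (*-congʳ yᵐ≈1) (*-identityˡ _) ⟨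
            y ^ m * y ^ (3 ℕ.∸ k)       ≈⟨ ^-homo-* y m (3 ℕ.∸ k) ⟨
            y ^ (m ℕ.+ (3 ℕ.∸ k))       ≡⟨ ≡.cong (y ^_) exponents ⟩
            y ^ (m ℕ.∸ k ℕ.+ 3)         ≈⟨ ^-homo-* y (m ℕ.∸ k) 3 ⟩
            y ^ (m ℕ.∸ k) * y ^ 3       ∎))))
        where
        exponents : m ℕ.+ (3 ℕ.∸ k) ≡ m ℕ.∸ k ℕ.+ 3
        exponents = ≡.trans (≡.sym (ℕ.+-∸-assoc m k≤3))
          (≡.trans (≡.cong (ℕ._∸ k) (ℕ.+-comm m 3))
          (≡.trans (ℕ.+-∸-assoc 3 (ℕ.<⇒≤ k<m)) (ℕ.+-comm 3 (m ℕ.∸ k))))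

      -- Exponents k and k + m agree on m-th roots of unity, so the m + 4 binomial terms,
      -- padded to 2m terms by zeros, fold to m terms.
      difference-^ : (x - y) ^ n ≈ range m (λ k → x ^ k * (ε k * d k · 1#) * y ^ (m ℕ.∸ k) * y ^ 3)
      difference-^ = begin
        (x - y) ^ n
          ≈⟨ Binomial.theorem commutativeSemiring n x (- y) ⟩
        range (suc n) term
          ≈⟨ +-identityʳ _ ⟨
        range (suc n) term + 0#
          ≈⟨ +-congˡ (range-ε r {term ∘ (suc n ℕ.+_)} λ k _ → padding k) ⟨
        range (suc n) term + range r (term ∘ (suc n ℕ.+_))
          ≈⟨ range-+ (suc n) r term ⟨
        range (suc n ℕ.+ r) term
          ≡⟨ ≡.cong (λ l → range l term) padded-length ⟩
        range (m ℕ.+ m) term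
          ≈⟨ range-+ m m term ⟩
        range m term + range m (term ∘ (m ℕ.+_))
          ≈⟨ +-cong (range-cong m λ k → term-low) (range-cong m λ k → term-high) ⟩
        range m (λ k → (n C k) · (ε k * reduced k)) + range m (λ k → (n C (m ℕ.+ k)) · (ε k * reduced k))
          ≈⟨ range-∙ m (λ k → (n C k) · (ε k * reduced k)) (λ k → (n C (m ℕ.+ k)) · (ε k * reduced k)) ⟨
        range m (λ k → (n C k) · (ε k * reduced k) + (n C (m ℕ.+ k)) · (ε k * reduced k))
          ≈⟨ range-cong m (λ k _ → collect k) ⟩
        range m (λ k → x ^ k * (ε k * d k · 1#) * y ^ (m ℕ.∸ k) * y ^ 3) ∎
        where
        padded-length : suc n ℕ.+ r ≡ m ℕ.+ m
        padded-length = ≡.trans (≡.cong (ℕ._+ r) (≡.sym (ℕ.+-suc m 3)))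
          (≡.trans (ℕ.+-assoc m 4 r) (≡.cong (m ℕ.+_) (≡.sym m≡4+r)))

        padding : ∀ k → term (suc n ℕ.+ k) ≈ 0#
        padding k rewrite k>n⇒nCk≡0 {n} {suc n ℕ.+ k} (ℕ.m≤m+n (suc n) k) = refl

        collect : ∀ k → (n C k) · (ε k * reduced k) + (n C (m ℕ.+ k)) · (ε k * reduced k) ≈
                        x ^ k * (ε k * d k · 1#) * y ^ (m ℕ.∸ k) * y ^ 3
        collect k = begin
          (n C k) · (ε k * reduced k) + (n C (m ℕ.+ k)) · (ε k * reduced k)
            ≈⟨ ×-homo-+ (ε k * reduced k) (n C k) (n C (m ℕ.+ k)) ⟨
          d k · (ε k * reduced k)
            ≈⟨ ×-congʳ (d k) (*-identityˡ _) ⟨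
          d k · (1# * (ε k * reduced k))
            ≈⟨ ×-assoc-* (d k) 1# _ ⟨
          d k · 1# * (ε k * (x ^ k * (y ^ (m ℕ.∸ k) * y ^ 3)))
            ≈⟨ solve 5 (λ d e x a b → d :* (e :* (x :* (a :* b))) := x :* (e :* d) :* a :* b) refl
                 (d k · 1#) (ε k) (x ^ k) (y ^ (m ℕ.∸ k)) (y ^ 3) ⟩
          x ^ k * (ε k * d k · 1#) * y ^ (m ℕ.∸ k) * y ^ 3 ∎

    module _ (α : Fin m → Carrier) (distinct : Distinct α) (unity : ∀ i → α i ^ m ≈ 1#) where

      V U : Matrix m m
      V i k = α i ^ toℕ k
      U k j = α j ^ (m ℕ.∸ toℕ k)

      -- On the diagonal of `V ⊡ U` each of the `m` terms is `αᵢ ^ m = 1`. Off it, `αᵢ - αⱼ` times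
      -- the entry is `αⱼ (αᵢ ^ m - αⱼ ^ m) = 0`, and the first factor is not zero.
      det-V*det-U : det V * det U ≈ (m · 1#) ^ m
      det-V*det-U = begin
        det V * det U                       ≈⟨ det-* V U ⟨
        det (V ⊡ U)                         ≈⟨ det-lower (λ i<k → off-diagonal (Fin.<⇒≢ i<k)) ⟩
        product (λ i → (V ⊡ U) i i)         ≈⟨ product-cong {m} diagonal ⟩
        product {m} (λ i → m · 1#)          ≈⟨ product-const m (m · 1#) ⟩
        (m · 1#) ^ m                        ∎
        where
        diagonal : ∀ i → (V ⊡ U) i i ≈ m · 1#
        diagonal i = trans (range-cong m λ k k<m → trans (sym (^-homo-* (α i) k (m ℕ.∸ k)))
            (trans (^-congʳ (α i) (ℕ.m+[n∸m]≡n (ℕ.<⇒≤ k<m))) (unity i)))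
          (sum-replicate m)
        off-diagonal : ∀ {i j} → i ≢ j → (V ⊡ U) i j ≈ 0#
        off-diagonal {i} {j} i≢j with integral (begin
            (α i - α j) * (V ⊡ U) i j       ≈⟨ geometric m (α i) (α j) ⟩
            α j * (α i ^ m - α j ^ m)       ≈⟨ *-congˡ (x≈y⇒x-y≈0 (trans (unity i) (sym (unity j)))) ⟩
            α j * 0#                        ≈⟨ zeroʳ _ ⟩
            0#                              ∎)
        ... | inj₁ αᵢ-αⱼ≈0 = contradiction (distinct i j (x-y≈0⇒x≈y _ _ αᵢ-αⱼ≈0)) i≢j
        ... | inj₂ VUᵢⱼ≈0  = VUᵢⱼ≈0

      -- `det V` and `det U` are never evaluated singly: only their product enters. The columns'
      -- factors `αⱼ ^ 3` come out as `product α ^ 3`.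
      det-difference-^ : det (λ i j → (α i - α j) ^ n) ≈
        (m · 1#) ^ m * product coefficient * product α ^ 3
      det-difference-^ = begin
        det (λ i j → (α i - α j) ^ n)
          ≈⟨ det-cong {m} (λ i j → trans (difference-^ (unity i) (unity j)) (sym (*-distribʳ-range i j))) ⟩
        det (λ i j → ((λ i k → V i k * coefficient k) ⊡ U) i j * α j ^ 3)
          ≈⟨ det-scale-columns ((λ i k → V i k * coefficient k) ⊡ U) (λ j → α j ^ 3) ⟩
        det ((λ i k → V i k * coefficient k) ⊡ U) * product (λ j → α j ^ 3)
          ≈⟨ *-cong (trans (det-* (λ i k → V i k * coefficient k) U) (*-congʳ (det-scale-columns V coefficient))) (product-^ α 3) ⟩
        det V * product coefficient * det U * product α ^ 3
          ≈⟨ solve 4 (λ v c u a → v :* c :* u :* a := v :* u :* c :* a) refl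
               (det V) (product coefficient) (det U) (product α ^ 3) ⟩
        det V * det U * product coefficient * product α ^ 3
          ≈⟨ *-congʳ (*-congʳ det-V*det-U) ⟩
        (m · 1#) ^ m * product coefficient * product α ^ 3 ∎
        where
        *-distribʳ-range : ∀ i j → ((λ i k → V i k * coefficient k) ⊡ U) i j * α j ^ 3 ≈
          range m (λ k → α i ^ k * (ε k * d k · 1#) * α j ^ (m ℕ.∸ k) * α j ^ 3)
        *-distribʳ-range i j = *-distribʳ-sum {m} (α j ^ 3) λ k → V i k * coefficient k * U k j

-- Products of factorials and of binomial coefficients

module ℕProduct where
  open RangeSum ℕ.*-1-commutativeMonoid public
    renaming (range to ∏; range-cong to ∏-cong; range-+ to ∏-+; range-suc to ∏-suc;
              range-reverse to ∏-reverse; range-∙ to ∏-*)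
  open ≡.≡-Reasoning

  superfactorial : ℕ → ℕ
  superfactorial n = ∏ n _!

  -- Multiply `(2j-1)! (2j)! = 2j ((2j-1)!)²` over `1 ≤ j ≤ h`, so that `Q` is the product of the
  -- `(2j-1)!`. The superfactorial stops before `(2h)!`, which is therefore supplied as a factor.
  -- This is the source of `h !` in the result.
  superfactorial-even : ∀ h → ∃[ Q ]
    (superfactorial (h ℕ.* 2) ℕ.* (h ℕ.* 2) ! ≡ 2 ℕ.^ h ℕ.* h ! ℕ.* (Q ℕ.* Q))
  superfactorial-even zero    = 1 , ≡.refl
  superfactorial-even (suc h) with Q , eq ← superfactorial-even h = Q ℕ.* ((1 ℕ.+ h ℕ.* 2) ℕ.* F) , (begin
    superfactorial (2 ℕ.+ h ℕ.* 2) ℕ.* (2 ℕ.+ h ℕ.* 2) !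
      ≡⟨ ≡.cong (ℕ._* (2 ℕ.+ h ℕ.* 2) !) (≡.trans (∏-suc (1 ℕ.+ h ℕ.* 2) _!)
           (≡.cong (ℕ._* (1 ℕ.+ h ℕ.* 2) !) (∏-suc (h ℕ.* 2) _!))) ⟩
    sf ℕ.* F ℕ.* ((1 ℕ.+ h ℕ.* 2) ℕ.* F) ℕ.* ((2 ℕ.+ h ℕ.* 2) ℕ.* ((1 ℕ.+ h ℕ.* 2) ℕ.* F))
      ≡⟨ ≡.cong (λ x → x ℕ.* ((1 ℕ.+ h ℕ.* 2) ℕ.* F) ℕ.* ((2 ℕ.+ h ℕ.* 2) ℕ.* ((1 ℕ.+ h ℕ.* 2) ℕ.* F))) eq ⟩
    2 ℕ.^ h ℕ.* h ! ℕ.* (Q ℕ.* Q) ℕ.* ((1 ℕ.+ h ℕ.* 2) ℕ.* F) ℕ.* ((2 ℕ.+ h ℕ.* 2) ℕ.* ((1 ℕ.+ h ℕ.* 2) ℕ.* F))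
      ≡⟨ regroup (2 ℕ.^ h) (h !) Q F h ⟩
    2 ℕ.* 2 ℕ.^ h ℕ.* (suc h ℕ.* h !) ℕ.* (Q ℕ.* ((1 ℕ.+ h ℕ.* 2) ℕ.* F) ℕ.* (Q ℕ.* ((1 ℕ.+ h ℕ.* 2) ℕ.* F))) ∎)
    where
    F = (h ℕ.* 2) !
    sf = superfactorial (h ℕ.* 2)
    regroup : ∀ t f Q F h →
      t ℕ.* f ℕ.* (Q ℕ.* Q) ℕ.* ((1 ℕ.+ h ℕ.* 2) ℕ.* F) ℕ.* ((2 ℕ.+ h ℕ.* 2) ℕ.* ((1 ℕ.+ h ℕ.* 2) ℕ.* F)) ≡
      2 ℕ.* t ℕ.* ((1 ℕ.+ h) ℕ.* f) ℕ.* (Q ℕ.* ((1 ℕ.+ h ℕ.* 2) ℕ.* F) ℕ.* (Q ℕ.* ((1 ℕ.+ h ℕ.* 2) ℕ.* F)))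
    regroup = ℕ.solve-∀

  ∏-const : ∀ n x → ∏ n (λ _ → x) ≡ x ℕ.^ n
  ∏-const zero    x = ≡.refl
  ∏-const (suc n) x = ≡.cong (x ℕ.*_) (∏-const n x)

  ∏-suc-! : ∀ n → ∏ n suc ≡ n !
  ∏-suc-! zero    = ≡.refl
  ∏-suc-! (suc n) = ≡.trans (∏-suc n suc) (≡.trans (≡.cong (ℕ._* suc n) (∏-suc-! n)) (ℕ.*-comm (n !) (suc n)))

  -- Each coefficient is `n!` over two factorials, and the reversal `j ↦ r - 1 - j` carries the
  -- second family of factorials to the first; hence the square.
  ∏-binomials : ∀ r → ∏ r (λ j → (4 ℕ.+ (r ℕ.+ 3)) C (4 ℕ.+ j)) ℕ.*
    (∏ r (λ j → (4 ℕ.+ j) !) ℕ.* ∏ r (λ j → (4 ℕ.+ j) !)) ≡ ((4 ℕ.+ (r ℕ.+ 3)) !) ℕ.^ r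
  ∏-binomials zero       = ≡.refl
  ∏-binomials r@(suc r′) = begin
    ∏ r c ℕ.* (∏ r f ℕ.* ∏ r f)
      ≡⟨ ≡.cong (λ x → ∏ r c ℕ.* (∏ r f ℕ.* x)) (∏-reverse r′ f) ⟨
    ∏ r c ℕ.* (∏ r f ℕ.* ∏ r (λ j → f (r′ ℕ.∸ j)))
      ≡⟨ ≡.cong (∏ r c ℕ.*_) (∏-* r f (λ j → f (r′ ℕ.∸ j))) ⟨
    ∏ r c ℕ.* ∏ r (λ j → f j ℕ.* f (r′ ℕ.∸ j))
      ≡⟨ ∏-* r c (λ j → f j ℕ.* f (r′ ℕ.∸ j)) ⟨
    ∏ r (λ j → c j ℕ.* (f j ℕ.* f (r′ ℕ.∸ j)))
      ≡⟨ ∏-cong r (λ j j<r → factorials j (ℕ.s≤s⁻¹ j<r)) ⟩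
    ∏ r (λ _ → n !)
      ≡⟨ ∏-const r (n !) ⟩
    (n !) ℕ.^ r ∎
    where
    n = 4 ℕ.+ (r ℕ.+ 3)
    c f : ℕ → ℕ
    c j = n C (4 ℕ.+ j)
    f j = (4 ℕ.+ j) !
    factorials : ∀ j → j ℕ.≤ r′ → c j ℕ.* (f j ℕ.* f (r′ ℕ.∸ j)) ≡ n !
    factorials j j≤r′ = ≡.trans (≡.cong (λ x → c j ℕ.* (f j ℕ.* x !)) complement)
      (nCk*k!*[n∸k]! {n} {4 ℕ.+ j} (ℕ.+-monoʳ-≤ 4 (ℕ.≤-trans j≤r′ (ℕ.≤-trans (ℕ.n≤1+n r′) (ℕ.m≤m+n r 3)))))
      where
      complement : 4 ℕ.+ (r′ ℕ.∸ j) ≡ n ℕ.∸ (4 ℕ.+ j)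
      complement = ≡.trans (≡.sym (ℕ.+-∸-assoc 4 j≤r′)) (≡.cong (ℕ._∸ j)
        (≡.trans (ℕ.+-comm 4 r′) (ℕ.+-suc r′ 3)))

  binomial₂ : ∀ m → ((m ℕ.+ 3) C 2) ℕ.* 2 ≡ (m ℕ.+ 3) ℕ.* (m ℕ.+ 2)
  binomial₂ m rewrite ℕ.+-comm m 3 | ℕ.+-comm m 2 = ℕ.*-cancelʳ-≡ _ _ ((suc m) !) (begin
    ((3 ℕ.+ m) C 2) ℕ.* 2 ℕ.* (suc m) !                 ≡⟨ ℕ.*-assoc ((3 ℕ.+ m) C 2) 2 ((suc m) !) ⟩
    ((3 ℕ.+ m) C 2) ℕ.* (2 ℕ.* (suc m) !)               ≡⟨ nCk*k!*[n∸k]! {3 ℕ.+ m} {2} (ℕ.s≤s (ℕ.s≤s ℕ.z≤n)) ⟩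
    (3 ℕ.+ m) ℕ.* ((2 ℕ.+ m) ℕ.* (suc m) !)             ≡⟨ ℕ.*-assoc (3 ℕ.+ m) (2 ℕ.+ m) ((suc m) !) ⟨
    (3 ℕ.+ m) ℕ.* (2 ℕ.+ m) ℕ.* (suc m) !               ∎)
    where instance _ = suc m ℕ.!≢0

  binomial₃ : ∀ m → ((m ℕ.+ 3) C 3) ℕ.* 6 ≡ (m ℕ.+ 3) ℕ.* ((m ℕ.+ 2) ℕ.* (m ℕ.+ 1))
  binomial₃ m rewrite ℕ.+-comm m 3 | ℕ.+-comm m 2 | ℕ.+-comm m 1 = ℕ.*-cancelʳ-≡ _ _ (m !) (begin
    ((3 ℕ.+ m) C 3) ℕ.* 6 ℕ.* m !                       ≡⟨ ℕ.*-assoc ((3 ℕ.+ m) C 3) 6 (m !) ⟩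
    ((3 ℕ.+ m) C 3) ℕ.* (6 ℕ.* m !)                     ≡⟨ nCk*k!*[n∸k]! {3 ℕ.+ m} {3} (ℕ.s≤s (ℕ.s≤s (ℕ.s≤s ℕ.z≤n))) ⟩
    (3 ℕ.+ m) ℕ.* ((2 ℕ.+ m) ℕ.* ((1 ℕ.+ m) ℕ.* m !))   ≡⟨ regroup (3 ℕ.+ m) (2 ℕ.+ m) (1 ℕ.+ m) (m !) ⟩
    (3 ℕ.+ m) ℕ.* ((2 ℕ.+ m) ℕ.* (1 ℕ.+ m)) ℕ.* m !     ∎)
    where
    instance _ = m ℕ.!≢0
    regroup : ∀ a b c d → a ℕ.* (b ℕ.* (c ℕ.* d)) ≡ a ℕ.* (b ℕ.* c) ℕ.* d
    regroup = ℕ.solve-∀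

  nC[m+k] : ∀ m {k} → k ℕ.≤ 3 → (m ℕ.+ 3) C (m ℕ.+ k) ≡ (m ℕ.+ 3) C (3 ℕ.∸ k)
  nC[m+k] m {k} k≤3 = ≡.trans (nCk≡nC[n∸k] (ℕ.+-monoʳ-≤ m k≤3))
    (≡.cong ((m ℕ.+ 3) C_) (ℕ.[m+n]∸[m+o]≡n∸o m 3 k))

prime∤∏ : ∀ {p} → Prime p → ∀ n {f} → (∀ k → k ℕ.< n → ¬ p ℕ.∣ f k) → ¬ p ℕ.∣ ℕProduct.∏ n f
prime∤∏ pr zero    p∤f p∣1 = ℕ.nonTrivial⇒≢1 {{prime⇒nonTrivial pr}} (ℕ.∣1⇒≡1 p∣1)
prime∤∏ pr (suc n) {f} p∤f p∣∏ with euclidsLemma (f 0) (ℕProduct.∏ n (f ∘ suc)) pr p∣∏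
... | inj₁ p∣f₀ = p∤f 0 (ℕ.s≤s ℕ.z≤n) p∣f₀
... | inj₂ p∣∏′ = prime∤∏ pr n (λ k k<n → p∤f (suc k) (ℕ.s≤s k<n)) p∣∏′

-- The quadratic character as an m-th power

module QuadraticCharacter {c ℓ} (R : CommutativeRing c ℓ) where
  open CommutativeRing R hiding (zero)
  open AbelianGroupProperties +-abelianGroup
    using () renaming (x∙y⁻¹≈ε⇒x≈y to x-y≈0⇒x≈y; x≈y⇒x∙y⁻¹≈ε to x≈y⇒x-y≈0)
  open CommutativeSemiringExp commutativeSemiring
  open CommutativeMonoidSum *-commutativeMonoid
    using () renaming (sum to product)
  open SemiringMult semiring using (×-homo-+; ×1-homo-*) renaming (_×_ to _·_)
  open RangeSum *-commutativeMonoid using (range; range-∙)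
  open ℕProduct using (∏)
  open IntegerCoefficients R using (solve; _:=_; _:+_; _:*_; _:-_; :-_; con)
  open RootsOfUnity R
  open SetoidReasoning setoid

  ⟦_⟧ : ℕ → Carrier
  ⟦ k ⟧ = k · 1#

  ⟦⟧-* : ∀ a b → ⟦ a ℕ.* b ⟧ ≈ ⟦ a ⟧ * ⟦ b ⟧
  ⟦⟧-* = ×1-homo-*

  ⟦⟧-+ : ∀ a b → ⟦ a ℕ.+ b ⟧ ≈ ⟦ a ⟧ + ⟦ b ⟧
  ⟦⟧-+ = ×-homo-+ 1#

  ⟦⟧-^ : ∀ a n → ⟦ a ℕ.^ n ⟧ ≈ ⟦ a ⟧ ^ n
  ⟦⟧-^ a zero    = +-identityʳ 1#
  ⟦⟧-^ a (suc n) = trans (⟦⟧-* a (a ℕ.^ n)) (*-congˡ (⟦⟧-^ a n))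

  ⟦⟧-∏ : ∀ n f → range n (λ k → ⟦ f k ⟧) ≈ ⟦ ∏ n f ⟧
  ⟦⟧-∏ zero    f = sym (+-identityʳ 1#)
  ⟦⟧-∏ (suc n) f = trans (*-congˡ (⟦⟧-∏ n (f ∘ suc))) (sym (⟦⟧-* (f 0) _))

  -- Character values are their own inverses, so this takes the place of division.
  involution-cancel : ∀ {x y z} → x * x ≈ 1# → x * y ≈ z → y ≈ x * z
  involution-cancel {x} {y} {z} x²≈1 xy≈z = begin
    y             ≈⟨ *-identityˡ y ⟨
    1# * y        ≈⟨ *-congʳ x²≈1 ⟨
    x * x * y     ≈⟨ *-assoc x x y ⟩
    x * (x * y)   ≈⟨ *-congˡ xy≈z ⟩
    x * z         ∎

  involution-even : ∀ {x} t → x * x ≈ 1# → x ^ (t ℕ.* 2) ≈ 1#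
  involution-even zero    x²≈1 = refl
  involution-even (suc t) x²≈1 = trans (sym (*-assoc _ _ _)) (trans (*-cong x²≈1 (involution-even t x²≈1)) (*-identityˡ 1#))

  involution-odd : ∀ {x} t → x * x ≈ 1# → x ^ suc (t ℕ.* 2) ≈ x
  involution-odd t x²≈1 = trans (*-congˡ (involution-even t x²≈1)) (*-identityʳ _)

  -1*-1≈1 : - 1# * - 1# ≈ 1#
  -1*-1≈1 = solve 0 (:- con 1ℤ :* :- con 1ℤ := con 1ℤ) refl

  module Character (integral : ∀ {x y} → x * y ≈ 0# → x ≈ 0# ⊎ y ≈ 0#) (m : ℕ)
    (prime : Prime (suc (m ℕ.* 2))) (p·1≈0 : ⟦ suc (m ℕ.* 2) ⟧ ≈ 0#)
    (char : ∀ k → ⟦ k ⟧ ≈ 0# → suc (m ℕ.* 2) ℕ.∣ k)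
    (fermat : ∀ {x} → ¬ x ≈ 0# → x ^ (m ℕ.* 2) ≈ 1#) where

    p : ℕ
    p = suc (m ℕ.* 2)

    -- The Legendre symbol of `k` by Euler's criterion, treated here as a multiplicative function
    -- whose values square to one off the multiples of `p`.
    X : ℕ → Carrier
    X k = ⟦ k ⟧ ^ m

    X-cong : ∀ a b → ⟦ a ⟧ ≈ ⟦ b ⟧ → X a ≈ X b
    X-cong a b = ^-congˡ m

    X-* : ∀ a b → X (a ℕ.* b) ≈ X a * X b
    X-* a b = trans (^-congˡ m (⟦⟧-* a b)) (^-distrib-* ⟦ a ⟧ ⟦ b ⟧ m)

    X-^ : ∀ a n → X (a ℕ.^ n) ≈ X a ^ n
    X-^ a zero    = trans (^-congˡ m (+-identityʳ 1#)) (1^n≈1 m)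
    X-^ a (suc n) = trans (X-* a (a ℕ.^ n)) (*-congˡ (X-^ a n))

    χ-involution : ∀ {x} → ¬ x ≈ 0# → x ^ m * x ^ m ≈ 1#
    χ-involution {x} x≉0 = trans (sym (^-double x m)) (fermat x≉0)

    X-involution : ∀ {a} → ¬ p ℕ.∣ a → X a * X a ≈ 1#
    X-involution {a} p∤a = χ-involution (p∤a ∘ char a)

    X-square : ∀ a {b} → ¬ p ℕ.∣ a → X (a ℕ.* a ℕ.* b) ≈ X b
    X-square a {b} p∤a = begin
      X (a ℕ.* a ℕ.* b)     ≈⟨ trans (X-* (a ℕ.* a) b) (*-congʳ (X-* a a)) ⟩
      X a * X a * X b       ≈⟨ *-congʳ (X-involution p∤a) ⟩
      1# * X b              ≈⟨ *-identityˡ _ ⟩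
      X b                   ∎

    p∤ : ∀ {k} .{{_ : ℕ.NonZero k}} → k ℕ.< p → ¬ p ℕ.∣ k
    p∤ = ℕ.>⇒∤

    ⟦p+⟧ : ∀ a → ⟦ p ℕ.+ a ⟧ ≈ ⟦ a ⟧
    ⟦p+⟧ a = trans (⟦⟧-+ p a) (trans (+-congʳ p·1≈0) (+-identityˡ _))

    module Factorial (-1^m≈1 : (- 1#) ^ m ≈ 1#) .{{_ : ℕ.NonZero m}} where

      -- `2m = p - 1` is `-1` in the ring.
      X2*Xm : X 2 * X m ≈ 1#
      X2*Xm = begin
        X 2 * X m             ≈⟨ trans (*-comm _ _) (sym (X-* m 2)) ⟩
        X (m ℕ.* 2)           ≈⟨ ^-congˡ m (x-y≈0⇒x≈y _ _ (trans (solve 1 (λ x → x :- :- con 1ℤ := con 1ℤ :+ x) refl _) p·1≈0)) ⟩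
        (- 1#) ^ m            ≈⟨ -1^m≈1 ⟩
        1#                    ∎

      -- The squares of 1, …, m are the m-th roots of unity.
      ⟦m!⟧² : ⟦ m ! ⟧ * ⟦ m ! ⟧ ≈ - 1#
      ⟦m!⟧² = begin
        ⟦ m ! ⟧ * ⟦ m ! ⟧                 ≡⟨ ≡.cong (λ k → ⟦ k ⟧ * ⟦ k ⟧) (ℕProduct.∏-suc-! m) ⟨
        ⟦ ∏ m suc ⟧ * ⟦ ∏ m suc ⟧         ≈⟨ *-cong (⟦⟧-∏ m suc) (⟦⟧-∏ m suc) ⟨
        range m g * range m g             ≈⟨ range-∙ m g g ⟨
        product {m} r                     ≈⟨ unity-product integral -1^m≈1 r distinct unity ⟩
        - 1#                              ∎
        where
        g : ℕ → Carrier
        g k = ⟦ suc k ⟧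
        r : Fin m → Carrier
        r i = g (toℕ i) * g (toℕ i)

        i<p : ∀ (i : Fin m) → suc (toℕ i) ℕ.< p
        i<p i = ℕ.s≤s (ℕ.≤-trans (Fin.toℕ<n i) (ℕ.m≤m*n m 2))

        unity : ∀ i → r i ^ m ≈ 1#
        unity i = trans (^-distrib-* (g (toℕ i)) (g (toℕ i)) m) (X-involution (p∤ (i<p i)))

        sum<p : ∀ (i j : Fin m) → suc (toℕ i) ℕ.+ suc (toℕ j) ℕ.< p
        sum<p i j = ℕ.s≤s (≡.subst (suc (toℕ i) ℕ.+ suc (toℕ j) ℕ.≤_)
          (≡.trans (≡.cong (m ℕ.+_) (≡.sym (ℕ.+-identityʳ m))) (ℕ.*-comm 2 m))
          (ℕ.+-mono-≤ (Fin.toℕ<n i) (Fin.toℕ<n j)))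

        ordered : ∀ {a b} → a ℕ.≤ b → b ℕ.< m → ⟦ a ⟧ ≈ ⟦ b ⟧ → a ≡ b
        ordered {a} {b} a≤b b<m eq with b ℕ.∸ a in b∸a
        ... | zero  = ℕ.≤-antisym a≤b (ℕ.m∸n≡0⇒m≤n b∸a)
        ... | suc k = contradiction (char (suc k) diff) (p∤ (ℕ.≤-<-trans (≡.subst (ℕ._≤ b) b∸a (ℕ.m∸n≤m b a))
                        (ℕ.<-trans b<m (ℕ.s≤s (ℕ.m≤m*n m 2)))))
          where
          diff : ⟦ suc k ⟧ ≈ 0#
          diff = begin
            ⟦ suc k ⟧                   ≈⟨ solve 2 (λ x a → x := (x :+ a) :- a) refl ⟦ suc k ⟧ ⟦ a ⟧ ⟩
            (⟦ suc k ⟧ + ⟦ a ⟧) - ⟦ a ⟧   ≈⟨ +-congʳ (⟦⟧-+ (suc k) a) ⟨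
            ⟦ suc k ℕ.+ a ⟧ - ⟦ a ⟧     ≡⟨ ≡.cong (λ l → ⟦ l ⟧ - ⟦ a ⟧) (≡.trans (≡.cong (ℕ._+ a) (≡.sym b∸a)) (ℕ.m∸n+n≡m a≤b)) ⟩
            ⟦ b ⟧ - ⟦ a ⟧               ≈⟨ x≈y⇒x-y≈0 (sym eq) ⟩
            0#                          ∎

        injective : ∀ {a b} → a ℕ.< m → b ℕ.< m → ⟦ a ⟧ ≈ ⟦ b ⟧ → a ≡ b
        injective {a} {b} a<m b<m eq with ℕ.≤-total a b
        ... | inj₁ a≤b = ordered a≤b b<m eq
        ... | inj₂ b≤a = ≡.sym (ordered b≤a a<m (sym eq))

        -- Equal squares leave `x = y` or `x = -y`; the latter is excluded because two numbers among
        -- `1, …, m` have a sum strictly between `0` and `p`.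
        distinct : Distinct r
        distinct i j rᵢ≈rⱼ with integral {g (toℕ i) - g (toℕ j)} {g (toℕ i) + g (toℕ j)}
          (trans (solve 2 (λ x y → (x :- y) :* (x :+ y) := x :* x :- y :* y) refl _ _) (x≈y⇒x-y≈0 rᵢ≈rⱼ))
        ... | inj₁ x-y≈0 = Fin.toℕ-injective (injective (Fin.toℕ<n i) (Fin.toℕ<n j) (x-y≈0⇒x≈y _ _ (trans
                (solve 2 (λ x y → x :- y := (con 1ℤ :+ x) :- (con 1ℤ :+ y)) refl _ _) x-y≈0)))
        ... | inj₂ x+y≈0 = contradiction (char _ (trans (⟦⟧-+ (suc (toℕ i)) (suc (toℕ j))) x+y≈0)) (p∤ (sum<p i j))

-- Evaluation of the symbol through characters of factorials

module Evaluation {c ℓ} (R : CommutativeRing c ℓ) where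
  open CommutativeRing R hiding (zero)
  open CommutativeSemiringExp commutativeSemiring
  open CommutativeMonoidSum *-commutativeMonoid
    using () renaming (sum to product)
  open RangeSum *-commutativeMonoid using (range; range-∙; range-cong)
  open ℕProduct
    using (∏; ∏-+; ∏-cong; ∏-binomials; binomial₂; binomial₃; nC[m+k]; superfactorial; superfactorial-even)
  open IntegerCoefficients R using (solve; _:=_; _:*_; :-_; con)
  open Determinant R using (det)
  open RootsOfUnity R
  open DifferencePowers R
  open QuadraticCharacter R
  open SetoidReasoning setoid

  module _ (integral : ∀ {x y} → x * y ≈ 0# → x ≈ 0# ⊎ y ≈ 0#) (m : ℕ)
    (prime : Prime (suc (m ℕ.* 2))) (p·1≈0 : ⟦ suc (m ℕ.* 2) ⟧ ≈ 0#)
    (char : ∀ k → ⟦ k ⟧ ≈ 0# → suc (m ℕ.* 2) ℕ.∣ k)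
    (fermat : ∀ {x} → ¬ x ≈ 0# → x ^ (m ℕ.* 2) ≈ 1#)
    (h h′ : ℕ) (h≡ : h ≡ 2 ℕ.+ h′) (m≡ : m ≡ h ℕ.* 2)
    where

    open Character integral m prime p·1≈0 char fermat

    private
      r = h′ ℕ.* 2

      m≡4+r : m ≡ 4 ℕ.+ r
      m≡4+r = ≡.trans m≡ (≡.cong (ℕ._* 2) h≡)

      -1^m≈1 : (- 1#) ^ m ≈ 1#
      -1^m≈1 = trans (^-congʳ (- 1#) m≡) (-1^even h)

      m<p : m ℕ.< p
      m<p = ℕ.s≤s (ℕ.m≤m*n m 2)

      -- `m ≥ 4` gives `p ≥ 9`, so the constants 2, 3, 4, 5 and 7 below are all prime to `p`.
      8<p : 8 ℕ.< p
      8<p = ℕ.s≤s (ℕ.*-monoˡ-≤ 2 (≡.subst (4 ℕ.≤_) (≡.sym m≡4+r) (ℕ.m≤m+n 4 r)))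

      small : ∀ k → .{{_ : ℕ.NonZero k}} → k ℕ.≤ 8 → ¬ p ℕ.∣ k
      small k k≤8 = p∤ (ℕ.≤-<-trans k≤8 8<p)

      instance
        m≢0 : ℕ.NonZero m
        m≢0 = ≡.subst ℕ.NonZero (≡.sym m≡4+r) _

      p∤2 = small 2 (ℕ.≤ᵇ⇒≤ 2 8 _)
      p∤3 = small 3 (ℕ.≤ᵇ⇒≤ 3 8 _)
      p∤4 = small 4 (ℕ.≤ᵇ⇒≤ 4 8 _)
      p∤5 = small 5 (ℕ.≤ᵇ⇒≤ 5 8 _)
      p∤7 = small 7 (ℕ.≤ᵇ⇒≤ 7 8 _)

    open Factorial -1^m≈1

    -- `d₀` and `d₁` are the folded coefficients for `k = 0, 3` and for `k = 1, 2`, and `Y` is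
    -- `(m+3)! / m!`. `B` collects the coefficients with `4 ≤ k < m`, which folding leaves alone,
    -- and `F₄` the factorials `k!` of that range.
    d₀ d₁ Y F₄ B : ℕ
    d₀ = 1 ℕ.+ ((m ℕ.+ 3) C 3)
    d₁ = (m ℕ.+ 3) ℕ.+ ((m ℕ.+ 3) C 2)
    Y  = (m ℕ.+ 3) ℕ.* ((m ℕ.+ 2) ℕ.* (m ℕ.+ 1))
    F₄ = ∏ r (λ j → (4 ℕ.+ j) !)
    B  = ∏ r (λ j → (m ℕ.+ 3) C (4 ℕ.+ j))

    -- 2m = p - 1 turns 2(m + j) into p + (2j - 1).
    ⟦8Y⟧ : ⟦ 8 ℕ.* Y ⟧ ≈ ⟦ 15 ⟧
    ⟦8Y⟧ = begin
      ⟦ 8 ℕ.* Y ⟧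
        ≡⟨ ≡.cong ⟦_⟧ (double m) ⟩
      ⟦ (p ℕ.+ 5) ℕ.* ((p ℕ.+ 3) ℕ.* (p ℕ.+ 1)) ⟧
        ≈⟨ trans (⟦⟧-* (p ℕ.+ 5) ((p ℕ.+ 3) ℕ.* (p ℕ.+ 1))) (*-cong (⟦p+⟧ 5) (trans (⟦⟧-* (p ℕ.+ 3) (p ℕ.+ 1)) (*-cong (⟦p+⟧ 3) (⟦p+⟧ 1)))) ⟩
      ⟦ 5 ⟧ * (⟦ 3 ⟧ * ⟦ 1 ⟧)
        ≈⟨ trans (⟦⟧-* 5 3) (*-congˡ (⟦⟧-* 3 1)) ⟨
      ⟦ 15 ⟧ ∎
      where
      double : ∀ m → 8 ℕ.* ((m ℕ.+ 3) ℕ.* ((m ℕ.+ 2) ℕ.* (m ℕ.+ 1))) ≡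
        (1 ℕ.+ m ℕ.* 2 ℕ.+ 5) ℕ.* ((1 ℕ.+ m ℕ.* 2 ℕ.+ 3) ℕ.* (1 ℕ.+ m ℕ.* 2 ℕ.+ 1))
      double = ℕ.solve-∀

    -- `48 = 6 · 8`: the 6 clears the denominator of the binomial coefficient, the 8 turns `Y` into
    -- 15, and `63 = 48 + 15`.
    ⟦48d₀⟧ : ⟦ 48 ℕ.* d₀ ⟧ ≈ ⟦ 63 ⟧
    ⟦48d₀⟧ = begin
      ⟦ 48 ℕ.* d₀ ⟧                 ≡⟨ ≡.cong ⟦_⟧ (regroup ((m ℕ.+ 3) C 3)) ⟩
      ⟦ 48 ℕ.+ 8 ℕ.* (((m ℕ.+ 3) C 3) ℕ.* 6) ⟧   ≡⟨ ≡.cong (λ x → ⟦ 48 ℕ.+ 8 ℕ.* x ⟧) (binomial₃ m) ⟩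
      ⟦ 48 ℕ.+ 8 ℕ.* Y ⟧            ≈⟨ trans (⟦⟧-+ 48 (8 ℕ.* Y)) (+-congˡ ⟦8Y⟧) ⟩
      ⟦ 48 ⟧ + ⟦ 15 ⟧               ≈⟨ ⟦⟧-+ 48 15 ⟨
      ⟦ 63 ⟧                        ∎
      where
      regroup : ∀ c → 48 ℕ.* (1 ℕ.+ c) ≡ 48 ℕ.+ 8 ℕ.* (c ℕ.* 6)
      regroup = ℕ.solve-∀

    -- `8 d₁ = 4 · 2(m+3) + 2(m+3) · 2(m+2)`, which is `4 · 5 + 5 · 3` modulo `p`.
    ⟦8d₁⟧ : ⟦ 8 ℕ.* d₁ ⟧ ≈ ⟦ 35 ⟧
    ⟦8d₁⟧ = begin
      ⟦ 8 ℕ.* d₁ ⟧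
        ≡⟨ ≡.cong ⟦_⟧ (≡.trans (regroup (m ℕ.+ 3) ((m ℕ.+ 3) C 2))
             (≡.trans (≡.cong (λ x → 8 ℕ.* (m ℕ.+ 3) ℕ.+ 4 ℕ.* x) (binomial₂ m)) (double m))) ⟩
      ⟦ 4 ℕ.* (p ℕ.+ 5) ℕ.+ (p ℕ.+ 5) ℕ.* (p ℕ.+ 3) ⟧
        ≈⟨ trans (⟦⟧-+ (4 ℕ.* (p ℕ.+ 5)) ((p ℕ.+ 5) ℕ.* (p ℕ.+ 3))) (+-cong (⟦⟧-* 4 (p ℕ.+ 5)) (⟦⟧-* (p ℕ.+ 5) (p ℕ.+ 3))) ⟩
      ⟦ 4 ⟧ * ⟦ p ℕ.+ 5 ⟧ + ⟦ p ℕ.+ 5 ⟧ * ⟦ p ℕ.+ 3 ⟧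
        ≈⟨ +-cong (*-congˡ (⟦p+⟧ 5)) (*-cong (⟦p+⟧ 5) (⟦p+⟧ 3)) ⟩
      ⟦ 4 ⟧ * ⟦ 5 ⟧ + ⟦ 5 ⟧ * ⟦ 3 ⟧
        ≈⟨ trans (⟦⟧-+ 20 15) (+-cong (⟦⟧-* 4 5) (⟦⟧-* 5 3)) ⟨
      ⟦ 35 ⟧ ∎
      where
      regroup : ∀ n c → 8 ℕ.* (n ℕ.+ c) ≡ 8 ℕ.* n ℕ.+ 4 ℕ.* (c ℕ.* 2)
      regroup = ℕ.solve-∀
      double : ∀ m → 8 ℕ.* (m ℕ.+ 3) ℕ.+ 4 ℕ.* ((m ℕ.+ 3) ℕ.* (m ℕ.+ 2)) ≡
        4 ℕ.* (1 ℕ.+ m ℕ.* 2 ℕ.+ 5) ℕ.+ (1 ℕ.+ m ℕ.* 2 ℕ.+ 5) ℕ.* (1 ℕ.+ m ℕ.* 2 ℕ.+ 3)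
      double = ℕ.solve-∀

    X-8* : ∀ k → X (8 ℕ.* k) ≈ X 2 * X k
    X-8* k = trans (X-* 8 k) (*-congʳ (X-square 2 {2} p∤2))

    -- Up to squares 48 is 3 and 63 is 7. The character of 7 occurs for `d₁` as well, and the two
    -- cancel in the end.
    X3*Xd₀ : X 3 * X d₀ ≈ X 7
    X3*Xd₀ = begin
      X 3 * X d₀        ≈⟨ *-congʳ (X-square 4 {3} p∤4) ⟨
      X 48 * X d₀       ≈⟨ X-* 48 d₀ ⟨
      X (48 ℕ.* d₀)     ≈⟨ X-cong (48 ℕ.* d₀) 63 ⟦48d₀⟧ ⟩
      X 63              ≈⟨ X-square 3 {7} p∤3 ⟩
      X 7               ∎

    X2*Xd₁ : X 2 * X d₁ ≈ X 5 * X 7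
    X2*Xd₁ = trans (sym (X-8* d₁)) (trans (X-cong (8 ℕ.* d₁) 35 ⟦8d₁⟧) (X-* 5 7))

    X2*XY : X 2 * X Y ≈ X 3 * X 5
    X2*XY = trans (sym (X-8* Y)) (trans (X-cong (8 ℕ.* Y) 15 ⟦8Y⟧) (X-* 3 5))

    X[m+3]! : X ((m ℕ.+ 3) !) ≈ X Y * X (m !)
    X[m+3]! = trans (reflexive (≡.cong X factorial)) (X-* Y (m !))
      where
      regroup : ∀ a b c f → a ℕ.* (b ℕ.* (c ℕ.* f)) ≡ a ℕ.* (b ℕ.* c) ℕ.* f
      regroup = ℕ.solve-∀
      factorial : (m ℕ.+ 3) ! ≡ Y ℕ.* m !
      factorial rewrite ℕ.+-comm m 3 | ℕ.+-comm m 2 | ℕ.+-comm m 1 =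
        regroup (3 ℕ.+ m) (2 ℕ.+ m) (1 ℕ.+ m) (m !)

    Xm! : X (m !) ≈ (- 1#) ^ h
    Xm! = begin
      ⟦ m ! ⟧ ^ m                        ≈⟨ ^-congʳ ⟦ m ! ⟧ m≡ ⟩
      ⟦ m ! ⟧ ^ (h ℕ.* 2)                ≈⟨ ^-double ⟦ m ! ⟧ h ⟩
      ⟦ m ! ⟧ ^ h * ⟦ m ! ⟧ ^ h          ≈⟨ ^-distrib-* ⟦ m ! ⟧ ⟦ m ! ⟧ h ⟨
      (⟦ m ! ⟧ * ⟦ m ! ⟧) ^ h            ≈⟨ ^-congˡ h ⟦m!⟧² ⟩
      (- 1#) ^ h                         ∎

    p∤sf : ¬ p ℕ.∣ superfactorial m
    p∤sf = prime∤∏ prime m λ k k<m → prime∤! prime (ℕ.<-trans k<m m<p)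

    -- The square `Q * Q` disappears under the character. That `p` does not divide `Q` holds because
    -- `Q` divides a product of factorials of numbers below `p`.
    Xsf*Xm! : X (superfactorial m) * X (m !) ≈ X 2 ^ h * X (h !)
    Xsf*Xm! with Q , eq ← superfactorial-even h = begin
      X (superfactorial m) * X (m !)     ≈⟨ X-* (superfactorial m) (m !) ⟨
      X (superfactorial m ℕ.* m !)       ≡⟨ ≡.cong X identity ⟩
      X (Q ℕ.* Q ℕ.* (2 ℕ.^ h ℕ.* h !))  ≈⟨ X-square Q p∤Q ⟩
      X (2 ℕ.^ h ℕ.* h !)                ≈⟨ trans (X-* (2 ℕ.^ h) (h !)) (*-congʳ (X-^ 2 h)) ⟩
      X 2 ^ h * X (h !)                  ∎
      where
      identity : superfactorial m ℕ.* m ! ≡ Q ℕ.* Q ℕ.* (2 ℕ.^ h ℕ.* h !)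
      identity = ≡.trans (≡.cong (λ k → superfactorial k ℕ.* k !) m≡) (≡.trans eq (ℕ.*-comm (2 ℕ.^ h ℕ.* h !) (Q ℕ.* Q)))
      p∤Q : ¬ p ℕ.∣ Q
      p∤Q p∣Q with euclidsLemma (superfactorial m) (m !) prime
        (≡.subst (p ℕ.∣_) (≡.sym identity) (ℕ.∣m⇒∣m*n (2 ℕ.^ h ℕ.* h !) (ℕ.∣m⇒∣m*n Q p∣Q)))
      ... | inj₁ p∣sf = p∤sf p∣sf
      ... | inj₂ p∣m! = prime∤! prime m<p p∣m!

    sf≡12*F₄ : superfactorial m ≡ 12 ℕ.* F₄
    sf≡12*F₄ = ≡.trans (≡.cong superfactorial m≡4+r) (∏-+ 4 r _!)

    X3*XF₄ : X 3 * X F₄ ≈ X (superfactorial m)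
    X3*XF₄ = begin
      X 3 * X F₄            ≈⟨ *-congʳ (X-square 2 {3} p∤2) ⟨
      X 12 * X F₄           ≈⟨ X-* 12 F₄ ⟨
      X (12 ℕ.* F₄)         ≡⟨ ≡.cong X sf≡12*F₄ ⟨
      X (superfactorial m)  ∎

    p∤F₄ : ¬ p ℕ.∣ F₄
    p∤F₄ p∣F₄ = p∤sf (≡.subst (p ℕ.∣_) (≡.sym sf≡12*F₄) (ℕ.∣n⇒∣m*n 12 p∣F₄))

    X[m+3]!-involution : X ((m ℕ.+ 3) !) * X ((m ℕ.+ 3) !) ≈ 1#
    X[m+3]!-involution = X-involution (prime∤! prime (ℕ.s≤s (≡.subst (m ℕ.+ 3 ℕ.≤_)
      (≡.trans (≡.cong (m ℕ.+_) (≡.sym (ℕ.+-identityʳ m))) (ℕ.*-comm 2 m))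
      (ℕ.+-monoʳ-≤ m (≡.subst (3 ℕ.≤_) (≡.sym m≡4+r) (ℕ.s≤s (ℕ.s≤s (ℕ.s≤s ℕ.z≤n))))))))

    ^-half : ∀ x → (x * x) ^ h ≈ x ^ m
    ^-half x = begin
      (x * x) ^ h       ≈⟨ ^-distrib-* x x h ⟩
      x ^ h * x ^ h     ≈⟨ ^-double x h ⟨
      x ^ (h ℕ.* 2)     ≈⟨ ^-congʳ x m≡ ⟨
      x ^ m             ∎

    -- `B` occurs only to the power `h`, half the exponent of the character. Times `F₄ * F₄` it is
    -- `(m+3)!` to the even exponent `r = 2h′`, and `r h = m h′` makes its `h`-th power a power of a
    -- quadratic character; the `h`-th power of `F₄ * F₄` is `X F₄`.
    ⟦B⟧^h*XF₄ : ⟦ B ⟧ ^ h * X F₄ ≈ X ((m ℕ.+ 3) !) ^ h′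
    ⟦B⟧^h*XF₄ = begin
      ⟦ B ⟧ ^ h * ⟦ F₄ ⟧ ^ m                 ≈⟨ *-congˡ (^-half ⟦ F₄ ⟧) ⟨
      ⟦ B ⟧ ^ h * (⟦ F₄ ⟧ * ⟦ F₄ ⟧) ^ h      ≈⟨ ^-distrib-* ⟦ B ⟧ _ h ⟨
      (⟦ B ⟧ * (⟦ F₄ ⟧ * ⟦ F₄ ⟧)) ^ h        ≈⟨ ^-congˡ h (trans (⟦⟧-* B (F₄ ℕ.* F₄)) (*-congˡ (⟦⟧-* F₄ F₄))) ⟨
      ⟦ B ℕ.* (F₄ ℕ.* F₄) ⟧ ^ h              ≡⟨ ≡.cong (λ k → ⟦ k ⟧ ^ h) binomials ⟩
      ⟦ ((m ℕ.+ 3) !) ℕ.^ r ⟧ ^ h            ≈⟨ ^-congˡ h (⟦⟧-^ ((m ℕ.+ 3) !) r) ⟩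
      (⟦ (m ℕ.+ 3) ! ⟧ ^ r) ^ h              ≈⟨ ^-assocʳ _ r h ⟩
      ⟦ (m ℕ.+ 3) ! ⟧ ^ (r ℕ.* h)            ≡⟨ ≡.cong (⟦ (m ℕ.+ 3) ! ⟧ ^_) exponent ⟩
      ⟦ (m ℕ.+ 3) ! ⟧ ^ (m ℕ.* h′)           ≈⟨ ^-assocʳ _ m h′ ⟨
      X ((m ℕ.+ 3) !) ^ h′                   ∎
      where
      binomials : B ℕ.* (F₄ ℕ.* F₄) ≡ ((m ℕ.+ 3) !) ℕ.^ r
      binomials = ≡.subst (λ n → ∏ r (λ j → n C (4 ℕ.+ j)) ℕ.* (F₄ ℕ.* F₄) ≡ (n !) ℕ.^ r)
        (≡.cong (ℕ._+ 3) (≡.sym m≡4+r)) (∏-binomials r)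
      exponent : r ℕ.* h ≡ m ℕ.* h′
      exponent = ≡.trans (regroup h′ h) (≡.cong (ℕ._* h′) (≡.sym m≡))
        where
        regroup : ∀ h′ h → h′ ℕ.* 2 ℕ.* h ≡ h ℕ.* 2 ℕ.* h′
        regroup = ℕ.solve-∀

    open Folding integral m r m≡4+r -1^m≈1 using (ε; d; coefficient; det-difference-^)

    -- Consecutive signs are opposite, so each of the `t` pairs contributes `-1`.
    ∏-ε : ∀ t → range (t ℕ.* 2) ε ≈ (- 1#) ^ t
    ∏-ε zero    = refl
    ∏-ε (suc t) = begin
      ε 0 * (ε 1 * range (t ℕ.* 2) (ε ∘ (2 ℕ.+_)))
        ≈⟨ *-congˡ (*-congˡ (trans (range-cong (t ℕ.* 2) λ k _ → shift k) (∏-ε t))) ⟩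
      ε 0 * (ε 1 * (- 1#) ^ t)
        ≈⟨ solve 1 (λ x → (:- con 1ℤ) :* ((:- ((:- con 1ℤ) :* con 1ℤ)) :* x) := (:- con 1ℤ) :* x) refl _ ⟩
      (- 1#) ^ suc t ∎
      where
      shift : ∀ k → ε (2 ℕ.+ k) ≈ ε k
      shift k = solve 1 (λ x → :- ((:- con 1ℤ) :* ((:- con 1ℤ) :* x)) := :- x) refl ((- 1#) ^ k)

    -- By the symmetry of binomial coefficients the first four values of `d` are `d₀, d₁, d₁, d₀`;
    -- the later ones are single binomial coefficients.
    ∏-d : ∏ m d ≡ d₀ ℕ.* d₁ ℕ.* (d₀ ℕ.* d₁) ℕ.* B
    ∏-d = ≡.trans (≡.cong (λ l → ∏ l d) m≡4+r) (≡.trans (∏-+ 4 r d)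
      (≡.trans (≡.cong₂ ℕ._*_ first-four rest) (regroup d₀ d₁ B)))
      where
      C′ : ℕ → ℕ
      C′ k = (m ℕ.+ 3) C k

      high : ∀ {k} → k ℕ.≤ 3 → C′ (m ℕ.+ k) ≡ C′ (3 ℕ.∸ k)
      high = nC[m+k] m

      first-four : ∏ 4 d ≡ d₀ ℕ.* (d₁ ℕ.* (d₁ ℕ.* (d₀ ℕ.* 1)))
      first-four = ≡.cong₂ ℕ._*_ (≡.cong suc (high ℕ.z≤n))
        (≡.cong₂ ℕ._*_ (≡.cong₂ ℕ._+_ (nC1≡n (m ℕ.+ 3)) (high (ℕ.s≤s ℕ.z≤n)))
        (≡.cong₂ ℕ._*_ (≡.trans (≡.cong (C′ 2 ℕ.+_) (≡.trans (high (ℕ.s≤s (ℕ.s≤s ℕ.z≤n))) (nC1≡n (m ℕ.+ 3))))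
                          (ℕ.+-comm (C′ 2) (m ℕ.+ 3)))
          (≡.cong (ℕ._* 1) (≡.trans (≡.cong (C′ 3 ℕ.+_) (high (ℕ.s≤s (ℕ.s≤s (ℕ.s≤s ℕ.z≤n))))) (ℕ.+-comm (C′ 3) 1)))))

      rest : ∏ r (d ∘ (4 ℕ.+_)) ≡ B
      rest = ∏-cong r λ j _ → ≡.trans (≡.cong (C′ (4 ℕ.+ j) ℕ.+_)
        (k>n⇒nCk≡0 (ℕ.+-monoʳ-< m (ℕ.s≤s (ℕ.s≤s (ℕ.s≤s (ℕ.s≤s (ℕ.z≤n {j})))))))) (ℕ.+-identityʳ _)

      regroup : ∀ a b x → a ℕ.* (b ℕ.* (b ℕ.* (a ℕ.* 1))) ℕ.* x ≡ a ℕ.* b ℕ.* (a ℕ.* b) ℕ.* x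
      regroup = ℕ.solve-∀

    product-coefficient : product coefficient ≈ (- 1#) ^ h * (⟦ d₀ ℕ.* d₁ ⟧ * ⟦ d₀ ℕ.* d₁ ⟧ * ⟦ B ⟧)
    product-coefficient = begin
      range m (λ k → ε k * ⟦ d k ⟧)
        ≈⟨ range-∙ m ε (λ k → ⟦ d k ⟧) ⟩
      range m ε * range m (λ k → ⟦ d k ⟧)
        ≈⟨ *-cong (trans (reflexive (≡.cong (λ l → range l ε) m≡)) (∏-ε h))
                  (trans (⟦⟧-∏ m d) (reflexive (≡.cong ⟦_⟧ ∏-d))) ⟩
      (- 1#) ^ h * ⟦ d₀ ℕ.* d₁ ℕ.* (d₀ ℕ.* d₁) ℕ.* B ⟧
        ≈⟨ *-congˡ (trans (⟦⟧-* (d₀ ℕ.* d₁ ℕ.* (d₀ ℕ.* d₁)) B) (*-congʳ (⟦⟧-* (d₀ ℕ.* d₁) (d₀ ℕ.* d₁)))) ⟩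
      (- 1#) ^ h * (⟦ d₀ ℕ.* d₁ ⟧ * ⟦ d₀ ℕ.* d₁ ⟧ * ⟦ B ⟧) ∎

    module _ (α : Fin m → Carrier) (distinct : Distinct α) (unity : ∀ i → α i ^ m ≈ 1#)
      {s} (s² : s * s ≈ det (λ i j → (α i - α j) ^ (m ℕ.+ 3))) where

      -- The lone `- 1#` is `product α ^ 3`. Since `d₀ d₁` occurs squared, its `h`-th power is
      -- already a character value; only `B` is left with a bare power `h`.
      χ[s] : s ^ m ≈ X m ^ h * (((- 1#) ^ h * - 1#) ^ h * (X d₀ * X d₁ * ⟦ B ⟧ ^ h))
      χ[s] = begin
        s ^ m
          ≈⟨ ^-half s ⟨
        (s * s) ^ h
          ≈⟨ ^-congˡ h (trans s² (det-difference-^ α distinct unity)) ⟩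
        (⟦ m ⟧ ^ m * product coefficient * product α ^ 3) ^ h
          ≈⟨ ^-congˡ h (*-cong (*-congˡ product-coefficient) (^-congˡ 3 (unity-product integral -1^m≈1 α distinct unity))) ⟩
        (X m * ((- 1#) ^ h * (D * D * ⟦ B ⟧)) * (- 1#) ^ 3) ^ h
          ≈⟨ ^-congˡ h (solve 4 (λ x e d b → x :* (e :* (d :* d :* b)) :* ((:- con 1ℤ) :* ((:- con 1ℤ) :* ((:- con 1ℤ) :* con 1ℤ))) :=
               x :* ((e :* (:- con 1ℤ)) :* ((d :* d) :* b))) refl (X m) ((- 1#) ^ h) D ⟦ B ⟧) ⟩
        (X m * (((- 1#) ^ h * - 1#) * (D * D * ⟦ B ⟧))) ^ h
          ≈⟨ trans (^-distrib-* _ _ h) (*-congˡ (trans (^-distrib-* _ _ h) (*-congˡ (^-distrib-* _ _ h)))) ⟩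
        X m ^ h * (((- 1#) ^ h * - 1#) ^ h * ((D * D) ^ h * ⟦ B ⟧ ^ h))
          ≈⟨ *-congˡ (*-congˡ (*-congʳ (trans (^-half D) (X-* d₀ d₁)))) ⟩
        X m ^ h * (((- 1#) ^ h * - 1#) ^ h * (X d₀ * X d₁ * ⟦ B ⟧ ^ h)) ∎
        where D = ⟦ d₀ ℕ.* d₁ ⟧

      private
        a b e : Carrier
        a = X 2
        b = X 3
        e = X 7
        c₅ = X 5
        M = X (m !)
        f = X (h !)
        N = X ((m ℕ.+ 3) !)

        a² : a * a ≈ 1#
        a² = X-involution p∤2
        b² : b * b ≈ 1#
        b² = X-involution p∤3
        c² : c₅ * c₅ ≈ 1#
        c² = X-involution p∤5
        e² : e * e ≈ 1#
        e² = X-involution p∤7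
        M² : M * M ≈ 1#
        M² = X-involution (prime∤! prime m<p)

        Xm≈a : X m ≈ a
        Xm≈a = trans (involution-cancel a² X2*Xm) (*-identityʳ a)
        Xd₀≈ : X d₀ ≈ b * e
        Xd₀≈ = involution-cancel b² X3*Xd₀
        Xd₁≈ : X d₁ ≈ a * (c₅ * e)
        Xd₁≈ = involution-cancel a² X2*Xd₁
        N≈ : N ≈ a * (b * c₅) * M
        N≈ = trans X[m+3]! (*-congʳ (involution-cancel a² X2*XY))
        Xsf≈ : X (superfactorial m) ≈ M * (a ^ h * f)
        Xsf≈ = involution-cancel M² (trans (*-comm _ _) Xsf*Xm!)
        XF₄≈ : X F₄ ≈ b * (M * (a ^ h * f))
        XF₄≈ = trans (involution-cancel b² X3*XF₄) (*-congˡ Xsf≈)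
        B^h≈ : ⟦ B ⟧ ^ h ≈ X F₄ * N ^ h′
        B^h≈ = involution-cancel (X-involution p∤F₄) (trans (*-comm _ _) ⟦B⟧^h*XF₄)

        h^-even : ∀ {x} t → h′ ≡ t ℕ.* 2 → x * x ≈ 1# → x ^ h ≈ 1#
        h^-even t h′≡ x² = trans (^-congʳ _ (≡.trans h≡ (≡.cong (2 ℕ.+_) h′≡))) (involution-even (suc t) x²)

        h^-odd : ∀ {x} t → h′ ≡ suc (t ℕ.* 2) → x * x ≈ 1# → x ^ h ≈ x
        h^-odd t h′≡ x² = trans (^-congʳ _ (≡.trans h≡ (≡.cong (2 ℕ.+_) h′≡))) (involution-odd (suc t) x²)

      -- For even `h` the `h`-th and `h′`-th powers of character values and signs are one, including
      -- `X (m !) = (-1) ^ h`. The characters of 3 and 7 occur twice.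
      χ[s]-even : ∀ t → h′ ≡ t ℕ.* 2 → s ^ m ≈ X 2 * X 5 * X (h !)
      χ[s]-even t h′≡ = begin
        s ^ m
          ≈⟨ χ[s] ⟩
        X m ^ h * (((- 1#) ^ h * - 1#) ^ h * (X d₀ * X d₁ * ⟦ B ⟧ ^ h))
          ≈⟨ *-cong (h^-even t h′≡ (trans (*-cong Xm≈a Xm≈a) a²))
               (*-cong (trans (^-congˡ h (trans (*-congʳ (h^-even t h′≡ -1*-1≈1)) (*-identityˡ _))) (h^-even t h′≡ -1*-1≈1))
               (*-cong (*-cong Xd₀≈ Xd₁≈) (trans B^h≈ (*-cong
                 (trans XF₄≈ (*-congˡ (*-cong (trans Xm! (h^-even t h′≡ -1*-1≈1)) (*-congʳ (h^-even t h′≡ a²)))))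
                 (trans (^-congʳ N h′≡) (involution-even t X[m+3]!-involution)))))) ⟩
        1# * (1# * (b * e * (a * (c₅ * e)) * (b * (1# * (1# * f)) * 1#)))
          ≈⟨ solve 5 (λ a b c e f → con 1ℤ :* (con 1ℤ :* (b :* e :* (a :* (c :* e)) :*
               (b :* (con 1ℤ :* (con 1ℤ :* f)) :* con 1ℤ))) := (b :* b) :* (e :* e) :* (a :* c :* f)) refl a b c₅ e f ⟩
        (b * b) * (e * e) * (a * c₅ * f)
          ≈⟨ trans (*-congʳ (trans (*-cong b² e²) (*-identityˡ _))) (*-identityˡ _) ⟩
        a * c₅ * f ∎

      -- For odd `h` an `h`-th power of a character value is that value. After `X 3` and `X (h !)`
      -- are split off, every factor occurs an even number of times, including the sign `X (m !)`,
      -- which can stay unevaluated.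
      χ[s]-odd : ∀ t → h′ ≡ suc (t ℕ.* 2) → s ^ m ≈ X 3 * X (h !)
      χ[s]-odd t h′≡ = begin
        s ^ m
          ≈⟨ χ[s] ⟩
        X m ^ h * (((- 1#) ^ h * - 1#) ^ h * (X d₀ * X d₁ * ⟦ B ⟧ ^ h))
          ≈⟨ *-cong (trans (h^-odd t h′≡ (trans (*-cong Xm≈a Xm≈a) a²)) Xm≈a)
               (*-cong (trans (^-congˡ h (trans (*-congʳ (h^-odd t h′≡ -1*-1≈1)) -1*-1≈1)) (1^n≈1 h))
               (*-cong (*-cong Xd₀≈ Xd₁≈) (trans B^h≈ (*-cong
                 (trans XF₄≈ (*-congˡ (*-congˡ (*-congʳ (h^-odd t h′≡ a²)))))
                 (trans (^-congʳ N h′≡) (trans (involution-odd t X[m+3]!-involution) N≈)))))) ⟩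
        a * (1# * (b * e * (a * (c₅ * e)) * (b * (M * (a * f)) * (a * (b * c₅) * M))))
          ≈⟨ solve 6 (λ a b c e f M → a :* (con 1ℤ :* (b :* e :* (a :* (c :* e)) :*
               (b :* (M :* (a :* f)) :* (a :* (b :* c) :* M)))) :=
               (a :* a) :* (a :* a) :* (b :* b) :* (c :* c) :* (e :* e) :* (M :* M) :* (b :* f)) refl a b c₅ e f M ⟩
        (a * a) * (a * a) * (b * b) * (c₅ * c₅) * (e * e) * (M * M) * (b * f)
          ≈⟨ trans (*-congʳ (ones a² a² b² c² e² M²)) (*-identityˡ _) ⟩
        b * f ∎
        where
        _⊗_ : ∀ {x y} → x ≈ 1# → y ≈ 1# → x * y ≈ 1#
        x≈1 ⊗ y≈1 = trans (*-cong x≈1 y≈1) (*-identityˡ 1#)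
        ones : ∀ {u v w x y z} → u ≈ 1# → v ≈ 1# → w ≈ 1# → x ≈ 1# → y ≈ 1# → z ≈ 1# →
          u * v * w * x * y * z ≈ 1#
        ones u v w x y z = ((((u ⊗ v) ⊗ w) ⊗ x) ⊗ y) ⊗ z

-- Quadratic extensions, Gauss sums and the symbols of 2, 3 and 5

-- R[t] with t² = u t + v; the pair (a , b) stands for a + b t.
module QuadraticExtension {c ℓ} (R : CommutativeRing c ℓ) (u v : CommutativeRing.Carrier R) where
  open CommutativeRing R hiding (zero)
  open IntegerCoefficients R using (solve; _:=_; _:+_; _:*_; con)
  open SemiringMult semiring using () renaming (_×_ to _·_)
  open CommutativeSemiringExp commutativeSemiring using (_^_)

  extension : CommutativeRing c ℓ
  extension = record
    { Carrier = Carrier × Carrier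
    ; _≈_     = λ (a , b) (a′ , b′) → (a ≈ a′) × (b ≈ b′)
    ; _+_     = λ (a , b) (a′ , b′) → a + a′ , b + b′
    ; _*_     = λ (a , b) (a′ , b′) → a * a′ + v * (b * b′) , a * b′ + b * a′ + u * (b * b′)
    ; -_      = λ (a , b) → - a , - b
    ; 0#      = 0# , 0#
    ; 1#      = 1# , 0#
    ; isCommutativeRing = record
      { isRing = record
        { +-isAbelianGroup = record
          { isGroup = record
            { isMonoid = record
              { isSemigroup = record
                { isMagma = record
                  { isEquivalence = record
                    { refl  = refl , refl
                    ; sym   = λ (p , q) → sym p , sym q
                    ; trans = λ (p , q) (p′ , q′) → trans p p′ , trans q q′
                    }
                  ; ∙-cong = λ (p , q) (p′ , q′) → +-cong p p′ , +-cong q q′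
                  }
                ; assoc = λ _ _ _ → +-assoc _ _ _ , +-assoc _ _ _
                }
              ; identity = (λ _ → +-identityˡ _ , +-identityˡ _) , (λ _ → +-identityʳ _ , +-identityʳ _)
              }
            ; inverse = (λ _ → -‿inverseˡ _ , -‿inverseˡ _) , (λ _ → -‿inverseʳ _ , -‿inverseʳ _)
            ; ⁻¹-cong = λ (p , q) → -‿cong p , -‿cong q
            }
          ; comm = λ _ _ → +-comm _ _ , +-comm _ _
          }
        ; *-cong = λ (p , q) (p′ , q′) →
            +-cong (*-cong p p′) (*-congˡ (*-cong q q′)) ,
            +-cong (+-cong (*-cong p q′) (*-cong q p′)) (*-congˡ (*-cong q q′))
        ; *-assoc = λ (a , b) (c , d) (e , f) →
            solve 8 (λ u v a b c d e f →
              (a :* c :+ v :* (b :* d)) :* e :+ v :* ((a :* d :+ b :* c :+ u :* (b :* d)) :* f) :=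
              a :* (c :* e :+ v :* (d :* f)) :+ v :* (b :* (c :* f :+ d :* e :+ u :* (d :* f))))
              refl u v a b c d e f ,
            solve 8 (λ u v a b c d e f →
              (a :* c :+ v :* (b :* d)) :* f :+ (a :* d :+ b :* c :+ u :* (b :* d)) :* e
                :+ u :* ((a :* d :+ b :* c :+ u :* (b :* d)) :* f) :=
              a :* (c :* f :+ d :* e :+ u :* (d :* f)) :+ b :* (c :* e :+ v :* (d :* f))
                :+ u :* (b :* (c :* f :+ d :* e :+ u :* (d :* f))))
              refl u v a b c d e f
        ; *-identity =
            (λ (a , b) →
              solve 3 (λ v a b → con 1ℤ :* a :+ v :* (con 0ℤ :* b) := a) refl v a b ,
              solve 3 (λ u a b → con 1ℤ :* b :+ con 0ℤ :* a :+ u :* (con 0ℤ :* b) := b) refl u a b) ,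
            (λ (a , b) →
              solve 3 (λ v a b → a :* con 1ℤ :+ v :* (b :* con 0ℤ) := a) refl v a b ,
              solve 3 (λ u a b → a :* con 0ℤ :+ b :* con 1ℤ :+ u :* (b :* con 0ℤ) := b) refl u a b)
        ; distrib =
            (λ (a , b) (c , d) (e , f) →
              solve 7 (λ v a b c d e f → a :* (c :+ e) :+ v :* (b :* (d :+ f)) :=
                a :* c :+ v :* (b :* d) :+ (a :* e :+ v :* (b :* f))) refl v a b c d e f ,
              solve 7 (λ u a b c d e f → a :* (d :+ f) :+ b :* (c :+ e) :+ u :* (b :* (d :+ f)) :=
                a :* d :+ b :* c :+ u :* (b :* d) :+ (a :* f :+ b :* e :+ u :* (b :* f))) refl u a b c d e f) ,
            (λ (a , b) (c , d) (e , f) →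
              solve 7 (λ v a b c d e f → (c :+ e) :* a :+ v :* ((d :+ f) :* b) :=
                c :* a :+ v :* (d :* b) :+ (e :* a :+ v :* (f :* b))) refl v a b c d e f ,
              solve 7 (λ u a b c d e f → (c :+ e) :* b :+ (d :+ f) :* a :+ u :* ((d :+ f) :* b) :=
                c :* b :+ d :* a :+ u :* (d :* b) :+ (e :* b :+ f :* a :+ u :* (f :* b))) refl u a b c d e f)
        }
      ; *-comm = λ (a , b) (c , d) →
          solve 5 (λ v a b c d → a :* c :+ v :* (b :* d) := c :* a :+ v :* (d :* b)) refl v a b c d ,
          solve 5 (λ u a b c d → a :* d :+ b :* c :+ u :* (b :* d) := c :* b :+ d :* a :+ u :* (d :* b)) refl u a b c d
      }
    }

  private module S = CommutativeRing extension
  open SemiringMult S.semiring using () renaming (_×_ to _·ₛ_)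
  open CommutativeSemiringExp S.commutativeSemiring using () renaming (_^_ to _^ₛ_; ^-congˡ to ^ₛ-congˡ)

  ι : Carrier → S.Carrier
  ι a = a , 0#

  ι-cong : ∀ {a b} → a ≈ b → ι a S.≈ ι b
  ι-cong a≈b = a≈b , refl

  ι-·1 : ∀ n → n ·ₛ S.1# S.≈ ι (n · 1#)
  ι-·1 zero    = S.refl
  ι-·1 (suc n) = S.trans (S.+-congˡ {S.1#} (ι-·1 n)) (refl , +-identityʳ 0#)

  ι-^ : ∀ a n → ι a ^ₛ n S.≈ ι (a ^ n)
  ι-^ a zero    = S.refl
  ι-^ a (suc n) = S.trans (S.*-congˡ {ι a} (ι-^ a n))
    ( solve 3 (λ v a b → a :* b :+ v :* (con 0ℤ :* con 0ℤ) := a :* b) refl v a (a ^ n)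
    , solve 3 (λ u a b → a :* con 0ℤ :+ con 0ℤ :* b :+ u :* (con 0ℤ :* con 0ℤ) := con 0ℤ) refl u a (a ^ n))

  *-ι : ∀ a b c → (a , b) S.* ι c S.≈ (a * c , b * c)
  *-ι a b c =
    solve 4 (λ v a b c → a :* c :+ v :* (b :* con 0ℤ) := a :* c) refl v a b c ,
    solve 4 (λ u a b c → a :* con 0ℤ :+ b :* c :+ u :* (b :* con 0ℤ) := b :* c) refl u a b c

  -- Powers of `n · 1` lie in the base ring and multiply the two coordinates separately, so an
  -- identity in the extension can be read in its first coordinate.
  descend : ∀ n e {a b x y} → (a , b) S.* (n ·ₛ S.1#) ^ₛ e S.≈ (x , y) → a * (n · 1#) ^ e ≈ x
  descend n e {a} {b} {x} {y} eq = proj₁ (S.trans (S.sym (S.trans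
    (S.*-congˡ {a , b} (S.trans (^ₛ-congˡ e (ι-·1 n)) (ι-^ (n · 1#) e))) (*-ι a b ((n · 1#) ^ e)))) eq)

-- Evaluating the p-th power of a Gauss sum g, first by Frobenius and then from g².
module GaussSum {c ℓ} (R : CommutativeRing c ℓ) where
  open CommutativeRing R hiding (zero)
  open AbelianGroupProperties +-abelianGroup
    using () renaming (x∙y⁻¹≈ε⇒x≈y to x-y≈0⇒x≈y)
  open CommutativeSemiringExp commutativeSemiring
  open SemiringMult semiring using () renaming (_×_ to _·_)
  open IntegerCoefficients R using (solve; _:=_; _:+_; _:*_; _:-_; :-_; con)
  open Frobenius R
  open RootsOfUnity R using (^-double; 1^n≈1)
  open SetoidReasoning setoid

  periodic : ∀ {ζ} q r k → ζ ^ q ≈ 1# → ζ ^ (r ℕ.+ k ℕ.* q) ≈ ζ ^ r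
  periodic {ζ} q r k ζ^q≈1 = begin
    ζ ^ (r ℕ.+ k ℕ.* q)         ≈⟨ ^-homo-* ζ r (k ℕ.* q) ⟩
    ζ ^ r * ζ ^ (k ℕ.* q)       ≡⟨ ≡.cong (λ e → ζ ^ r * ζ ^ e) (ℕ.*-comm k q) ⟩
    ζ ^ r * ζ ^ (q ℕ.* k)       ≈⟨ *-congˡ (^-assocʳ ζ q k) ⟨
    ζ ^ r * (ζ ^ q) ^ k         ≈⟨ *-congˡ (trans (^-congˡ k ζ^q≈1) (1^n≈1 k)) ⟩
    ζ ^ r * 1#                  ≈⟨ *-identityʳ _ ⟩
    ζ ^ r                       ∎

  module _ (m : ℕ) (prime : Prime (suc (m ℕ.* 2))) (p·1≈0 : suc (m ℕ.* 2) · 1# ≈ 0#) where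
    private
      p : ℕ
      p = suc (m ℕ.* 2)

      _⊹_ : ∀ x y → (x + y) ^ p ≈ x ^ p + y ^ p
      _⊹_ = frobenius-+ prime p·1≈0

    power-by-square : ∀ g → g ^ p ≈ g * (g * g) ^ m
    power-by-square g = *-congˡ (trans (^-double g m) (sym (^-distrib-* g g m)))

    2T+1-power : ∀ T → (T + T + 1#) ^ p ≈ T ^ p + T ^ p + 1#
    2T+1-power T = trans ((T + T) ⊹ 1#) (+-cong (T ⊹ T) (1^n≈1 p))

    module _ {i} (i² : i * i ≈ - 1#) where

      -- The Gauss sum is `1 + i`, with square `2i`. Frobenius sends it to `1 + i ^ p`, where
      -- `i ^ p = i (i²) ^ m`.
      two : (1# + i) * (2 · 1#) ^ m * i ^ m ≈ 1# + i * (- 1#) ^ m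
      two = begin
        (1# + i) * (2 · 1#) ^ m * i ^ m        ≈⟨ *-assoc _ _ _ ⟩
        (1# + i) * ((2 · 1#) ^ m * i ^ m)      ≈⟨ *-congˡ (^-distrib-* (2 · 1#) i m) ⟨
        (1# + i) * (2 · 1# * i) ^ m            ≈⟨ *-congˡ (^-congˡ m square) ⟨
        (1# + i) * ((1# + i) * (1# + i)) ^ m   ≈⟨ power-by-square (1# + i) ⟨
        (1# + i) ^ p                           ≈⟨ 1# ⊹ i ⟩
        1# ^ p + i ^ p                         ≈⟨ +-cong (1^n≈1 p) (trans (power-by-square i) (*-congˡ (^-congˡ m i²))) ⟩
        1# + i * (- 1#) ^ m                    ∎
        where
        square : (1# + i) * (1# + i) ≈ 2 · 1# * i
        square = begin
          (1# + i) * (1# + i)                 ≈⟨ solve 1 (λ i → (con 1ℤ :+ i) :* (con 1ℤ :+ i) := con 1ℤ :+ (i :+ i) :+ i :* i) refl i ⟩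
          1# + (i + i) + i * i                ≈⟨ +-congˡ i² ⟩
          1# + (i + i) + - 1#                 ≈⟨ solve 1 (λ i → con 1ℤ :+ (i :+ i) :+ :- con 1ℤ := (con 1ℤ :+ (con 1ℤ :+ con 0ℤ)) :* i) refl i ⟩
          2 · 1# * i                          ∎

    module _ {ω} (ω²+ω+1 : ω * ω + ω + 1# ≈ 0#) where
      private g = ω + ω + 1#

      ω²≈ : ω * ω ≈ - ω - 1#
      ω²≈ = x-y≈0⇒x≈y _ _ (trans
        (solve 1 (λ w → w :* w :- (:- w :- con 1ℤ) := w :* w :+ w :+ con 1ℤ) refl ω) ω²+ω+1)

      ω³≈1 : ω ^ 3 ≈ 1#
      ω³≈1 = x-y≈0⇒x≈y _ _ (begin
        ω ^ 3 - 1#                        ≈⟨ solve 1 (λ w → w :* (w :* (w :* con 1ℤ)) :- con 1ℤ := (w :- con 1ℤ) :* (w :* w :+ w :+ con 1ℤ)) refl ω ⟩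
        (ω - 1#) * (ω * ω + ω + 1#)       ≈⟨ trans (*-congˡ ω²+ω+1) (zeroʳ _) ⟩
        0#                                ∎)

      g²≈-3 : g * g ≈ - 1# * 3 · 1#
      g²≈-3 = x-y≈0⇒x≈y _ _ (begin
        g * g - - 1# * 3 · 1#
          ≈⟨ solve 1 (λ w → (w :+ w :+ con 1ℤ) :* (w :+ w :+ con 1ℤ) :- (:- con 1ℤ) :* (con 1ℤ :+ (con 1ℤ :+ (con 1ℤ :+ con 0ℤ)))
               := (con 1ℤ :+ con 1ℤ :+ con 1ℤ :+ con 1ℤ) :* (w :* w :+ w :+ con 1ℤ)) refl ω ⟩
        (1# + 1# + 1# + 1#) * (ω * ω + ω + 1#)   ≈⟨ trans (*-congˡ ω²+ω+1) (zeroʳ _) ⟩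
        0#                                ∎)

      -- `g² = -3`, and the sign is absorbed by `(-1) ^ m = 1`.
      three : (- 1#) ^ m ≈ 1# → g * (3 · 1#) ^ m ≈ g ^ p
      three -1^m≈1 = begin
        g * (3 · 1#) ^ m                      ≈⟨ *-congˡ (*-identityˡ _) ⟨
        g * (1# * (3 · 1#) ^ m)               ≈⟨ *-congˡ (*-congʳ -1^m≈1) ⟨
        g * ((- 1#) ^ m * (3 · 1#) ^ m)       ≈⟨ *-congˡ (^-distrib-* (- 1#) (3 · 1#) m) ⟨
        g * (- 1# * 3 · 1#) ^ m               ≈⟨ *-congˡ (^-congˡ m g²≈-3) ⟨
        g * (g * g) ^ m                       ≈⟨ power-by-square g ⟨
        g ^ p                                 ∎

      three-1 : ∀ k → p ≡ 1 ℕ.+ k ℕ.* 3 → g ^ p ≈ g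
      three-1 k p≡ = trans (2T+1-power ω) (+-congʳ (+-cong ω^p ω^p))
        where ω^p = trans (^-congʳ ω p≡) (trans (periodic 3 1 k ω³≈1) (*-identityʳ ω))

      -- Frobenius sends `ω` to the conjugate `ω² = -ω - 1`, which reverses the sign of `2ω + 1`.
      three-2 : ∀ k → p ≡ 2 ℕ.+ k ℕ.* 3 → g ^ p ≈ - g
      three-2 k p≡ = trans (2T+1-power ω) (trans (+-congʳ (+-cong ω^p ω^p))
        (solve 1 (λ w → (:- w :- con 1ℤ) :+ (:- w :- con 1ℤ) :+ con 1ℤ := :- (w :+ w :+ con 1ℤ)) refl ω))
        where ω^p = trans (^-congʳ ω p≡) (trans (periodic 3 2 k ω³≈1) (trans (*-congˡ (*-identityʳ ω)) ω²≈))

    -- Under e₁ and e₂, ζ is a primitive fifth root of unity and T = ζ + ζ⁻¹; the cofactors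
    -- below come from reducing by e₁ and then by e₂.
    module _ {ζ T} (e₁ : ζ * ζ - T * ζ + 1# ≈ 0#) (e₂ : T * T + T - 1# ≈ 0#) where
      private g = T + T + 1#

      combination : ∀ {x y} a b → x - y ≈ a * (ζ * ζ - T * ζ + 1#) + b * (T * T + T - 1#) → x ≈ y
      combination a b eq = x-y≈0⇒x≈y _ _ (trans eq (trans
        (+-cong (trans (*-congˡ e₁) (zeroʳ a)) (trans (*-congˡ e₂) (zeroʳ b))) (+-identityˡ 0#)))

      ζ⁵≈1 : ζ ^ 5 ≈ 1#
      ζ⁵≈1 = combination ((ζ - 1#) * (ζ * ζ + (1# + T) * ζ + 1#)) ((ζ - 1#) * (ζ * ζ))
        (solve 2 (λ z t → z :* (z :* (z :* (z :* (z :* con 1ℤ)))) :- con 1ℤ :=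
          (z :- con 1ℤ) :* (z :* z :+ (con 1ℤ :+ t) :* z :+ con 1ℤ) :* (z :* z :- t :* z :+ con 1ℤ)
          :+ (z :- con 1ℤ) :* (z :* z) :* (t :* t :+ t :- con 1ℤ)) refl ζ T)

      ζ+ζ⁴≈T : ζ + ζ ^ 4 ≈ T
      ζ+ζ⁴≈T = combination (ζ * ζ + T * ζ + T * T - 1#) ((T - 1#) * ζ - 1#)
        (solve 2 (λ z t → z :+ z :* (z :* (z :* (z :* con 1ℤ))) :- t :=
          (z :* z :+ t :* z :+ t :* t :- con 1ℤ) :* (z :* z :- t :* z :+ con 1ℤ)
          :+ ((t :- con 1ℤ) :* z :- con 1ℤ) :* (t :* t :+ t :- con 1ℤ)) refl ζ T)

      ζ²+ζ³≈ : ζ ^ 2 + ζ ^ 3 ≈ - T - 1#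
      ζ²+ζ³≈ = combination (1# + ζ + T) ζ
        (solve 2 (λ z t → z :* (z :* con 1ℤ) :+ z :* (z :* (z :* con 1ℤ)) :- (:- t :- con 1ℤ) :=
          (con 1ℤ :+ z :+ t) :* (z :* z :- t :* z :+ con 1ℤ)
          :+ z :* (t :* t :+ t :- con 1ℤ)) refl ζ T)

      g²≈5 : g * g ≈ 5 · 1#
      g²≈5 = combination 0# (1# + 1# + 1# + 1#)
        (solve 2 (λ z t → (t :+ t :+ con 1ℤ) :* (t :+ t :+ con 1ℤ) :-
            (con 1ℤ :+ (con 1ℤ :+ (con 1ℤ :+ (con 1ℤ :+ (con 1ℤ :+ con 0ℤ))))) :=
          con 0ℤ :* (z :* z :- t :* z :+ con 1ℤ)
          :+ (con 1ℤ :+ con 1ℤ :+ con 1ℤ :+ con 1ℤ) :* (t :* t :+ t :- con 1ℤ)) refl ζ T)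

      five : g * (5 · 1#) ^ m ≈ g ^ p
      five = trans (*-congˡ (^-congˡ m (sym g²≈5))) (sym (power-by-square g))

      -- Writing `T` as `ζ + ζ⁴` lets Frobenius act on exponents, where only `p` modulo 5 matters.
      T^p : ∀ r k → p ≡ r ℕ.+ k ℕ.* 5 → T ^ p ≈ ζ ^ r + (ζ ^ r) ^ 4
      T^p r k p≡ = begin
        T ^ p                         ≈⟨ ^-congˡ p ζ+ζ⁴≈T ⟨
        (ζ + ζ ^ 4) ^ p               ≈⟨ ζ ⊹ (ζ ^ 4) ⟩
        ζ ^ p + (ζ ^ 4) ^ p           ≈⟨ +-congˡ (trans (^-assocʳ ζ 4 p) (trans (^-congʳ ζ (ℕ.*-comm 4 p)) (sym (^-assocʳ ζ p 4)))) ⟩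
        ζ ^ p + (ζ ^ p) ^ 4           ≈⟨ +-cong ζ^p (^-congˡ 4 ζ^p) ⟩
        ζ ^ r + (ζ ^ r) ^ 4           ∎
        where ζ^p = trans (^-congʳ ζ p≡) (periodic 5 r k ζ⁵≈1)

      residue : ∀ {r} k → p ≡ r ℕ.+ k ℕ.* 5 → ζ ^ r + (ζ ^ r) ^ 4 ≈ ζ + ζ ^ 4 → g ^ p ≈ g
      residue {r} k p≡ eq = trans (2T+1-power T) (+-congʳ (+-cong ≈T ≈T))
        where ≈T = trans (T^p r k p≡) (trans eq ζ+ζ⁴≈T)

      -- Here Frobenius sends `T` to `-T - 1`, the other root of `T² + T - 1`, so `2T + 1` changes
      -- sign.
      nonresidue : ∀ {r} k → p ≡ r ℕ.+ k ℕ.* 5 → ζ ^ r + (ζ ^ r) ^ 4 ≈ ζ ^ 2 + ζ ^ 3 → g ^ p ≈ - g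
      nonresidue {r} k p≡ eq = trans (2T+1-power T) (trans (+-congʳ (+-cong ≈T′ ≈T′))
        (solve 1 (λ t → (:- t :- con 1ℤ) :+ (:- t :- con 1ℤ) :+ con 1ℤ := :- (t :+ t :+ con 1ℤ)) refl T))
        where ≈T′ = trans (T^p r k p≡) (trans eq ζ²+ζ³≈)

      five-1 : ∀ k → p ≡ 1 ℕ.+ k ℕ.* 5 → g ^ p ≈ g
      five-1 k p≡ = residue {1} k p≡ (+-cong (*-identityʳ ζ) (^-congˡ 4 (*-identityʳ ζ)))

      five-4 : ∀ k → p ≡ 4 ℕ.+ k ℕ.* 5 → g ^ p ≈ g
      five-4 k p≡ = residue {4} k p≡ (trans (+-congˡ (trans (^-assocʳ ζ 4 4)
        (trans (periodic 5 1 3 ζ⁵≈1) (*-identityʳ ζ)))) (+-comm _ _))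

      five-2 : ∀ k → p ≡ 2 ℕ.+ k ℕ.* 5 → g ^ p ≈ - g
      five-2 k p≡ = nonresidue {2} k p≡ (+-congˡ (trans (^-assocʳ ζ 2 4) (periodic 5 3 1 ζ⁵≈1)))

      five-3 : ∀ k → p ≡ 3 ℕ.+ k ℕ.* 5 → g ^ p ≈ - g
      five-3 k p≡ = nonresidue {3} k p≡ (trans (+-congˡ (trans (^-assocʳ ζ 3 4) (periodic 5 2 2 ζ⁵≈1))) (+-comm _ _))

module Supplements {c ℓ} (R : CommutativeRing c ℓ) where
  open CommutativeRing R hiding (zero)
  open CommutativeSemiringExp commutativeSemiring
  open SemiringMult semiring using () renaming (_×_ to _·_)
  open IntegerCoefficients R using (solve; _:=_; _:+_; _:*_; :-_; con)

  -- 0# + 0# + 1# is the first coordinate of T + T + 1 for T = (0# , 1#).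
  unit-coordinate : ∀ {x y} → (0# + 0# + 1#) * x ≈ y → x ≈ y
  unit-coordinate eq = trans (solve 1 (λ x → x := (con 0ℤ :+ con 0ℤ :+ con 1ℤ) :* x) refl _) eq

  ≈1 : 0# + 0# + 1# ≈ 1#
  ≈1 = solve 0 (con 0ℤ :+ con 0ℤ :+ con 1ℤ := con 1ℤ) refl

  module _ (h m : ℕ) (m≡ : m ≡ h ℕ.* 2) (prime : Prime (suc (m ℕ.* 2)))
    (p·1≈0 : suc (m ℕ.* 2) · 1# ≈ 0#) where

    module Two where
      open QuadraticExtension R 0# (- 1#)
      module S = CommutativeRing extension
      open GaussSum extension
      open RootsOfUnity extension using (-1^even)
      module E = CommutativeSemiringExp S.commutativeSemiring

      i : S.Carrier
      i = 0# , 1#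

      i² : i S.* i S.≈ S.- S.1#
      i² = solve 0 (con 0ℤ :* con 0ℤ :+ (:- con 1ℤ) :* (con 1ℤ :* con 1ℤ) := :- con 1ℤ) refl
         , solve 0 (con 0ℤ :* con 1ℤ :+ con 1ℤ :* con 0ℤ :+ con 0ℤ :* (con 1ℤ :* con 1ℤ) := :- con 0ℤ) refl

      -- For even `h` both `i ^ m = (-1) ^ h` and `(-1) ^ m` are one, which leaves
      -- `(1 + i) 2 ^ m = 1 + i`; its first coordinate is the claim.
      [2/p]≈1 : ∀ t → h ≡ t ℕ.* 2 → (2 · 1#) ^ m ≈ 1#
      [2/p]≈1 t h≡ = trans (solve 1 (λ x → x := (con 1ℤ :+ con 0ℤ) :* x) refl _)
        (trans (descend 2 m eq) (+-identityʳ 1#))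
        where
        open SetoidReasoning S.setoid
        1+i = S.1# S.+ i

        i^m : i E.^ m S.≈ S.1#
        i^m = begin
          i E.^ m                     ≈⟨ E.^-congʳ i (≡.trans m≡ (ℕ.*-comm h 2)) ⟩
          i E.^ (2 ℕ.* h)             ≈⟨ E.^-assocʳ i 2 h ⟨
          (i E.^ 2) E.^ h             ≈⟨ E.^-congˡ h (S.trans (S.*-congˡ {i} (S.*-identityʳ i)) i²) ⟩
          (S.- S.1#) E.^ h            ≈⟨ E.^-congʳ (S.- S.1#) h≡ ⟩
          (S.- S.1#) E.^ (t ℕ.* 2)    ≈⟨ -1^even t ⟩
          S.1#                        ∎

        eq : 1+i S.* (SemiringMult._×_ S.semiring 2 S.1#) E.^ m S.≈ 1+i
        eq = begin
          1+i S.* (SemiringMult._×_ S.semiring 2 S.1#) E.^ m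
            ≈⟨ S.*-identityʳ _ ⟨
          1+i S.* (SemiringMult._×_ S.semiring 2 S.1#) E.^ m S.* S.1#
            ≈⟨ S.*-congˡ i^m ⟨
          1+i S.* (SemiringMult._×_ S.semiring 2 S.1#) E.^ m S.* i E.^ m
            ≈⟨ two m prime (S.trans (ι-·1 (suc (m ℕ.* 2))) (ι-cong p·1≈0)) i² ⟩
          S.1# S.+ i S.* (S.- S.1#) E.^ m
            ≈⟨ S.+-congˡ (S.*-congˡ {i} (S.trans (E.^-congʳ (S.- S.1#) m≡) (-1^even h))) ⟩
          S.1# S.+ i S.* S.1#
            ≈⟨ S.+-congˡ (S.*-identityʳ i) ⟩
          1+i ∎

    module Three where
      open QuadraticExtension R (- 1#) (- 1#)
      module S = CommutativeRing extension
      open GaussSum extension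
      open RootsOfUnity extension using (-1^even)
      module E = CommutativeSemiringExp S.commutativeSemiring

      ω : S.Carrier
      ω = 0# , 1#

      ω²+ω+1 : ω S.* ω S.+ ω S.+ S.1# S.≈ S.0#
      ω²+ω+1 = solve 0 (con 0ℤ :* con 0ℤ :+ (:- con 1ℤ) :* (con 1ℤ :* con 1ℤ) :+ con 0ℤ :+ con 1ℤ := con 0ℤ) refl
             , solve 0 (con 0ℤ :* con 1ℤ :+ con 1ℤ :* con 0ℤ :+ (:- con 1ℤ) :* (con 1ℤ :* con 1ℤ) :+ con 1ℤ :+ con 0ℤ := con 0ℤ) refl

      p·1ₛ≈0 = S.trans (ι-·1 (suc (m ℕ.* 2))) (ι-cong p·1≈0)

      3^m = three m prime p·1ₛ≈0 ω²+ω+1 (S.trans (E.^-congʳ (S.- S.1#) m≡) (-1^even h))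

      [3/p]≈1 : ∀ k → suc (m ℕ.* 2) ≡ 1 ℕ.+ k ℕ.* 3 → (3 · 1#) ^ m ≈ 1#
      [3/p]≈1 k p≡ = trans (unit-coordinate
        (descend 3 m (S.trans 3^m (three-1 m prime p·1ₛ≈0 ω²+ω+1 k p≡)))) ≈1

      [3/p]≈-1 : ∀ k → suc (m ℕ.* 2) ≡ 2 ℕ.+ k ℕ.* 3 → (3 · 1#) ^ m ≈ - 1#
      [3/p]≈-1 k p≡ = trans (unit-coordinate
        (descend 3 m (S.trans 3^m (three-2 m prime p·1ₛ≈0 ω²+ω+1 k p≡)))) (-‿cong ≈1)

    module Five where
      -- A fifth root of unity is reached by two quadratic steps: `T² = -T + 1` first, then
      -- `ζ² = T ζ - 1` over it.
      module Q₁ = QuadraticExtension R (- 1#) 1#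
      module S₁ = CommutativeRing Q₁.extension

      T₁ : S₁.Carrier
      T₁ = 0# , 1#

      module Q₂ = QuadraticExtension Q₁.extension T₁ (S₁.- S₁.1#)
      module S₂ = CommutativeRing Q₂.extension
      open GaussSum Q₂.extension

      ζ T g : S₂.Carrier
      ζ = S₁.0# , S₁.1#
      T = T₁ , S₁.0#
      g = T S₂.+ T S₂.+ S₂.1#

      module E = CommutativeSemiringExp S₂.commutativeSemiring

      T₁²+T₁-1 : T₁ S₁.* T₁ S₁.+ T₁ S₁.- S₁.1# S₁.≈ S₁.0#
      T₁²+T₁-1 =
          solve 0 (con 0ℤ :* con 0ℤ :+ con 1ℤ :* (con 1ℤ :* con 1ℤ) :+ con 0ℤ :+ :- con 1ℤ := con 0ℤ) refl
        , solve 0 (con 0ℤ :* con 1ℤ :+ con 1ℤ :* con 0ℤ :+ (:- con 1ℤ) :* (con 1ℤ :* con 1ℤ) :+ con 1ℤ :+ :- con 0ℤ := con 0ℤ) refl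

      module I₁ = IntegerCoefficients Q₁.extension

      e₁ : ζ S₂.* ζ S₂.- T S₂.* ζ S₂.+ S₂.1# S₂.≈ S₂.0#
      e₁ = I₁.solve 1 (λ t → con₁ 0ℤ ⊗ con₁ 0ℤ ⊕ (⊝ con₁ 1ℤ) ⊗ (con₁ 1ℤ ⊗ con₁ 1ℤ)
               ⊕ ⊝ (t ⊗ con₁ 0ℤ ⊕ (⊝ con₁ 1ℤ) ⊗ (con₁ 0ℤ ⊗ con₁ 1ℤ)) ⊕ con₁ 1ℤ I₁.:= con₁ 0ℤ) S₁.refl T₁
         , I₁.solve 1 (λ t → con₁ 0ℤ ⊗ con₁ 1ℤ ⊕ con₁ 1ℤ ⊗ con₁ 0ℤ ⊕ t ⊗ (con₁ 1ℤ ⊗ con₁ 1ℤ)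
               ⊕ ⊝ (t ⊗ con₁ 1ℤ ⊕ con₁ 0ℤ ⊗ con₁ 0ℤ ⊕ t ⊗ (con₁ 0ℤ ⊗ con₁ 1ℤ)) ⊕ con₁ 0ℤ I₁.:= con₁ 0ℤ) S₁.refl T₁
        where open I₁ using () renaming (_:+_ to _⊕_; _:*_ to _⊗_; :-_ to ⊝_; con to con₁)

      e₂ : T S₂.* T S₂.+ T S₂.- S₂.1# S₂.≈ S₂.0#
      e₂ = S₁.trans (I₁.solve 1 (λ t → t ⊗ t ⊕ (⊝ con₁ 1ℤ) ⊗ (con₁ 0ℤ ⊗ con₁ 0ℤ) ⊕ t ⊕ ⊝ con₁ 1ℤ
               I₁.:= t ⊗ t ⊕ t ⊕ ⊝ con₁ 1ℤ) S₁.refl T₁) T₁²+T₁-1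
         , I₁.solve 1 (λ t → t ⊗ con₁ 0ℤ ⊕ con₁ 0ℤ ⊗ t ⊕ t ⊗ (con₁ 0ℤ ⊗ con₁ 0ℤ) ⊕ con₁ 0ℤ ⊕ ⊝ con₁ 0ℤ
               I₁.:= con₁ 0ℤ) S₁.refl T₁
        where open I₁ using () renaming (_:+_ to _⊕_; _:*_ to _⊗_; :-_ to ⊝_; con to con₁)

      p·1ₛ≈0 = S₂.trans (Q₂.ι-·1 (suc (m ℕ.* 2)))
        (Q₂.ι-cong (S₁.trans (Q₁.ι-·1 (suc (m ℕ.* 2))) (Q₁.ι-cong p·1≈0)))

      5^m = five m prime p·1ₛ≈0 e₁ e₂

      Residue Nonresidue : ℕ → Set
      Residue p    = ∃[ k ] (p ≡ 1 ℕ.+ k ℕ.* 5 ⊎ p ≡ 4 ℕ.+ k ℕ.* 5)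
      Nonresidue p = ∃[ k ] (p ≡ 2 ℕ.+ k ℕ.* 5 ⊎ p ≡ 3 ℕ.+ k ℕ.* 5)

      -- The first coordinate of `g` is `2T + 1` in the lower extension, and the first coordinate of
      -- that is one; hence two descents.
      [5/p]≈1 : Residue (suc (m ℕ.* 2)) → (5 · 1#) ^ m ≈ 1#
      [5/p]≈1 (k , p≡) = trans (unit-coordinate
        (Q₁.descend 5 m (Q₂.descend 5 m (S₂.trans 5^m (power p≡))))) ≈1
        where
        power : suc (m ℕ.* 2) ≡ 1 ℕ.+ k ℕ.* 5 ⊎ suc (m ℕ.* 2) ≡ 4 ℕ.+ k ℕ.* 5 → g E.^ suc (m ℕ.* 2) S₂.≈ g
        power = Sum.[ five-1 m prime p·1ₛ≈0 e₁ e₂ k , five-4 m prime p·1ₛ≈0 e₁ e₂ k ]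

      [5/p]≈-1 : Nonresidue (suc (m ℕ.* 2)) → (5 · 1#) ^ m ≈ - 1#
      [5/p]≈-1 (k , p≡) = trans (unit-coordinate
        (Q₁.descend 5 m (Q₂.descend 5 m (S₂.trans 5^m (power p≡))))) (-‿cong ≈1)
        where
        power : suc (m ℕ.* 2) ≡ 2 ℕ.+ k ℕ.* 5 ⊎ suc (m ℕ.* 2) ≡ 3 ℕ.+ k ℕ.* 5 → g E.^ suc (m ℕ.* 2) S₂.≈ S₂.- g
        power = Sum.[ five-2 m prime p·1ₛ≈0 e₁ e₂ k , five-3 m prime p·1ₛ≈0 e₁ e₂ k ]

-- Integers modulo n, and Fermat's little theorem

module ModularRing (n : ℕ) where

  infix 4 _≈_
  -- A wrapper around _≡_[mod_] from which the two integers can be inferred.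
  record _≈_ (a b : ℤ) : Set where
    constructor mod
    field congruent : a ≡ b [mod n ]
  open _≈_ public

  ≡⇒≈ : ∀ {a b} → a ≡ b → a ≈ b
  ≡⇒≈ {a} ≡.refl = mod (ℤ.divides 0ℤ (ℤ.+-inverseʳ a))

  ≈-sym : ∀ {a b} → a ≈ b → b ≈ a
  ≈-sym {a} {b} (mod a≈b) = mod (≡.subst (+ n ℤ.∣_) (negate a b) (ℤ.∣m⇒∣-m a≈b))
    where
    negate : ∀ a b → ℤ.- (a ℤ.- b) ≡ b ℤ.- a
    negate = ℤ.solve-∀

  ≈-trans : ∀ {a b c} → a ≈ b → b ≈ c → a ≈ c
  ≈-trans {a} {b} {c} (mod a≈b) (mod b≈c) = mod (≡.subst (+ n ℤ.∣_) (telescope a b c) (ℤ.∣m∣n⇒∣m+n a≈b b≈c))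
    where
    telescope : ∀ a b c → (a ℤ.- b) ℤ.+ (b ℤ.- c) ≡ a ℤ.- c
    telescope = ℤ.solve-∀

  +-cong : ∀ {a b c d} → a ≈ b → c ≈ d → a ℤ.+ c ≈ b ℤ.+ d
  +-cong {a} {b} {c} {d} (mod a≈b) (mod c≈d) = mod (≡.subst (+ n ℤ.∣_) (regroup a b c d) (ℤ.∣m∣n⇒∣m+n a≈b c≈d))
    where
    regroup : ∀ a b c d → (a ℤ.- b) ℤ.+ (c ℤ.- d) ≡ (a ℤ.+ c) ℤ.- (b ℤ.+ d)
    regroup = ℤ.solve-∀

  *-cong : ∀ {a b c d} → a ≈ b → c ≈ d → a ℤ.* c ≈ b ℤ.* d
  *-cong {a} {b} {c} {d} (mod a≈b) (mod c≈d) = mod (≡.subst (+ n ℤ.∣_) (regroup a b c d)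
    (ℤ.∣m∣n⇒∣m+n (ℤ.∣m⇒∣m*n c a≈b) (ℤ.∣n⇒∣m*n b c≈d)))
    where
    regroup : ∀ a b c d → (a ℤ.- b) ℤ.* c ℤ.+ b ℤ.* (c ℤ.- d) ≡ a ℤ.* c ℤ.- b ℤ.* d
    regroup = ℤ.solve-∀

  -‿cong : ∀ {a b} → a ≈ b → ℤ.- a ≈ ℤ.- b
  -‿cong {a} {b} (mod a≈b) = mod (≡.subst (+ n ℤ.∣_) (regroup a b) (ℤ.∣m⇒∣-m a≈b))
    where
    regroup : ∀ a b → ℤ.- (a ℤ.- b) ≡ ℤ.- a ℤ.- ℤ.- b
    regroup = ℤ.solve-∀

  -- The carrier stays ℤ and only equality is coarsened, so integer expressions pass to the quotient
  -- unchanged.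
  modularRing : CommutativeRing 0ℓ 0ℓ
  modularRing = record
    { Carrier = ℤ
    ; _≈_     = _≈_
    ; _+_     = ℤ._+_
    ; _*_     = ℤ._*_
    ; -_      = ℤ.-_
    ; 0#      = 0ℤ
    ; 1#      = 1ℤ
    ; isCommutativeRing = record
      { isRing = record
        { +-isAbelianGroup = record
          { isGroup = record
            { isMonoid = record
              { isSemigroup = record
                { isMagma = record
                  { isEquivalence = record { refl = ≡⇒≈ ≡.refl ; sym = ≈-sym ; trans = ≈-trans }
                  ; ∙-cong        = +-cong
                  }
                ; assoc = λ a b c → ≡⇒≈ (ℤ.+-assoc a b c)
                }
              ; identity = (λ a → ≡⇒≈ (ℤ.+-identityˡ a)) , (λ a → ≡⇒≈ (ℤ.+-identityʳ a))
              }
            ; inverse = (λ a → ≡⇒≈ (ℤ.+-inverseˡ a)) , (λ a → ≡⇒≈ (ℤ.+-inverseʳ a))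
            ; ⁻¹-cong = -‿cong
            }
          ; comm = λ a b → ≡⇒≈ (ℤ.+-comm a b)
          }
        ; *-cong     = *-cong
        ; *-assoc    = λ a b c → ≡⇒≈ (ℤ.*-assoc a b c)
        ; *-identity = (λ a → ≡⇒≈ (ℤ.*-identityˡ a)) , (λ a → ≡⇒≈ (ℤ.*-identityʳ a))
        ; distrib    = (λ a b c → ≡⇒≈ (ℤ.*-distribˡ-+ a b c)) , (λ a b c → ≡⇒≈ (ℤ.*-distribʳ-+ a b c))
        }
      ; *-comm = λ a b → ≡⇒≈ (ℤ.*-comm a b)
      }
    }

  open CommutativeSemiringExp (CommutativeRing.commutativeSemiring modularRing) public
    using (_^_; ^-congˡ; ^-congʳ; ^-distrib-*)
  open QuadraticCharacter modularRing using (⟦_⟧)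

  ≈0⇒∣ : ∀ {a} → a ≈ 0ℤ → + n ℤ.∣ a
  ≈0⇒∣ {a} (mod a≈0) = ≡.subst (+ n ℤ.∣_) (ℤ.+-identityʳ a) a≈0

  ∣⇒≈0 : ∀ {a} → + n ℤ.∣ a → a ≈ 0ℤ
  ∣⇒≈0 {a} n∣a = mod (≡.subst (+ n ℤ.∣_) (≡.sym (ℤ.+-identityʳ a)) n∣a)

  ⟦⟧≡ : ∀ k → ⟦ k ⟧ ≡ + k
  ⟦⟧≡ zero    = ≡.refl
  ⟦⟧≡ (suc k) = ≡.cong (λ z → 1ℤ ℤ.+ z) (⟦⟧≡ k)

  char : ∀ k → ⟦ k ⟧ ≈ 0ℤ → n ℕ.∣ k
  char k k≈0 = ℤ.∣⇒∣ᵤ (≡.subst (+ n ℤ.∣_) (⟦⟧≡ k) (≈0⇒∣ k≈0))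

  n·1≈0 : ⟦ n ⟧ ≈ 0ℤ
  n·1≈0 = ∣⇒≈0 (≡.subst (+ n ℤ.∣_) (≡.sym (⟦⟧≡ n)) ℤ.∣-refl)

  ^≡ : ∀ x k → x ^ k ≡ x ℤ.^ k
  ^≡ x zero    = ≡.refl
  ^≡ x (suc k) = ≡.cong (x ℤ.*_) (^≡ x k)

  -- Since the operations of `modularRing` are those of ℤ, the two determinants are equal as
  -- integers and not merely congruent.
  det-modular : ∀ {m} (A : Fin m → Fin m → ℤ) → Defs.det A ≡ Determinant.det modularRing A
  det-modular {zero}  A = ≡.refl
  det-modular {suc m} A = SemiringSum.sum-cong-≋ ℤ.+-*-semiring {suc m}
    {λ j → -1ℤ ℤ.^ toℕ j ℤ.* A zero j ℤ.* Defs.det (λ i k → A (suc i) (punchIn j k))}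
    {Determinant.laplaceTerm modularRing A}
    λ j → ≡.cong₂ (λ ε d → ε ℤ.* A zero j ℤ.* d) (≡.sym (^≡ -1ℤ (toℕ j)))
      (det-modular (λ i k → A (suc i) (punchIn j k)))

module PrimeField {q : ℕ} (prime : Prime (suc q)) where
  private p = suc q
  open ModularRing p public
  open QuadraticCharacter modularRing using (⟦_⟧)
  open CommutativeRing modularRing using (sym; trans; zeroˡ)
  open AbelianGroupProperties (CommutativeRing.+-abelianGroup modularRing)
    using () renaming (x∙y⁻¹≈ε⇒x≈y to x-y≈0⇒x≈y; x≈y⇒x∙y⁻¹≈ε to x≈y⇒x-y≈0)

  integral : ∀ {x y} → x ℤ.* y ≈ 0ℤ → x ≈ 0ℤ ⊎ y ≈ 0ℤ
  integral {x} {y} xy≈0 = Sum.map to to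
    (euclidsLemma ∣ x ∣ ∣ y ∣ prime (≡.subst (p ℕ.∣_) (ℤ.abs-* x y) (ℤ.∣⇒∣ᵤ (≈0⇒∣ xy≈0))))
    where
    to : ∀ {x} → p ℕ.∣ ∣ x ∣ → x ≈ 0ℤ
    to p∣x = ∣⇒≈0 (ℤ.∣ᵤ⇒∣ p∣x)

  1≉0 : ¬ 1ℤ ≈ 0ℤ
  1≉0 1≈0 = ℕ.nonTrivial⇒≢1 {{prime⇒nonTrivial prime}} (ℕ.∣1⇒≡1 (ℤ.∣⇒∣ᵤ (≈0⇒∣ 1≈0)))

  -- Induction on `k`, with Frobenius applied to `1 + k`.
  ⟦k⟧^p≈⟦k⟧ : ∀ k → ⟦ k ⟧ ^ p ≈ ⟦ k ⟧
  ⟦k⟧^p≈⟦k⟧ zero    = zeroˡ (0ℤ ^ q)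
  ⟦k⟧^p≈⟦k⟧ (suc k) = trans (Frobenius.frobenius-+ modularRing prime n·1≈0 1ℤ ⟦ k ⟧)
    (+-cong (RootsOfUnity.1^n≈1 modularRing p) (⟦k⟧^p≈⟦k⟧ k))

  x^p≈x : ∀ x → x ^ p ≈ x
  x^p≈x x = trans (^-congˡ p x≈) (trans (⟦k⟧^p≈⟦k⟧ (x ℤ.%ℕ p)) (sym x≈))
    where
    cancel : ∀ r q → (r ℤ.+ q) ℤ.- r ≡ q
    cancel = ℤ.solve-∀
    x≈ : x ≈ ⟦ x ℤ.%ℕ p ⟧
    x≈ = mod (ℤ.divides (x ℤ./ℕ p) (≡.trans
      (≡.cong₂ ℤ._-_ (ℤ.a≡a%ℕn+[a/ℕn]*n x p) (⟦⟧≡ (x ℤ.%ℕ p)))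
      (cancel (+ (x ℤ.%ℕ p)) (x ℤ./ℕ p ℤ.* + p))))

  fermat : ∀ {x} → ¬ x ≈ 0ℤ → x ^ q ≈ 1ℤ
  fermat {x} x≉0 = Sum.[ (λ x≈0 → contradiction x≈0 x≉0) , x-y≈0⇒x≈y (x ^ q) 1ℤ ]′
    (integral {x} {x ^ q ℤ.- 1ℤ} (trans (≡⇒≈ (expand x (x ^ q))) (x≈y⇒x-y≈0 {x ℤ.* x ^ q} {x} (x^p≈x x))))
    where
    expand : ∀ x y → x ℤ.* (y ℤ.- 1ℤ) ≡ x ℤ.* y ℤ.- x
    expand = ℤ.solve-∀

-- Values of the Legendre symbol

legendre-cases : ∀ q a →
  (+ suc q ℤ.∣ a × legendre a (suc q) ≡ 0ℤ) ⊎
  (QuadraticResidue (suc q) a × legendre a (suc q) ≡ 1ℤ) ⊎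
  ((¬ + suc q ℤ.∣ a) × (¬ QuadraticResidue (suc q) a) × legendre a (suc q) ≡ -1ℤ)
legendre-cases q a = cases (+ suc q ℤ.∣? a) (quadraticResidue? (suc q) a)
  where
  -- Abstracting over both decisions lets the conditionals inside `legendre` reduce in each case.
  cases : (d : Dec (+ suc q ℤ.∣ a)) (e : Dec (QuadraticResidue (suc q) a)) →
    let l = if does d then 0ℤ else if does e then 1ℤ else -1ℤ in
    (+ suc q ℤ.∣ a × l ≡ 0ℤ) ⊎ (QuadraticResidue (suc q) a × l ≡ 1ℤ) ⊎
    ((¬ + suc q ℤ.∣ a) × (¬ QuadraticResidue (suc q) a) × l ≡ -1ℤ)
  cases (yes p∣a) _        = inj₁ (p∣a , ≡.refl)
  cases (no  _)   (yes qr) = inj₂ (inj₁ (qr , ≡.refl))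
  cases (no  p∤a) (no ¬qr) = inj₂ (inj₂ (p∤a , ¬qr , ≡.refl))

Small : ℤ → Set
Small x = x ≡ 0ℤ ⊎ x ≡ 1ℤ ⊎ x ≡ -1ℤ

legendre-small : ∀ q a → Small (legendre a (suc q))
legendre-small q a with legendre-cases q a
... | inj₁ (_ , eq)            = inj₁ eq
... | inj₂ (inj₁ (_ , eq))     = inj₂ (inj₁ eq)
... | inj₂ (inj₂ (_ , _ , eq)) = inj₂ (inj₂ eq)

-- Two of the numbers `0`, `1`, `-1` differ by at most 2. This turns the congruences of Euler's
-- criterion into equalities of symbols.
small-≡ : ∀ {p x y} → 2 ℕ.< p → Small x → Small y → x ≡ y [mod p ] → x ≡ y
small-≡ {p} {x} {y} 2<p x-small y-small x≡y = decidable-stable (x ℤ.≟ y) λ x≢y →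
  ℕ.<⇒≱ 2<p (ℕ.≤-trans (ℕ.∣⇒≤ {{ℕ.≢-nonZero (x≢y ∘ ℤ.i-j≡0⇒i≡j x y ∘ ℤ.∣i∣≡0⇒i≡0)}} (ℤ.∣⇒∣ᵤ x≡y))
    (difference x-small y-small))
  where
  difference : ∀ {x y} → Small x → Small y → ∣ x ℤ.- y ∣ ℕ.≤ 2
  difference (inj₁ ≡.refl)        (inj₁ ≡.refl)        = ℕ.≤ᵇ⇒≤ 0 2 _
  difference (inj₁ ≡.refl)        (inj₂ (inj₁ ≡.refl)) = ℕ.≤ᵇ⇒≤ 1 2 _
  difference (inj₁ ≡.refl)        (inj₂ (inj₂ ≡.refl)) = ℕ.≤ᵇ⇒≤ 1 2 _
  difference (inj₂ (inj₁ ≡.refl)) (inj₁ ≡.refl)        = ℕ.≤ᵇ⇒≤ 1 2 _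
  difference (inj₂ (inj₁ ≡.refl)) (inj₂ (inj₁ ≡.refl)) = ℕ.≤ᵇ⇒≤ 0 2 _
  difference (inj₂ (inj₁ ≡.refl)) (inj₂ (inj₂ ≡.refl)) = ℕ.≤ᵇ⇒≤ 2 2 _
  difference (inj₂ (inj₂ ≡.refl)) (inj₁ ≡.refl)        = ℕ.≤ᵇ⇒≤ 1 2 _
  difference (inj₂ (inj₂ ≡.refl)) (inj₂ (inj₁ ≡.refl)) = ℕ.≤ᵇ⇒≤ 2 2 _
  difference (inj₂ (inj₂ ≡.refl)) (inj₂ (inj₂ ≡.refl)) = ℕ.≤ᵇ⇒≤ 0 2 _

legendre-cong : ∀ q a b → a ≡ b [mod suc q ] → legendre a (suc q) ≡ legendre b (suc q)
legendre-cong q a b a≡b = compare (legendre-cases q a) (legendre-cases q b)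
  where
  open ModularRing (suc q)
  transfer-∣ : ∀ {a b} → a ≈ b → + suc q ℤ.∣ a → + suc q ℤ.∣ b
  transfer-∣ a≈b p∣a = ≈0⇒∣ (≈-trans (≈-sym a≈b) (∣⇒≈0 p∣a))
  transfer-QR : ∀ {a b} → a ≈ b → QuadraticResidue (suc q) a → QuadraticResidue (suc q) b
  transfer-QR {a} a≈b (p∤a , x , x²≡a) =
    p∤a ∘ transfer-∣ (≈-sym a≈b) , x , congruent (≈-trans (mod {x ℤ.* x} {a} x²≡a) a≈b)
  a≈b : a ≈ b
  a≈b = mod a≡b
  compare : ∀ {l l′} →
    (+ suc q ℤ.∣ a × l ≡ 0ℤ) ⊎ (QuadraticResidue (suc q) a × l ≡ 1ℤ) ⊎
    ((¬ + suc q ℤ.∣ a) × (¬ QuadraticResidue (suc q) a) × l ≡ -1ℤ) →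
    (+ suc q ℤ.∣ b × l′ ≡ 0ℤ) ⊎ (QuadraticResidue (suc q) b × l′ ≡ 1ℤ) ⊎
    ((¬ + suc q ℤ.∣ b) × (¬ QuadraticResidue (suc q) b) × l′ ≡ -1ℤ) →
    l ≡ l′
  compare (inj₁ (p∣a , eq)) (inj₁ (p∣b , qe)) = ≡.trans eq (≡.sym qe)
  compare (inj₁ (p∣a , eq)) (inj₂ (inj₁ ((p∤b , _) , qe))) = contradiction (transfer-∣ a≈b p∣a) p∤b
  compare (inj₁ (p∣a , eq)) (inj₂ (inj₂ (p∤b , _ , qe))) = contradiction (transfer-∣ a≈b p∣a) p∤b
  compare (inj₂ (inj₁ ((p∤a , _) , eq))) (inj₁ (p∣b , qe)) = contradiction (transfer-∣ (≈-sym a≈b) p∣b) p∤a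
  compare (inj₂ (inj₁ (qr , eq))) (inj₂ (inj₁ (rq , qe))) = ≡.trans eq (≡.sym qe)
  compare (inj₂ (inj₁ (qr , eq))) (inj₂ (inj₂ (_ , ¬rq , qe))) = contradiction (transfer-QR a≈b qr) ¬rq
  compare (inj₂ (inj₂ (p∤a , _ , eq))) (inj₁ (p∣b , qe)) = contradiction (transfer-∣ (≈-sym a≈b) p∣b) p∤a
  compare (inj₂ (inj₂ (_ , ¬qr , eq))) (inj₂ (inj₁ (rq , qe))) = contradiction (transfer-QR (≈-sym a≈b) rq) ¬qr
  compare (inj₂ (inj₂ (_ , _ , eq))) (inj₂ (inj₂ (_ , _ , qe))) = ≡.trans eq (≡.sym qe)

legendre-remainder : ∀ q r k {p} → p ≡ r ℕ.+ k ℕ.* suc q → legendre (+ p) (suc q) ≡ legendre (+ r) (suc q)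
legendre-remainder q r k ≡.refl = legendre-cong q (+ (r ℕ.+ k ℕ.* suc q)) (+ r) (ℤ.divides (+ k) (≡.trans
  (≡.cong (ℤ._- + r) (≡.trans (ℤ.pos-+ r (k ℕ.* suc q)) (≡.cong (ℤ._+_ (+ r)) (ℤ.pos-* k (suc q)))))
  (cancel (+ r) (+ k ℤ.* + suc q))))
  where
  cancel : ∀ r x → (r ℤ.+ x) ℤ.- r ≡ x
  cancel = ℤ.solve-∀

-- Euler's criterion

module EulerCriterion (m : ℕ) .{{_ : ℕ.NonZero m}} (prime : Prime (suc (m ℕ.* 2)))
  (α : Fin m → ℤ) (representatives : RepresentsQuadraticResidues (suc (m ℕ.* 2)) α) where

  private
    p : ℕ
    p = suc (m ℕ.* 2)
  open PrimeField prime public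
  open QuadraticCharacter modularRing using (⟦_⟧; module Character) public
  open Character integral m prime n·1≈0 char fermat public hiding (p)
  open RootsOfUnity modularRing using (Distinct; unity-complete; square-one)
  open RepresentsQuadraticResidues representatives
  open CommutativeRing modularRing using (sym; trans; reflexive)

  ∤⇒≉0 : ∀ {a} → ¬ + p ℤ.∣ a → ¬ a ≈ 0ℤ
  ∤⇒≉0 p∤a = p∤a ∘ ≈0⇒∣

  residue-unity : ∀ {a} → QuadraticResidue p a → a ^ m ≈ 1ℤ
  residue-unity {a} (p∤a , x , x²≡a) = trans (^-congˡ m (sym x²≈a))
    (trans (^-distrib-* x x m) (χ-involution x≉0))
    where
    x²≈a : x ℤ.* x ≈ a
    x²≈a = mod x²≡a
    x≉0 : ¬ x ≈ 0ℤ
    x≉0 x≈0 = ∤⇒≉0 p∤a (trans (sym x²≈a) (*-cong x≈0 x≈0))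

  α-distinct : Distinct α
  α-distinct i j (mod αᵢ≡αⱼ) = distinct i j αᵢ≡αⱼ

  α-unity : ∀ i → α i ^ m ≈ 1ℤ
  α-unity i = residue-unity (residue i)

  represented-residue : ∀ {a} → ∃[ i ] (α i ≈ a) → QuadraticResidue p a
  represented-residue {a} (i , αᵢ≈a) = transfer (residue i)
    where
    transfer : QuadraticResidue p (α i) → QuadraticResidue p a
    transfer (p∤αᵢ , x , x²≡αᵢ) =
      (λ p∣a → ∤⇒≉0 p∤αᵢ (trans αᵢ≈a (∣⇒≈0 p∣a))) , x , congruent (trans (mod {x ℤ.* x} {α i} x²≡αᵢ) αᵢ≈a)

  -- The `m` representatives are distinct roots of `x ^ m - 1`, hence all its roots, so `a` is
  -- congruent to one of them.
  unity-residue : ∀ {a} → a ^ m ≈ 1ℤ → QuadraticResidue p a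
  unity-residue {a} aᵐ≈1 = represented-residue (unity-complete integral α α-distinct α-unity 1≉0 a aᵐ≈1)

  -- For `a` prime to `p`, `a ^ m` is a square root of one, and the value one is taken at residues
  -- only.
  euler : ∀ a → legendre a p ≈ a ^ m
  euler a = cases (legendre-cases (m ℕ.* 2) a)
    where
    0^m : ∀ m .{{_ : ℕ.NonZero m}} → 0ℤ ^ m ≈ 0ℤ
    0^m (suc m) = CommutativeRing.zeroˡ modularRing (0ℤ ^ m)

    cases : ∀ {l} →
      (+ p ℤ.∣ a × l ≡ 0ℤ) ⊎ (QuadraticResidue p a × l ≡ 1ℤ) ⊎
      ((¬ + p ℤ.∣ a) × (¬ QuadraticResidue p a) × l ≡ -1ℤ) → l ≈ a ^ m
    cases (inj₁ (p∣a , ≡.refl)) = sym (trans (^-congˡ m (∣⇒≈0 p∣a)) (0^m m))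
    cases (inj₂ (inj₁ (qr , ≡.refl))) = sym (residue-unity qr)
    cases (inj₂ (inj₂ (p∤a , ¬qr , ≡.refl))) =
      Sum.[ (λ aᵐ≈1 → contradiction (unity-residue aᵐ≈1) ¬qr) , sym ]′
        (square-one integral (χ-involution (∤⇒≉0 p∤a)))

  X≈legendre : ∀ r → X r ≈ legendre (+ r) p
  X≈legendre r = trans (^-congˡ m (reflexive (⟦⟧≡ r))) (sym (euler (+ r)))

-- Counting the nonresidues below p/4

count : ∀ {P : ℕ → Set} → (∀ r → Dec (P r)) → ℕ → ℕ
count P? n = length (filter P? (upTo n))

module _ {P : ℕ → Set} (P? : ∀ r → Dec (P r)) where

  count-suc : ∀ n → count P? (suc n) ≡ count P? n ℕ.+ length (filter P? [ n ])
  count-suc n = ≡.trans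
    (≡.cong length (≡.trans (≡.cong (filter P?) (≡.sym (List.upTo-∷ʳ n))) (List.filter-++ P? (upTo n) [ n ])))
    (List.length-++ (filter P? (upTo n)))

  count-yes : ∀ n → P n → count P? (suc n) ≡ suc (count P? n)
  count-yes n Pn = ≡.trans (count-suc n) (≡.trans
    (≡.cong (λ l → count P? n ℕ.+ length l) (List.filter-accept P? {x = n} {xs = []} Pn)) (ℕ.+-comm (count P? n) 1))

  count-no : ∀ n → ¬ P n → count P? (suc n) ≡ count P? n
  count-no n ¬Pn = ≡.trans (count-suc n) (≡.trans
    (≡.cong (λ l → count P? n ℕ.+ length l) (List.filter-reject P? {x = n} {xs = []} ¬Pn)) (ℕ.+-identityʳ (count P? n)))

  count-stable : ∀ n k → (∀ j → n ℕ.≤ j → ¬ P j) → count P? (n ℕ.+ k) ≡ count P? n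
  count-stable n zero    none = ≡.cong (count P?) (ℕ.+-identityʳ n)
  count-stable n (suc k) none = ≡.trans (≡.cong (count P?) (ℕ.+-suc n k))
    (≡.trans (count-no (n ℕ.+ k) (none (n ℕ.+ k) (ℕ.m≤m+n n k))) (count-stable n k none))

module QuarterCount (m : ℕ) .{{_ : ℕ.NonZero m}} (prime : Prime (suc (m ℕ.* 2)))
  (α : Fin m → ℤ) (representatives : RepresentsQuadraticResidues (suc (m ℕ.* 2)) α)
  (h : ℕ) (m≡ : m ≡ h ℕ.* 2) where

  open EulerCriterion m prime α representatives
  open CommutativeRing modularRing using (refl; sym; trans)

  private
    p : ℕ
    p = suc (m ℕ.* 2)

    Q : ℕ → Set
    Q r = 0 ℕ.< r × 4 ℕ.* r ℕ.< p × legendre (+ r) p ≡ -1ℤ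

    Q? : ∀ r → Dec (Q r)
    Q? r = 0 ℕ.<? r ×-dec 4 ℕ.* r ℕ.<? p ×-dec legendre (+ r) p ℤ.≟ -1ℤ

    p≡4h+1 : p ≡ suc (4 ℕ.* h)
    p≡4h+1 = ≡.trans (≡.cong (λ m → suc (m ℕ.* 2)) m≡) (≡.cong suc (≡.trans (ℕ.*-assoc h 2 2) (ℕ.*-comm h 4)))

    h<p : h ℕ.< p
    h<p = ≡.subst (h ℕ.<_) (≡.sym p≡4h+1) (ℕ.s≤s (ℕ.m≤n*m h 4))

  -- Passing from `n` to `n + 1` multiplies both sides by the symbol of `n + 1`. The count takes
  -- `suc n` because `upTo (suc n)` ends with `n`.
  power-counts : ∀ n → n ℕ.≤ h → -1ℤ ^ count Q? (suc n) ≈ X (n !)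
  power-counts zero    _   = sym (RootsOfUnity.1^n≈1 modularRing m)
  power-counts (suc n) n<h = cases (legendre-cases (m ℕ.* 2) (+ suc n))
    where
    step : ∀ {l} → X (suc n) ≈ l → l ℤ.* X (n !) ≈ X (suc n !)
    step eq = trans (*-cong (sym eq) refl) (sym (X-* (suc n) (n !)))

    IH : -1ℤ ^ count Q? (suc n) ≈ X (n !)
    IH = power-counts n (ℕ.<⇒≤ n<h)

    X≈ : X (suc n) ≈ legendre (+ suc n) p
    X≈ = X≈legendre (suc n)

    cases :
      (+ p ℤ.∣ + suc n × legendre (+ suc n) p ≡ 0ℤ) ⊎
      (QuadraticResidue p (+ suc n) × legendre (+ suc n) p ≡ 1ℤ) ⊎
      ((¬ + p ℤ.∣ + suc n) × (¬ QuadraticResidue p (+ suc n)) × legendre (+ suc n) p ≡ -1ℤ) →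
      -1ℤ ^ count Q? (suc (suc n)) ≈ X (suc n !)
    cases (inj₁ (p∣n , _)) = contradiction (ℤ.∣⇒∣ᵤ p∣n) (p∤ (ℕ.≤-<-trans n<h h<p))
    cases (inj₂ (inj₁ (_ , eq))) = trans
      (^-congʳ -1ℤ (count-no Q? (suc n) λ (_ , _ , eq′) → 1≢-1 (≡.trans (≡.sym eq) eq′)))
      (trans IH (trans (≡⇒≈ (≡.sym (ℤ.*-identityˡ (X (n !))))) (step (trans X≈ (≡⇒≈ eq)))))
      where
      1≢-1 : 1ℤ ≢ -1ℤ
      1≢-1 ()
    cases (inj₂ (inj₂ (_ , _ , eq))) = trans
      (^-congʳ -1ℤ (count-yes Q? (suc n) (ℕ.s≤s ℕ.z≤n , 4n<p , eq)))
      (trans (*-cong (refl {x = -1ℤ}) IH) (step (trans X≈ (≡⇒≈ eq))))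
      where
      4n<p : 4 ℕ.* suc n ℕ.< p
      4n<p = ≡.subst (4 ℕ.* suc n ℕ.<_) (≡.sym p≡4h+1) (ℕ.s≤s (ℕ.*-monoʳ-≤ 4 n<h))

  power-nonresidues : -1ℤ ^ nonresiduesBelowQuarter p ≈ X (h !)
  power-nonresidues = trans (^-congʳ -1ℤ counts) (power-counts h ℕ.≤-refl)
    where
    beyond : ∀ j → suc h ℕ.≤ j → ¬ Q j
    beyond j h<j (_ , 4j<p , _) = ℕ.<⇒≱ (≡.subst (4 ℕ.* j ℕ.<_) p≡4h+1 4j<p)
      (ℕ.≤-trans (ℕ.s≤s (ℕ.≤-trans (ℕ.m≤m+n (4 ℕ.* h) 3) (ℕ.≤-reflexive (ℕ.+-comm (4 ℕ.* h) 3))))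
        (ℕ.≤-trans (ℕ.≤-reflexive (≡.sym (ℕ.*-suc 4 h))) (ℕ.*-monoʳ-≤ 4 h<j)))

    counts : nonresiduesBelowQuarter p ≡ count Q? (suc h)
    -- `p = (h + 1) + 3h`, and from `h + 1` onwards `4 j < p` fails.
    counts = ≡.trans (≡.cong (count Q?) p≡4h+1) (count-stable Q? (suc h) (3 ℕ.* h) beyond)

-- Existence of the square root, and reciprocity for 3 and 5

odd-power-neg : ∀ x k → (ℤ.- x) ℤ.^ suc (k ℕ.* 2) ≡ ℤ.- (x ℤ.^ suc (k ℕ.* 2))
odd-power-neg x zero    = base x
  where
  base : ∀ x → (ℤ.- x) ℤ.* 1ℤ ≡ ℤ.- (x ℤ.* 1ℤ)
  base = ℤ.solve-∀
odd-power-neg x (suc k) = ≡.trans (≡.cong (λ y → (ℤ.- x) ℤ.* ((ℤ.- x) ℤ.* y)) (odd-power-neg x k))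
  (step x (x ℤ.^ suc (k ℕ.* 2)))
  where
  step : ∀ x y → (ℤ.- x) ℤ.* ((ℤ.- x) ℤ.* (ℤ.- y)) ≡ ℤ.- (x ℤ.* (x ℤ.* y))
  step = ℤ.solve-∀

S₂-square : ∀ {m} h → m ≡ h ℕ.* 2 → (α : Fin m → ℤ) → ∃[ s ] (s ℤ.* s ≡ S₂ (3 ℕ.+ m) -1ℤ α)
S₂-square h ≡.refl α = transport (SkewSymmetric.det-skew-square h A skew)
  where
  n = 3 ℕ.+ h ℕ.* 2
  A : Fin (h ℕ.* 2) → Fin (h ℕ.* 2) → ℤ
  A i j = (α i ℤ.+ -1ℤ ℤ.* α j) ℤ.^ n

  negate : ∀ a b → a ℤ.+ -1ℤ ℤ.* b ≡ ℤ.- (b ℤ.+ -1ℤ ℤ.* a)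
  negate = ℤ.solve-∀

  skew : SkewSymmetric.Skew A
  skew i j = ≡.trans (≡.cong (ℤ._^ n) (negate (α i) (α j)))
    -- The exponent `3 + 2h` is `1 + 2(h + 1)`, hence odd.
    (odd-power-neg (α j ℤ.+ -1ℤ ℤ.* α i) (suc h))

  transport : ∃[ s ] (s ℤ.* s ≡ Determinant.det ℤ.+-*-commutativeRing A) → ∃[ s ] (s ℤ.* s ≡ S₂ n -1ℤ α)
  transport (s , s²≡) = s , ≡.trans s²≡ (≡.sym (SkewSymmetric.det-Defs A))

distinct-prime∤ : ∀ {p q} .{{_ : ℕ.NonTrivial q}} → Prime p → q ℕ.< p → ¬ q ℕ.∣ p
distinct-prime∤ {p} {q} pr q<p q∣p = Sum.[ ℕ.nonTrivial⇒≢1 , (λ q≡p → ℕ.<⇒≢ q<p q≡p) ]′ (prime⇒irreducible pr q∣p)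

-1^even≡1 : ∀ t → -1ℤ ℤ.^ (t ℕ.* 2) ≡ 1ℤ
-1^even≡1 zero    = ≡.refl
-1^even≡1 (suc t) = ≡.cong (λ x → -1ℤ ℤ.* (-1ℤ ℤ.* x)) (-1^even≡1 t)

-1^small : ∀ n → -1ℤ ℤ.^ n ≡ 1ℤ ⊎ -1ℤ ℤ.^ n ≡ -1ℤ
-1^small zero    = inj₁ ≡.refl
-1^small (suc n) = Sum.[ (λ eq → inj₂ (≡.cong (-1ℤ ℤ.*_) eq)) , (λ eq → inj₁ (≡.cong (-1ℤ ℤ.*_) eq)) ]′ (-1^small n)

small-sign : ∀ {x y} → x ≡ 1ℤ ⊎ x ≡ -1ℤ → Small y → Small (x ℤ.* y)
small-sign (inj₁ ≡.refl) (inj₁ ≡.refl)        = inj₁ ≡.refl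
small-sign (inj₁ ≡.refl) (inj₂ (inj₁ ≡.refl)) = inj₂ (inj₁ ≡.refl)
small-sign (inj₁ ≡.refl) (inj₂ (inj₂ ≡.refl)) = inj₂ (inj₂ ≡.refl)
small-sign (inj₂ ≡.refl) (inj₁ ≡.refl)        = inj₁ ≡.refl
small-sign (inj₂ ≡.refl) (inj₂ (inj₁ ≡.refl)) = inj₂ (inj₂ ≡.refl)
small-sign (inj₂ ≡.refl) (inj₂ (inj₂ ≡.refl)) = inj₂ (inj₁ ≡.refl)

module Reciprocity (m h : ℕ) (m≡ : m ≡ h ℕ.* 2) (prime : Prime (suc (m ℕ.* 2))) (5<p : 5 ℕ.< suc (m ℕ.* 2)) where
  private
    p : ℕ
    p = suc (m ℕ.* 2)
  open PrimeField prime
  open QuadraticCharacter modularRing using (⟦_⟧)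
  open Supplements modularRing
  open CommutativeRing modularRing using (trans)

  -- Both sides depend only on `p` modulo 3: the left by the Gauss sum, the right by computing
  -- `legendre` at the remainder.
  [3/p]≈[p/3] : ⟦ 3 ⟧ ^ m ≈ legendre (+ p) 3
  [3/p]≈[p/3] = cases (p ℕ.% 3) (p ℕ./ 3) (ℕ.m%n<n p 3) (ℕ.m≡m%n+[m/n]*n p 3)
    where
    module T = Three h m m≡ prime n·1≈0
    cases : ∀ r k → r ℕ.< 3 → p ≡ r ℕ.+ k ℕ.* 3 → ⟦ 3 ⟧ ^ m ≈ legendre (+ p) 3
    cases 0 k _ p≡ = contradiction (ℕ.divides k p≡) (distinct-prime∤ prime (ℕ.<-trans (ℕ.≤ᵇ⇒≤ 4 5 _) 5<p))
    cases 1 k _ p≡ = trans (T.[3/p]≈1 k p≡) (≡⇒≈ (≡.sym (legendre-remainder 2 1 k p≡)))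
    cases 2 k _ p≡ = trans (T.[3/p]≈-1 k p≡) (≡⇒≈ (≡.sym (legendre-remainder 2 2 k p≡)))
    cases (suc (suc (suc _))) k (ℕ.s≤s (ℕ.s≤s (ℕ.s≤s ()))) _

  [5/p]≈[p/5] : ⟦ 5 ⟧ ^ m ≈ legendre (+ p) 5
  [5/p]≈[p/5] = cases (p ℕ.% 5) (p ℕ./ 5) (ℕ.m%n<n p 5) (ℕ.m≡m%n+[m/n]*n p 5)
    where
    module F = Five h m m≡ prime n·1≈0
    cases : ∀ r k → r ℕ.< 5 → p ≡ r ℕ.+ k ℕ.* 5 → ⟦ 5 ⟧ ^ m ≈ legendre (+ p) 5
    cases 0 k _ p≡ = contradiction (ℕ.divides k p≡) (distinct-prime∤ prime 5<p)
    cases 1 k _ p≡ = trans (F.[5/p]≈1 (k , inj₁ p≡)) (≡⇒≈ (≡.sym (legendre-remainder 4 1 k p≡)))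
    cases 2 k _ p≡ = trans (F.[5/p]≈-1 (k , inj₁ p≡)) (≡⇒≈ (≡.sym (legendre-remainder 4 2 k p≡)))
    cases 3 k _ p≡ = trans (F.[5/p]≈-1 (k , inj₂ p≡)) (≡⇒≈ (≡.sym (legendre-remainder 4 3 k p≡)))
    cases 4 k _ p≡ = trans (F.[5/p]≈1 (k , inj₂ p≡)) (≡⇒≈ (≡.sym (legendre-remainder 4 4 k p≡)))
    cases (suc (suc (suc (suc (suc _))))) k (ℕ.s≤s (ℕ.s≤s (ℕ.s≤s (ℕ.s≤s (ℕ.s≤s ()))))) _

m*2/4 : ∀ {m} h → m ≡ h ℕ.* 2 → m ℕ.* 2 ℕ./ 4 ≡ h
m*2/4 h ≡.refl = ≡.trans (≡.cong (ℕ._/ 4) (ℕ.*-assoc h 2 2)) (ℕ.m*n/n≡m h 4)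

parity : ∀ n → ∃[ t ] (n ≡ t ℕ.* 2 ⊎ n ≡ suc (t ℕ.* 2))
parity zero    = zero , inj₁ ≡.refl
parity (suc n) = next (parity n)
  where
  next : ∃[ t ] (n ≡ t ℕ.* 2 ⊎ n ≡ suc (t ℕ.* 2)) → ∃[ t ] (suc n ≡ t ℕ.* 2 ⊎ suc n ≡ suc (t ℕ.* 2))
  next (t , inj₁ eq) = t , inj₂ (≡.cong suc eq)
  next (t , inj₂ eq) = suc t , inj₁ (≡.cong suc eq)

-- The symbol of a square root when h is at least 2

module LegendreOfRoot (m h : ℕ) .{{_ : ℕ.NonZero m}} (m≡ : m ≡ h ℕ.* 2) (prime : Prime (suc (m ℕ.* 2)))
  (α : Fin m → ℤ) (representatives : RepresentsQuadraticResidues (suc (m ℕ.* 2)) α) where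

  open EulerCriterion m prime α representatives
  open QuarterCount m prime α representatives h m≡ using (power-nonresidues)
  open CommutativeRing modularRing using (refl; sym; trans)
  open Determinant modularRing using (det; det-cong)

  private
    p : ℕ
    p = suc (m ℕ.* 2)

    N : ℕ
    N = nonresiduesBelowQuarter p

  -1^N : X (h !) ≈ -1ℤ ℤ.^ N
  -1^N = trans (sym power-nonresidues) (≡⇒≈ (^≡ -1ℤ N))

  S₂-modular : S₂ (3 ℕ.+ m) -1ℤ α ≈ det (λ i j → (α i ℤ.- α j) ^ (m ℕ.+ 3))
  S₂-modular = trans (≡⇒≈ (det-modular (λ i j → (α i ℤ.+ -1ℤ ℤ.* α j) ℤ.^ (3 ℕ.+ m))))
    (det-cong {m} λ i j → ≡⇒≈ (≡.trans (≡.sym (^≡ (α i ℤ.+ -1ℤ ℤ.* α j) (3 ℕ.+ m)))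
      (≡.cong₂ _^_ (≡.cong (ℤ._+_ (α i)) (ℤ.-1*i≡-i (α j))) (ℕ.+-comm 3 m))))

  -- The formula is obtained modulo `p` only; since both sides are `0` or `±1` and `p > 2`, it holds
  -- in ℤ.
  conclude : ∀ {s} l → Small l → 2 ℕ.< p → s ^ m ≈ l ℤ.* X (h !) → legendre s p ≡ -1ℤ ℤ.^ N ℤ.* l
  conclude {s} l l-small 2<p sᵐ≈ = small-≡ 2<p (legendre-small (m ℕ.* 2) s)
    (small-sign (-1^small N) l-small)
    (congruent (trans (euler s) (trans sᵐ≈ (trans (*-cong (refl {x = l}) -1^N)
      (≡⇒≈ (ℤ.*-comm l (-1ℤ ℤ.^ N)))))))

  module _ (h′ : ℕ) (h≡ : h ≡ 2 ℕ.+ h′) (s : ℤ) (s²≡ : s ℤ.* s ≡ S₂ (3 ℕ.+ m) -1ℤ α) where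

    private
      module E = Evaluation modularRing

      s²≈ : s ℤ.* s ≈ det (λ i j → (α i ℤ.- α j) ^ (m ℕ.+ 3))
      s²≈ = trans (≡⇒≈ s²≡) S₂-modular

      5<p : 5 ℕ.< p
      5<p = ℕ.s≤s (ℕ.≤-trans (ℕ.≤ᵇ⇒≤ 5 8 _) (ℕ.*-monoˡ-≤ 2
        (≡.subst (4 ℕ.≤_) (≡.sym (≡.trans m≡ (≡.cong (ℕ._* 2) h≡))) (ℕ.m≤m+n 4 (h′ ℕ.* 2)))))

      2<p : 2 ℕ.< p
      2<p = ℕ.<-trans (ℕ.≤ᵇ⇒≤ 3 5 _) 5<p

      open Reciprocity m h m≡ prime 5<p

      modulus : ℕ → ℕ
      modulus k = ∣ + 4 ℤ.+ -1ℤ ℤ.^ k ∣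

      goal : ∀ {k q} → modulus k ≡ q → m ℕ.* 2 ℕ./ 4 ≡ k →
        legendre s p ≡ -1ℤ ℤ.^ N ℤ.* legendre (+ p) q →
        legendre s p ≡ -1ℤ ℤ.^ N ℤ.* legendre (+ p) (modulus (m ℕ.* 2 ℕ./ 4))
      goal q≡ k≡ eq = ≡.trans eq (≡.cong (λ q → -1ℤ ℤ.^ N ℤ.* legendre (+ p) q)
        (≡.sym (≡.trans (≡.cong modulus k≡) q≡)))

      -- For even `h` the stray factor `X 2` is one, and the modulus `4 + 1` matches the remaining
      -- `X 5`.
      even : ∀ t → h′ ≡ t ℕ.* 2 →
        legendre s p ≡ -1ℤ ℤ.^ N ℤ.* legendre (+ p) (modulus (m ℕ.* 2 ℕ./ 4))
      even t h′≡ = goal (≡.cong (λ x → ∣ + 4 ℤ.+ x ∣) (-1^even≡1 (suc t)))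
        (≡.trans (m*2/4 h m≡) h-even)
        (conclude {s} (legendre (+ p) 5) (legendre-small 4 (+ p)) 2<p (trans
          (E.χ[s]-even integral m prime n·1≈0 char fermat h h′ h≡ m≡ α α-distinct α-unity s²≈ t h′≡)
          (*-cong (trans (*-cong (Two.[2/p]≈1 h m m≡ prime n·1≈0 (suc t) h-even) [5/p]≈[p/5])
            (≡⇒≈ (ℤ.*-identityˡ (legendre (+ p) 5)))) (refl {x = X (h !)}))))
        where
        open Supplements modularRing using (module Two)
        h-even : h ≡ suc t ℕ.* 2
        h-even = ≡.trans h≡ (≡.cong (2 ℕ.+_) h′≡)

      odd : ∀ t → h′ ≡ suc (t ℕ.* 2) →
        legendre s p ≡ -1ℤ ℤ.^ N ℤ.* legendre (+ p) (modulus (m ℕ.* 2 ℕ./ 4))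
      odd t h′≡ = goal (≡.cong (λ x → ∣ + 4 ℤ.+ -1ℤ ℤ.* x ∣) (-1^even≡1 (suc t)))
        (≡.trans (m*2/4 h m≡) (≡.trans h≡ (≡.cong (2 ℕ.+_) h′≡)))
        (conclude {s} (legendre (+ p) 3) (legendre-small 2 (+ p)) 2<p (trans
          (E.χ[s]-odd integral m prime n·1≈0 char fermat h h′ h≡ m≡ α α-distinct α-unity s²≈ t h′≡)
          (*-cong [3/p]≈[p/3] (refl {x = X (h !)}))))

    legendre-root : legendre s p ≡ -1ℤ ℤ.^ N ℤ.* legendre (+ p) (modulus (m ℕ.* 2 ℕ./ 4))
    legendre-root = dispatch (parity h′)
      where
      dispatch : ∃[ t ] (h′ ≡ t ℕ.* 2 ⊎ h′ ≡ suc (t ℕ.* 2)) →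
        legendre s p ≡ -1ℤ ℤ.^ N ℤ.* legendre (+ p) (modulus (m ℕ.* 2 ℕ./ 4))
      dispatch (t , inj₁ eq) = even t eq
      dispatch (t , inj₂ eq) = odd t eq

-- The prime 5

module _ {c ℓ} (R : CommutativeRing c ℓ) where
  open CommutativeRing R hiding (zero)
  open CommutativeSemiringExp commutativeSemiring using (_^_; ^-congˡ)
  open IntegerCoefficients R using (solve; _:=_; _:+_; _:*_; _:-_; :-_; con; _:^_)
  open Determinant R using (det)

  -- The diagonal is zero and the exponent odd, so the determinant is `((β₀ - β₁)²) ^ 5`, where
  -- `(β₀ - β₁)² = 1 + 1 - 2 β₀ β₁ = 4`.
  det-fifth-powers : ∀ (β : Fin 2 → Carrier) → (∀ i → β i * β i ≈ 1#) → β zero * (β (suc zero) * 1#) ≈ - 1# →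
    det (λ i j → (β i - β j) ^ 5) ≈ ((1# + 1#) * (1# + 1#)) ^ 5
  det-fifth-powers β β² β₀β₁ = trans
    (solve 2 (λ a b →
      con 1ℤ :* ((a :- a) :^ 5) :* (con 1ℤ :* ((b :- b) :^ 5) :* con 1ℤ :+ con 0ℤ)
      :+ ((:- con 1ℤ) :* con 1ℤ :* ((a :- b) :^ 5) :* (con 1ℤ :* ((b :- a) :^ 5) :* con 1ℤ :+ con 0ℤ) :+ con 0ℤ)
      := (a :* a :+ b :* b :- (con 1ℤ :+ con 1ℤ) :* (a :* (b :* con 1ℤ))) :^ 5) refl (β zero) (β (suc zero)))
    (^-congˡ 5 (trans (+-cong (+-cong (β² zero) (β² (suc zero))) (-‿cong (*-congˡ β₀β₁)))
      (solve 0 (con 1ℤ :+ con 1ℤ :- (con 1ℤ :+ con 1ℤ) :* (:- con 1ℤ) := (con 1ℤ :+ con 1ℤ) :* (con 1ℤ :+ con 1ℤ)) refl)))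

module ModuloFive (prime : Prime 5) (α : Fin 2 → ℤ) (representatives : RepresentsQuadraticResidues 5 α) where
  open EulerCriterion 2 prime α representatives
  open LegendreOfRoot 2 1 ≡.refl prime α representatives using (S₂-modular)
  open CommutativeRing modularRing using (trans)

  α² : ∀ i → α i ℤ.* α i ≈ 1ℤ
  α² i = trans (≡⇒≈ (≡.cong (α i ℤ.*_) (≡.sym (ℤ.*-identityʳ (α i))))) (α-unity i)

  -- Here `m = 2`, so the symbol of `s` is `s²` modulo 5, that is `4⁵ = 1024 = 5 · 205 - 1`.
  legendre-root-5 : ∀ s → s ℤ.* s ≡ S₂ 5 -1ℤ α → legendre s 5 ≡ -1ℤ
  legendre-root-5 s s²≡ = small-≡ (ℕ.≤ᵇ⇒≤ 3 5 _) (legendre-small 4 s) (inj₂ (inj₂ ≡.refl))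
    (congruent (trans (euler s) (trans (≡⇒≈ (≡.cong (s ℤ.*_) (ℤ.*-identityʳ s)))
      (trans (≡⇒≈ s²≡) (trans S₂-modular (trans
        (det-fifth-powers modularRing α α² (RootsOfUnity.unity-product modularRing integral (≡⇒≈ ≡.refl) α α-distinct α-unity))
        4⁵≈-1))))))
    where
    4⁵≈-1 : + 1024 ≈ -1ℤ
    4⁵≈-1 = mod (ℤ.divides (+ 205) ≡.refl)

-- Assembly according to h = (p - 1)/4

-- `m` and `p` are variables tied by equations, so that matching can replace them; in the theorem
-- they are quotients that do not reduce.
square-root-and-symbol : ∀ h m p → m ≡ h ℕ.* 2 → p ≡ suc (m ℕ.* 2) → Prime p →
  ∀ (α : Fin m → ℤ) → RepresentsQuadraticResidues p α →
  (∃[ s ] (s ℤ.* s ≡ S₂ (3 ℕ.+ m) -1ℤ α)) ×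
  (∀ (s : ℤ) → s ℤ.* s ≡ S₂ (3 ℕ.+ m) -1ℤ α →
    legendre s p ≡
      -1ℤ ℤ.^ nonresiduesBelowQuarter p ℤ.*
      legendre (+ p) ∣ + 4 ℤ.+ -1ℤ ℤ.^ ((p ℕ.∸ 1) ℕ./ 4) ∣)
square-root-and-symbol 0 .0 .1 ≡.refl ≡.refl pr = contradiction pr ¬prime[1]
-- For `p = 5` the right side computes to `-1`: the only candidate below 5/4 is the residue 1, and 5
-- is a nonresidue modulo 3.
square-root-and-symbol 1 .2 .5 ≡.refl ≡.refl pr α reps =
  S₂-square 1 ≡.refl α , ModuloFive.legendre-root-5 pr α reps
square-root-and-symbol h@(suc (suc h′)) m .(suc (m ℕ.* 2)) m≡ ≡.refl pr α reps =
  S₂-square h m≡ α , LegendreOfRoot.legendre-root m h {{m≢0}} m≡ pr α reps h′ ≡.refl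
  where
  m≢0 : ℕ.NonZero m
  m≢0 = ≡.subst ℕ.NonZero (≡.sym m≡) _

open import Data.Integer.Base using (_+_; _*_; _^_)

corollary1p12 : ∀ (p : ℕ) → Prime p → p % 4 ≡ 1 →
    ∀ (α : Fin ((p ∸ 1) / 2) → ℤ) → RepresentsQuadraticResidues p α →
    (∃[ s ] (s * s ≡ S₂ (3 ℕ.+ (p ∸ 1) / 2) -1ℤ α)) ×
    (∀ (s : ℤ) → s * s ≡ S₂ (3 ℕ.+ (p ∸ 1) / 2) -1ℤ α →
    legendre s p ≡
    -1ℤ ^ nonresiduesBelowQuarter p *
    legendre (+ p) ∣ + 4 + -1ℤ ^ ((p ∸ 1) / 4) ∣)
corollary1p12 p pr p%4≡1 = square-root-and-symbol h ((p ∸ 1) / 2) p m≡ p≡′ pr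
  where
  h : ℕ
  h = p / 4
  p≡ : p ≡ suc (h ℕ.* 2 ℕ.* 2)
  p≡ = ≡.trans (ℕ.m≡m%n+[m/n]*n p 4) (≡.cong₂ ℕ._+_ p%4≡1 (≡.sym (ℕ.*-assoc h 2 2)))
  m≡ : (p ∸ 1) / 2 ≡ h ℕ.* 2
  m≡ = ≡.trans (≡.cong (λ q → (q ∸ 1) / 2) p≡) (ℕ.m*n/n≡m (h ℕ.* 2) 2)
  p≡′ : p ≡ suc ((p ∸ 1) / 2 ℕ.* 2)
  p≡′ = ≡.trans p≡ (≡.cong (λ m → suc (m ℕ.* 2)) (≡.sym m≡))
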